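{- Let $n\ge 3$ and let $x\in S^n$ be a square point. Then $\frac{10}{7}x\in T^n$.
   Context: $K_n=(V_n,E_n)$ is the complete graph on $n$ nodes. For $U\subseteq V_n$, $\delta(U)$ is the set of edges with exactly one endpoint in $U$, and for $F\subseteq E_n$, $x(F)=\sum_{e\in F}x_e$. The subtour elimination polytope is $S^n=\{x\in\mathbb{R}^{E_n}: x(\delta(v))=2 \ \forall v\in V_n,\ x(\delta(S))\ge 2\ \forall \emptyset\ne S\subsetneq V_n,\ 0\le x_e\le 1\ \forall e\in E_n\}$. A tour is a multiset $J$ of edges of $K_n$ such that the multigraph $(V_n,J)$ is connected and every node has even degree; its incidence vector $\chi^J\in\mathbb{R}^{E_n}$ has $\chi^J_e$ equal to the multiplicity of $e$ in $J$ (multiplicities may be arbitrarily large). $T^n$ is the convex hull of the incidence vectors of all tours of $K_n$. A point $x\in S^n$ is $\frac12$-integer if $x_e\in\{0,\frac12,1\}$ for all $e$; edges with $x_e=\frac12$ are called $\frac12$-edges. A square point is a $\frac12$-integer point $x\in S^n$ whose $\frac12$-edges form a node-disjoint union of $4$-cycles. -}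

module Defs where

open import Data.Bool using (Bool; true; false; _xor_; T)
open import Data.Nat as ℕ using (ℕ)
open import Data.Nat.Divisibility using (_∣_)
open import Data.Integer using (+_)
open import Data.Rational using (ℚ; _/_; 0ℚ; 1ℚ; ½; _+_; _*_; _≤_)
open import Data.Fin using (Fin; _<_; _<?_)
open import Data.List using (List; []; _∷_; [_]; concatMap; map; foldr; filter)
open import Data.List.Membership.Propositional using (_∈_)
open import Data.List.Relation.Unary.All using (All)
open import Data.List.Relation.Unary.Any using (Any)
open import Data.List.Relation.Unary.AllPairs using (AllPairs)
open import Data.Product using (Σ; Σ-syntax; ∃; ∃-syntax; _×_; _,_; proj₁; proj₂)
open import Data.Sum using (_⊎_)
open import Data.Vec.Functional using (Vector)
open import Data.List using (allFin)
open import Relation.Nullary using (¬_; yes; no)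
open import Relation.Binary.PropositionalEquality using (_≡_; _≢_)
open import Function.Bundles using (_⇔_)

-- Nodes of K_n are Fin n.  An edge {i,j} of K_n is represented uniquely
-- as an ordered pair (i , j) with i < j.
Edge : ℕ → Set
Edge n = Σ[ p ∈ Fin n × Fin n ] proj₁ p < proj₂ p

end₁ end₂ : ∀ {n} → Edge n → Fin n
end₁ ((i , j) , _) = i
end₂ ((i , j) , _) = j

allEdges : (n : ℕ) → List (Edge n)
allEdges n = concatMap (λ i → concatMap (λ j → pick i j) (allFin n)) (allFin n)
  where
  pick : Fin n → Fin n → List (Edge n)
  pick i j with i <? j
  ... | yes p = [ ((i , j) , p) ]
  ... | no _  = []

NodeSet : ℕ → Set
NodeSet n = Fin n → Bool

δ : ∀ {n} → NodeSet n → List (Edge n)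
δ {n} U = filter (λ e → Data.Bool._≟_ (U (end₁ e) xor U (end₂ e)) true) (allEdges n)
  where import Data.Bool

singleton : ∀ {n} → Fin n → NodeSet n
singleton v w with Data.Fin._≟_ v w
  where import Data.Fin
... | yes _ = true
... | no _  = false

sumℚ : List ℚ → ℚ
sumℚ = foldr _+_ 0ℚ

sumℕ : List ℕ → ℕ
sumℕ = foldr ℕ._+_ 0

x[_] : ∀ {n} → (Edge n → ℚ) → List (Edge n) → ℚ
x[ x ] F = sumℚ (map x F)

Nonempty Proper : ∀ {n} → NodeSet n → Set
Nonempty {n} U = ∃[ v ] U v ≡ true
Proper   {n} U = ∃[ v ] U v ≡ false

InSEP : (n : ℕ) → (Edge n → ℚ) → Set
InSEP n x =
  (∀ (v : Fin n) → x[ x ] (δ (singleton v)) ≡ + 2 / 1) ×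
  (∀ (U : NodeSet n) → Nonempty U → Proper U → + 2 / 1 ≤ x[ x ] (δ U)) ×
  (∀ (e : Edge n) → 0ℚ ≤ x e × x e ≤ 1ℚ)

HalfInteger : ∀ {n} → (Edge n → ℚ) → Set
HalfInteger x = ∀ e → x e ≡ 0ℚ ⊎ x e ≡ ½ ⊎ x e ≡ 1ℚ

Quad : ℕ → Set
Quad n = Fin n × Fin n × Fin n × Fin n

quadNodes : ∀ {n} → Quad n → List (Fin n)
quadNodes (a , b , c , d) = a ∷ b ∷ c ∷ d ∷ []

Distinct4 : ∀ {n} → Quad n → Set
Distinct4 q = AllPairs _≢_ (quadNodes q)

Joins : ∀ {n} → Edge n → Fin n → Fin n → Set
Joins e u v = (end₁ e ≡ u × end₂ e ≡ v) ⊎ (end₁ e ≡ v × end₂ e ≡ u)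

EdgeOfQuad : ∀ {n} → Edge n → Quad n → Set
EdgeOfQuad e (a , b , c , d) = Joins e a b ⊎ Joins e b c ⊎ Joins e c d ⊎ Joins e d a

NodeDisjoint : ∀ {n} → Quad n → Quad n → Set
NodeDisjoint q r = All (λ u → All (λ w → u ≢ w) (quadNodes r)) (quadNodes q)

SquarePoint : (n : ℕ) → (Edge n → ℚ) → Set
SquarePoint n x = InSEP n x × HalfInteger x ×
  (∃[ Q ] (All Distinct4 Q × AllPairs NodeDisjoint Q ×
           (∀ e → x e ≡ ½ ⇔ Any (EdgeOfQuad e) Q)))

Multiset : ℕ → Set
Multiset n = Edge n → ℕ

data Reach {n} (m : Multiset n) : Fin n → Fin n → Set where
  here : ∀ {u} → Reach m u u
  step : ∀ {u w v} (e : Edge n) → Joins e u w → ℕ.NonZero (m e) →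
         Reach m w v → Reach m u v

Connected : ∀ {n} → Multiset n → Set
Connected m = ∀ u v → Reach m u v

deg : ∀ {n} → Multiset n → Fin n → ℕ
deg m v = sumℕ (map m (δ (singleton v)))

IsTour : (n : ℕ) → Multiset n → Set
IsTour n m = Connected m × (∀ v → 2 ∣ deg m v)

toℚ : ℕ → ℚ
toℚ k = + k / 1

InTourPolytope : (n : ℕ) → (Edge n → ℚ) → Set
InTourPolytope n y =
  Σ[ L ∈ List (ℚ × Multiset n) ] (All (λ p → 0ℚ ≤ proj₁ p × IsTour n (proj₂ p)) L ×
          sumℚ (map proj₁ L) ≡ 1ℚ ×
          (∀ e → sumℚ (map (λ p → proj₁ p * toℚ (proj₂ p e)) L) ≡ y e))

{-# OPTIONS --safe #-}

-- Write x = 1 + ½A + ½B, where 1 stands for the edges of value one and each square is split into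
-- opposite pairs A and B.  The split can be chosen so that H = 1 + A is connected, hence a
-- Hamiltonian cycle: if both orientations of a square disconnected the graph, the intersection of
-- the two cuts would be an odd cut of the even graph H.  By matroid intersection, x is a convex
-- combination of connected spanning F that use exactly one edge of every pair A.  For such F the
-- vector z = ½1 + ⅙A + ⅓B dominates a convex combination of the J with F + J even: on a cut, 6z is
-- |H| + 2|1 + B| while 2x is |H| + |1 + B|, and |H| ≥ 2 is even, so z ≥ 1 follows from x ≥ 2 except
-- on cuts made of two pairs A, and those meet F in two edges.  Finally 10/7 x = 1/7 H + 6/7 (x + z),
-- and domination suffices because doubled edges may be added to tours.
--
-- Both polyhedral theorems are proved by moving a point along ± a direction that keeps the tight
-- constraints tight.  The direction is an edge weighting with zero vertex sums in a graph of minimum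
-- degree two, whose vertices are tight nodes for T-joins, and classes of elements lying in the same
-- tight sets together with the pairs for matroid intersection.

module Submission where

open import Data.Bool using (Bool; true; false; _xor_; _∧_; _∨_; not; if_then_else_)
import Data.Bool as B
import Data.Bool.Properties as BP
open import Data.Nat as ℕ using (ℕ; zero; suc)
import Data.Nat.Properties as ℕP
import Data.Nat.Tactic.RingSolver as NS
open import Data.Nat.Divisibility using (_∣_; divides)
import Data.Integer as ℤ
import Data.Integer.Properties as ℤP
open import Data.Rational
  using (ℚ; _/_; 0ℚ; 1ℚ; ½; _+_; _*_; _-_; -_; _≤_; _<_; 1/_; ≢-nonZero)
import Data.Rational as ℚ
import Data.Rational.Properties as ℚP
import Data.Rational.Unnormalised as ℚᵘ
import Data.Rational.Unnormalised.Properties as ℚᵘP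
open import Data.Fin using (Fin; zero; suc)
import Data.Fin as F
import Data.Fin.Properties as FP
open import Data.List using (List; []; _∷_; _++_; map; length; filter; allFin; tabulate; concatMap)
import Data.List.Properties as LP
open import Data.List.Membership.Propositional using (_∈_; find; lose)
import Data.List.Membership.Propositional.Properties as MP
open import Data.List.Relation.Unary.All as All using (All; []; _∷_)
import Data.List.Relation.Unary.All.Properties as AllP
open import Data.List.Relation.Unary.AllPairs using (AllPairs; []; _∷_)
open import Data.List.Relation.Unary.Any as Any using (Any; here; there)
open import Data.List.Relation.Binary.Pointwise using (Pointwise; []; _∷_)
open import Data.Product using (Σ-syntax; ∃; ∃-syntax; _×_; _,_; proj₁; proj₂)
open import Data.Sum using (_⊎_; inj₁; inj₂)
open import Data.Empty using (⊥; ⊥-elim)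
open import Function using (_∘_)
open import Function.Bundles using (Equivalence)
open import Relation.Nullary using (¬_; Dec; yes; no; does)
open import Relation.Nullary.Decidable using (dec⇒maybe; ⌊_⌋; ¬?; _×-dec_; _⊎-dec_; _→-dec_)
open import Relation.Binary using (tri<; tri≈; tri>)
open import Relation.Binary.PropositionalEquality
  using (_≡_; _≢_; refl; sym; trans; cong; cong₂; subst; subst₂; module ≡-Reasoning)
open import Algebra.Bundles using (CommutativeRing)
import Algebra.Properties.Semiring.Sum as SemiringSum
open import Tactic.RingSolver using (solve-∀)
open import Tactic.RingSolver.Core.AlmostCommutativeRing
  using (AlmostCommutativeRing; fromCommutativeRing)
open import Defs
  using (toℚ; sumℚ; sumℕ; Edge; end₁; end₂; allEdges; singleton; Joins; Quad; quadNodes; Distinct4;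
         NodeDisjoint; EdgeOfQuad; SquarePoint; Multiset; Reach; Connected; deg; IsTour; InTourPolytope)

-- The constants solve a small optimisation problem. Let a cut contain h edges of `1 + A` and j
-- edges of `1 + B`, so that h ≥ 2 is even and h + j ≥ 4. A weight p h + q j that is at least one on
-- all of these cuts must in particular cover (h , j) = (4 , 0), which is expensive. Rainbow forests
-- cross such a cut evenly and excuse it, and then the minimal cases are (2 , 2), (4 , 1) and (6 ,
-- 0); p = 1/6 and q = 1/3 make all three tight. Edgewise x + z is then 2/3 h + 5/6 j, and the tour
-- `H`, taken with weight t, evens this out: t + 2/3 (1 - t) = 5/6 (1 - t) gives t = 1/7 and the
-- common coefficient 5/7, which is 10/7 of the coefficient 1/2 in x. The join polyhedron is
-- unbounded upwards, so a direction may never meet a new constraint. Asking only for domination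
-- makes this harmless: the move in the opposite sense then ends below the starting point.
-- Contractions are idempotent maps on the nodes, so edges keep their indices and vectors their
-- length, and loops are allowed.

ℚ-ring : AlmostCommutativeRing _ _
ℚ-ring = fromCommutativeRing ℚP.+-*-commutativeRing (λ q → dec⇒maybe (0ℚ ℚP.≟ q))

module ℚΣ = SemiringSum (CommutativeRing.semiring ℚP.+-*-commutativeRing)
module ℕΣ = SemiringSum ℕP.+-*-semiring
module 𝔹Σ = SemiringSum (CommutativeRing.semiring BP.xor-∧-commutativeRing)

opaque
  ∑ : ∀ {n} → (Fin n → ℚ) → ℚ
  ∑ = ℚΣ.sum

  ∑ℕ : ∀ {n} → (Fin n → ℕ) → ℕ
  ∑ℕ = ℕΣ.sum

  ⨁ : ∀ {n} → (Fin n → Bool) → Bool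
  ⨁ = 𝔹Σ.sum

⟦_⟧ : Bool → ℚ
⟦ true ⟧  = 1ℚ
⟦ false ⟧ = 0ℚ

⟦_⟧ℕ : Bool → ℕ
⟦ true ⟧ℕ  = 1
⟦ false ⟧ℕ = 0

≢true : ∀ {b} → b ≢ true → b ≡ false
≢true {false} _ = refl
≢true {true}  h = ⊥-elim (h refl)

true≢false : ∀ {b} → b ≡ true → b ≡ false → ⊥
true≢false refl ()

∧-true : ∀ {a b} → a ∧ b ≡ true → a ≡ true × b ≡ true
∧-true {true} {true} _ = refl , refl

_==_ : ∀ {n} → Fin n → Fin n → Bool
i == j = ⌊ i F.≟ j ⌋

==-refl : ∀ {n} (i : Fin n) → (i == i) ≡ true
==-refl i with i F.≟ i
... | yes _ = refl
... | no h  = ⊥-elim (h refl)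

==-≢ : ∀ {n} {i j : Fin n} → i ≢ j → (i == j) ≡ false
==-≢ {i = i} {j} h with i F.≟ j
... | yes e = ⊥-elim (h e)
... | no _  = refl

==⇒≡ : ∀ {n} {i j : Fin n} → (i == j) ≡ true → i ≡ j
==⇒≡ {i = i} {j} h with i F.≟ j
... | yes e = e

==-sym : ∀ {n} (i j : Fin n) → (i == j) ≡ (j == i)
==-sym i j with i F.≟ j
... | yes refl = sym (==-refl i)
... | no h     = sym (==-≢ (h ∘ sym))

-- Rational arithmetic

≤-by : ∀ {p q c} → 0ℚ ≤ c → q ≡ p + c → p ≤ q
≤-by {p} {q} {c} h e =
  subst₂ _≤_ (ℚP.+-identityʳ p) (sym e) (ℚP.+-monoʳ-≤ p h)

0≤- : ∀ {p q} → p ≤ q → 0ℚ ≤ q - p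
0≤- {p} {q} h = subst (_≤ q - p) (ℚP.+-inverseʳ p) (ℚP.+-monoˡ-≤ (- p) h)

0≤-⁻ : ∀ {p q} → 0ℚ ≤ q - p → p ≤ q
0≤-⁻ {p} {q} h = ≤-by h (lem p q)
  where
  lem : ∀ p q → q ≡ p + (q - p)
  lem = solve-∀ ℚ-ring

-≡0⇒≡ : ∀ {p q} → p - q ≡ 0ℚ → p ≡ q
-≡0⇒≡ {p} {q} h = trans (lem p q) (trans (cong (_+ q) h) (ℚP.+-identityˡ q))
  where
  lem : ∀ p q → p ≡ p - q + q
  lem = solve-∀ ℚ-ring

0≤+ : ∀ {p q} → 0ℚ ≤ p → 0ℚ ≤ q → 0ℚ ≤ p + q
0≤+ h k = ℚP.+-mono-≤ h k

0≤* : ∀ {p q} → 0ℚ ≤ p → 0ℚ ≤ q → 0ℚ ≤ p * q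
0≤* {p} {q} h k =
  subst (_≤ p * q) (ℚP.*-zeroʳ p) (ℚP.*-monoˡ-≤-nonNeg p {{ℚ.nonNegative h}} k)

*-mono-≤ʳ : ∀ {r p q} → 0ℚ ≤ r → p ≤ q → r * p ≤ r * q
*-mono-≤ʳ {r} h k = ℚP.*-monoˡ-≤-nonNeg r {{ℚ.nonNegative h}} k

0<* : ∀ {p q} → 0ℚ < p → 0ℚ < q → 0ℚ < p * q
0<* {p} {q} h k = subst (_< p * q) (ℚP.*-zeroʳ p) (ℚP.*-monoʳ-<-pos p {{ℚ.positive h}} k)

<-by : ∀ {p q c} → 0ℚ < c → q ≡ p + c → p < q
<-by {p} {q} {c} h e =
  subst₂ _<_ (ℚP.+-identityʳ p) (sym e) (ℚP.+-monoʳ-< p h)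

0<- : ∀ {p q} → p < q → 0ℚ < q - p
0<- {p} {q} h = subst (_< q - p) (ℚP.+-inverseʳ p) (ℚP.+-monoˡ-< (- p) h)

0<1 : 0ℚ < 1ℚ
0<1 = ℚ.*<* (ℤ.+<+ (ℕ.s≤s ℕ.z≤n)) where import Data.Integer as ℤ

0≤1 : 0ℚ ≤ 1ℚ
0≤1 = ℚP.<⇒≤ 0<1

1≢0 : 1ℚ ≢ 0ℚ
1≢0 ()

≤∧≢⇒< : ∀ {p q} → p ≤ q → p ≢ q → p < q
≤∧≢⇒< {p} {q} h ne with ℚP.<-cmp p q
... | tri< l _ _ = l
... | tri≈ _ e _ = ⊥-elim (ne e)
... | tri> _ _ g = ⊥-elim (ne (ℚP.≤-antisym h (ℚP.<⇒≤ g)))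

<⇒≱ : ∀ {p q} → p < q → q ≤ p → ⊥
<⇒≱ h k = ℚP.<-irrefl refl (ℚP.<-≤-trans h k)

-- A reciprocal as plain data avoids threading NonZero instances.
inverse : ∀ q → q ≢ 0ℚ → ∃[ r ] r * q ≡ 1ℚ
inverse q h = (1/ q) {{≢-nonZero h}} , ℚP.*-inverseˡ q {{≢-nonZero h}}

inverse⁺ : ∀ q → 0ℚ < q → ∃[ r ] 0ℚ < r × r * q ≡ 1ℚ
inverse⁺ q h with inverse q (λ e → ℚP.<-irrefl (sym e) h)
... | r , e with ℚP.<-cmp r 0ℚ
... | tri> _ _ g = r , g , e
... | tri≈ _ refl _ = ⊥-elim (1≢0 (trans (sym e) (ℚP.*-zeroˡ q)))
... | tri< l _ _ = ⊥-elim (<⇒≱ 0<1 (subst (_≤ 0ℚ) e (subst (r * q ≤_) (ℚP.*-zeroˡ q)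
                     (ℚP.*-monoʳ-≤-nonNeg q {{ℚ.nonNegative (ℚP.<⇒≤ h)}} (ℚP.<⇒≤ l)))))

0≤⟦⟧ : ∀ b → 0ℚ ≤ ⟦ b ⟧
0≤⟦⟧ true  = 0≤1
0≤⟦⟧ false = ℚP.≤-refl

-- Sums over Fin n

==-suc : ∀ {n} (i j : Fin n) → (suc i == suc j) ≡ (i == j)
==-suc i j with i F.≟ j
... | yes refl = refl
... | no _     = refl

opaque
  unfolding ∑ ∑ℕ ⨁

  ∑-cong : ∀ {n} {f g : Fin n → ℚ} → (∀ i → f i ≡ g i) → ∑ f ≡ ∑ g
  ∑-cong = ℚΣ.sum-cong-≗

  ⨁-cong : ∀ {n} {f g : Fin n → Bool} → (∀ i → f i ≡ g i) → ⨁ f ≡ ⨁ g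
  ⨁-cong = 𝔹Σ.sum-cong-≗

  ∑ℕ-cong : ∀ {n} {f g : Fin n → ℕ} → (∀ i → f i ≡ g i) → ∑ℕ f ≡ ∑ℕ g
  ∑ℕ-cong = ℕΣ.sum-cong-≗

  ∑-+ : ∀ {n} (f g : Fin n → ℚ) → ∑ (λ i → f i + g i) ≡ ∑ f + ∑ g
  ∑-+ = ℚΣ.∑-distrib-+

  ∑-* : ∀ {n} r (f : Fin n → ℚ) → ∑ (λ i → r * f i) ≡ r * ∑ f
  ∑-* r f = sym (ℚΣ.*-distribˡ-sum r f)

  ∑-zero : ∀ {n} {f : Fin n → ℚ} → (∀ i → f i ≡ 0ℚ) → ∑ f ≡ 0ℚ
  ∑-zero {n} h = trans (∑-cong h) (ℚΣ.sum-replicate-zero n)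

  ⨁-xor : ∀ {n} (f g : Fin n → Bool) → ⨁ (λ i → f i xor g i) ≡ ⨁ f xor ⨁ g
  ⨁-xor = 𝔹Σ.∑-distrib-+

  ∑-comm : ∀ {m n} (f : Fin m → Fin n → ℚ) →
    ∑ (λ i → ∑ (f i)) ≡ ∑ (λ j → ∑ (λ i → f i j))
  ∑-comm = ℚΣ.∑-comm

  ∑ℕ-+ : ∀ {n} (f g : Fin n → ℕ) → ∑ℕ (λ i → f i ℕ.+ g i) ≡ ∑ℕ f ℕ.+ ∑ℕ g
  ∑ℕ-+ = ℕΣ.∑-distrib-+

  ∑ℕ-* : ∀ {n} r (f : Fin n → ℕ) → ∑ℕ (λ i → r ℕ.* f i) ≡ r ℕ.* ∑ℕ f
  ∑ℕ-* r f = sym (ℕΣ.*-distribˡ-sum r f)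

  ∑ℕ-comm : ∀ {m n} (f : Fin m → Fin n → ℕ) →
    ∑ℕ (λ i → ∑ℕ (f i)) ≡ ∑ℕ (λ j → ∑ℕ (λ i → f i j))
  ∑ℕ-comm = ℕΣ.∑-comm

  ∑ℕ-zero : ∀ {n} {f : Fin n → ℕ} → (∀ i → f i ≡ 0) → ∑ℕ f ≡ 0
  ∑ℕ-zero {n} h = trans (∑ℕ-cong h) (ℕΣ.sum-replicate-zero n)

  ⨁-zero : ∀ {n} {f : Fin n → Bool} → (∀ i → f i ≡ false) → ⨁ f ≡ false
  ⨁-zero {n} h = trans (⨁-cong h) (𝔹Σ.sum-replicate-zero n)

  ∑-mono : ∀ {n} {f g : Fin n → ℚ} → (∀ i → f i ≤ g i) → ∑ f ≤ ∑ g
  ∑-mono {zero}  h = ℚP.≤-refl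
  ∑-mono {suc n} h = ℚP.+-mono-≤ (h zero) (∑-mono (h ∘ suc))

  ∑-nonneg : ∀ {n} {f : Fin n → ℚ} → (∀ i → 0ℚ ≤ f i) → 0ℚ ≤ ∑ f
  ∑-nonneg {zero}  h = ℚP.≤-refl
  ∑-nonneg {suc n} h = 0≤+ (h zero) (∑-nonneg (h ∘ suc))

  term≤∑ : ∀ {n} {f : Fin n → ℚ} → (∀ i → 0ℚ ≤ f i) → ∀ i → f i ≤ ∑ f
  term≤∑ {suc n} {f} h zero    = ≤-by (∑-nonneg (h ∘ suc)) refl
  term≤∑ {suc n} {f} h (suc i) =
    ℚP.≤-trans (term≤∑ (h ∘ suc) i) (≤-by (h zero) (ℚP.+-comm (f zero) _))

  ∑≡0⇒ : ∀ {n} {f : Fin n → ℚ} → (∀ i → 0ℚ ≤ f i) → ∑ f ≡ 0ℚ → ∀ i → f i ≡ 0ℚ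
  ∑≡0⇒ h e i = ℚP.≤-antisym (subst (_ ≤_) e (term≤∑ h i)) (h i)

  ∑-single : ∀ {n} (a : Fin n) (f : Fin n → ℚ) → ∑ (λ i → ⟦ i == a ⟧ * f i) ≡ f a
  ∑-single zero f = trans (cong₂ _+_ (ℚP.*-identityˡ (f zero))
    (∑-zero {f = λ i → 0ℚ * f (suc i)} (λ i → ℚP.*-zeroˡ (f (suc i)))))
    (ℚP.+-identityʳ (f zero))
  ∑-single (suc a) f = trans (cong₂ _+_ (ℚP.*-zeroˡ (f zero))
      (trans (∑-cong (λ i → cong (λ b → ⟦ b ⟧ * f (suc i)) (==-suc i a))) (∑-single a (f ∘ suc))))
    (ℚP.+-identityˡ (f (suc a)))

  ⨁-single : ∀ {n} (a : Fin n) (f : Fin n → Bool) → ⨁ (λ i → (i == a) ∧ f i) ≡ f a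
  ⨁-single zero f = trans (cong (f zero xor_) (⨁-zero {f = λ i → (suc i == zero) ∧ f (suc i)} (λ i → refl)))
    (lem (f zero))
    where
    lem : ∀ b → b xor false ≡ b
    lem true  = refl
    lem false = refl
  ⨁-single (suc a) f =
    trans (⨁-cong (λ i → cong (_∧ f (suc i)) (==-suc i a))) (⨁-single a (f ∘ suc))

  ∑ℕ-single : ∀ {n} (a : Fin n) (f : Fin n → ℕ) → ∑ℕ (λ i → ⟦ i == a ⟧ℕ ℕ.* f i) ≡ f a
  ∑ℕ-single {suc n} zero f = trans (cong₂ ℕ._+_ (ℕP.*-identityˡ (f zero))
     (ℕΣ.sum-replicate-zero n)) (ℕP.+-identityʳ _)
  ∑ℕ-single (suc a) f =
    trans (∑ℕ-cong (λ i → cong (λ b → ⟦ b ⟧ℕ ℕ.* f (suc i)) (==-suc i a))) (∑ℕ-single a (f ∘ suc))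

  ∑ℕ-mono : ∀ {n} {f g : Fin n → ℕ} → (∀ i → f i ℕ.≤ g i) → ∑ℕ f ℕ.≤ ∑ℕ g
  ∑ℕ-mono {zero}  h = ℕ.z≤n
  ∑ℕ-mono {suc n} h = ℕP.+-mono-≤ (h zero) (∑ℕ-mono (h ∘ suc))

  ∑ℕ-tight : ∀ {n} {f g : Fin n → ℕ} → (∀ i → f i ℕ.≤ g i) → ∑ℕ g ℕ.≤ ∑ℕ f → ∀ i → f i ≡ g i
  ∑ℕ-tight {suc n} {f} {g} h k zero = ℕP.≤-antisym (h zero)
    (ℕP.+-cancelʳ-≤ (∑ℕ (g ∘ suc)) _ _ (ℕP.≤-trans k (ℕP.+-monoʳ-≤ (f zero) (∑ℕ-mono (h ∘ suc)))))
  ∑ℕ-tight {suc n} {f} {g} h k (suc i) = ∑ℕ-tight (h ∘ suc)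
    (ℕP.+-cancelˡ-≤ (g zero) _ _ (ℕP.≤-trans k (ℕP.+-monoˡ-≤ (∑ℕ (f ∘ suc)) (h zero)))) i

∑-two : ∀ {n} {f : Fin n → ℚ} (a b : Fin n) → a ≢ b → (∀ i → i ≢ a → i ≢ b → f i ≡ 0ℚ) →
  ∑ f ≡ f a + f b
∑-two {f = f} a b ne h = trans (∑-cong pt) (trans (∑-+ _ _) (cong₂ _+_ (∑-single a f) (∑-single b f)))
  where
  pt : ∀ i → f i ≡ ⟦ i == a ⟧ * f i + ⟦ i == b ⟧ * f i
  pt i with i F.≟ a | i F.≟ b
  ... | yes refl | yes e    = ⊥-elim (ne e)
  ... | yes refl | no _     = (λ q → solveL q) (f i)
    where solveL : ∀ q → q ≡ 1ℚ * q + 0ℚ * q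
          solveL = solve-∀ ℚ-ring
  ... | no _     | yes refl = (λ q → solveR q) (f i)
    where solveR : ∀ q → q ≡ 0ℚ * q + 1ℚ * q
          solveR = solve-∀ ℚ-ring
  ... | no p     | no q     = trans (h i p q) (zz (f i))
    where zz : ∀ q → 0ℚ ≡ 0ℚ * q + 0ℚ * q
          zz = solve-∀ ℚ-ring

⨁-two : ∀ {n} {f : Fin n → Bool} (a b : Fin n) → a ≢ b → (∀ i → i ≢ a → i ≢ b → f i ≡ false) →
  ⨁ f ≡ f a xor f b
⨁-two {f = f} a b ne h =
  trans (⨁-cong pt) (trans (⨁-xor (λ i → (i == a) ∧ f i) (λ i → (i == b) ∧ f i))
    (cong₂ _xor_ (⨁-single a f) (⨁-single b f)))
  where
  pt : ∀ i → f i ≡ ((i == a) ∧ f i) xor ((i == b) ∧ f i)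
  pt i with i F.≟ a | i F.≟ b
  ... | yes refl | yes e    = ⊥-elim (ne e)
  ... | yes refl | no _     with f i
  ... | true  = refl
  ... | false = refl
  pt i | no _     | yes refl = refl
  pt i | no p     | no q     = h i p q

-- Natural numbers as rationals

toℚ-+ : ∀ a b → toℚ (a ℕ.+ b) ≡ toℚ a + toℚ b
toℚ-+ a b = ℚP.toℚᵘ-injective (begin
  ℚ.toℚᵘ (toℚ (a ℕ.+ b))                     ≈⟨ ℚP.toℚᵘ-fromℚᵘ (ℚᵘ.mkℚᵘ (ℤ.+ (a ℕ.+ b)) 0) ⟩
  ℚᵘ.mkℚᵘ (ℤ.+ (a ℕ.+ b)) 0                    ≈⟨ ℚᵘ.*≡*
    (cong (ℤ._* ℤ.+ 1) (sym (cong₂ ℤ._+_ (ℤP.*-identityʳ (ℤ.+ a)) (ℤP.*-identityʳ (ℤ.+ b))))) ⟩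
  ℚᵘ.mkℚᵘ (ℤ.+ a) 0 ℚᵘ.+ ℚᵘ.mkℚᵘ (ℤ.+ b) 0       ≈⟨ ℚᵘP.≃-sym
    (ℚᵘP.+-cong (ℚP.toℚᵘ-fromℚᵘ (ℚᵘ.mkℚᵘ (ℤ.+ a) 0)) (ℚP.toℚᵘ-fromℚᵘ (ℚᵘ.mkℚᵘ (ℤ.+ b) 0))) ⟩
  ℚ.toℚᵘ (toℚ a) ℚᵘ.+ ℚ.toℚᵘ (toℚ b)         ≈⟨ ℚᵘP.≃-sym (ℚP.toℚᵘ-homo-+ (toℚ a) (toℚ b)) ⟩
  ℚ.toℚᵘ (toℚ a + toℚ b)                     ∎)
  where open ℚᵘP.≃-Reasoning

0≤toℚ : ∀ k → 0ℚ ≤ toℚ k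
0≤toℚ zero    = ℚP.≤-refl
0≤toℚ (suc k) = subst (0ℚ ≤_) (sym (toℚ-+ 1 k)) (0≤+ 0≤1 (0≤toℚ k))

toℚ-mono : ∀ {a b} → a ℕ.≤ b → toℚ a ≤ toℚ b
toℚ-mono {a} {b} h = ≤-by (0≤toℚ (b ℕ.∸ a))
  (trans (cong toℚ (sym (ℕP.m+[n∸m]≡n h))) (toℚ-+ a (b ℕ.∸ a)))

toℚ-suc : ∀ a → toℚ a < toℚ (suc a)
toℚ-suc a = <-by 0<1 (trans (toℚ-+ 1 a) (ℚP.+-comm 1ℚ (toℚ a)))

toℚ-cancel : ∀ {a b} → toℚ a ≤ toℚ b → a ℕ.≤ b
toℚ-cancel {a} {b} h with a ℕP.≤? b
... | yes p = p
... | no q  = ⊥-elim (<⇒≱ (toℚ-suc b) (ℚP.≤-trans (toℚ-mono (ℕP.≰⇒> q)) h))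

toℚ-injective : ∀ {a b} → toℚ a ≡ toℚ b → a ≡ b
toℚ-injective h = ℕP.≤-antisym (toℚ-cancel (ℚP.≤-reflexive h)) (toℚ-cancel (ℚP.≤-reflexive (sym h)))

toℚ-* : ∀ a b → toℚ (a ℕ.* b) ≡ toℚ a * toℚ b
toℚ-* zero b    = sym (ℚP.*-zeroˡ (toℚ b))
toℚ-* (suc a) b = trans (toℚ-+ b (a ℕ.* b)) (trans (cong (λ q → toℚ b + q) (toℚ-* a b))
  (trans (lem (toℚ a) (toℚ b)) (cong (_* toℚ b) (sym (toℚ-+ 1 a)))))
  where
  lem : ∀ p q → q + p * q ≡ (1ℚ + p) * q
  lem = solve-∀ ℚ-ring

⟦⟧-toℚ : ∀ b → toℚ ⟦ b ⟧ℕ ≡ ⟦ b ⟧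
⟦⟧-toℚ true  = refl
⟦⟧-toℚ false = refl

opaque
  unfolding ∑ ∑ℕ
  toℚ-∑ : ∀ {n} (f : Fin n → ℕ) → toℚ (∑ℕ f) ≡ ∑ (λ i → toℚ (f i))
  toℚ-∑ {zero}  f = refl
  toℚ-∑ {suc n} f = trans (toℚ-+ (f zero) (∑ℕ (f ∘ suc))) (cong (toℚ (f zero) +_) (toℚ-∑ (f ∘ suc)))

-- Cones: vectors that dominate a weighted combination of integral points

Vec : ℕ → Set
Vec M = Fin M → ℚ

module _ {M : ℕ} where

  dot : Vec M → Vec M → ℚ
  dot a d = ∑ (λ e → a e * d e)

  dot-move : ∀ a x t d → dot a (λ e → x e + t * d e) ≡ dot a x + t * dot a d
  dot-move a x t d = trans (∑-cong (λ e → lem (a e) (x e) t (d e)))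
    (trans (∑-+ (λ e → a e * x e) (λ e → t * (a e * d e)))
      (cong (λ q → dot a x + q) (∑-* t (λ e → a e * d e))))
    where
    lem : ∀ a x t d → a * (x + t * d) ≡ a * x + t * (a * d)
    lem = solve-∀ ℚ-ring

  -- Weights are strictly positive, so every point vanishes wherever v does.
  data Cone (G : (Fin M → ℕ) → Set) : ℚ → Vec M → Set where
    nil  : ∀ {v} → (∀ e → 0ℚ ≤ v e) → Cone G 0ℚ v
    cons : ∀ {w v w′ v′} (c : ℚ) (J : Fin M → ℕ) → 0ℚ < c → G J → Cone G w′ v′ → w ≡ c + w′ →
           (∀ e → c * toℚ (J e) + v′ e ≤ v e) → Cone G w v

  module _ {G : (Fin M → ℕ) → Set} where

    -- Each constructor carries its own inequality, so a larger bound is absorbed at the head and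
    -- the tail stays as it is.
    cone-up : ∀ {w v v₁} → Cone G w v → (∀ e → v e ≤ v₁ e) → Cone G w v₁
    cone-up (nil h) k = nil (λ e → ℚP.≤-trans (h e) (k e))
    cone-up (cons c J p g C q h) k = cons c J p g C q (λ e → ℚP.≤-trans (h e) (k e))

    cone-++ : ∀ {w₁ v₁ w₂ v₂} → Cone G w₁ v₁ → Cone G w₂ v₂ → Cone G (w₁ + w₂) (λ e → v₁ e + v₂ e)
    cone-++ {w₂ = w₂} {v₂} (nil {v} h) C = subst (λ w → Cone G w (λ e → v e + v₂ e)) (sym (ℚP.+-identityˡ w₂))
      (cone-up C (λ e → ≤-by (h e) (ℚP.+-comm (v e) (v₂ e))))
    cone-++ {w₂ = w₂} {v₂} (cons {v = v} {w′} {v′} c J p g C q h) D = cons c J p g (cone-++ C D)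
      (trans (cong (_+ w₂) q) (ℚP.+-assoc c w′ w₂))
      (λ e → subst (_≤ v e + v₂ e) (ℚP.+-assoc (c * toℚ (J e)) (v′ e) (v₂ e)) (ℚP.+-monoˡ-≤ (v₂ e) (h e)))

    cone-scale : ∀ {w v} r → 0ℚ < r → Cone G w v → Cone G (r * w) (λ e → r * v e)
    cone-scale {v = v} r pos (nil h) = subst (λ w → Cone G w (λ e → r * v e)) (sym (ℚP.*-zeroʳ r))
      (nil (λ e → 0≤* (ℚP.<⇒≤ pos) (h e)))
    cone-scale {v = v} r pos (cons {w′ = w′} {v′} c J p g C q h) = cons (r * c) J (0<* pos p) g
      (cone-scale r pos C)
      (trans (cong (r *_) q) (ℚP.*-distribˡ-+ r c w′))
      (λ e → subst (_≤ r * v e) (lem r c (toℚ (J e)) (v′ e)) (*-mono-≤ʳ (ℚP.<⇒≤ pos) (h e)))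
      where
      lem : ∀ r c j v → r * (c * j + v) ≡ (r * c) * j + r * v
      lem = solve-∀ ℚ-ring

    cone-point : ∀ {v} J → G J → (∀ e → toℚ (J e) ≤ v e) → Cone G 1ℚ v
    cone-point {v} J g h = cons 1ℚ J 0<1 g (nil {v = λ _ → 0ℚ} (λ _ → ℚP.≤-refl)) (sym (ℚP.+-identityʳ 1ℚ))
      (λ e → subst (_≤ v e) (lem (toℚ (J e))) (h e))
      where
      lem : ∀ j → j ≡ 1ℚ * j + 0ℚ
      lem = solve-∀ ℚ-ring

    cone-nonneg : ∀ {w v} → Cone G w v → ∀ e → 0ℚ ≤ v e
    cone-nonneg (nil h) = h
    cone-nonneg (cons c J p g C q h) e =
      ℚP.≤-trans (0≤+ (0≤* (ℚP.<⇒≤ p) (0≤toℚ (J e))) (cone-nonneg C e)) (h e)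

    weight-nonneg : ∀ {w v} → Cone G w v → 0ℚ ≤ w
    weight-nonneg (nil h) = ℚP.≤-refl
    weight-nonneg (cons c J p g C q h) = subst (0ℚ ≤_) (sym q) (0≤+ (ℚP.<⇒≤ p) (weight-nonneg C))

    weight-pos : ∀ {w v} → 0ℚ < w → Cone G w v → ∃ G
    weight-pos p (nil h) = ⊥-elim (ℚP.<-irrefl refl p)
    weight-pos p (cons c J _ g C q h) = J , g

    -- Nothing can cancel: all terms are nonnegative and the weights positive, so a coordinate where
    -- `v` vanishes is zero in every point used. This keeps forests inside the support of the square
    -- point and, at the end, tours inside the edges of the complete graph.
    cone-support : ∀ {w v} → Cone G w v → Cone (λ J → G J × (∀ e → v e ≡ 0ℚ → J e ≡ 0)) w v
    cone-support {v = v} C = go C (λ e z → z)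
      where
      go : ∀ {w v₁} → Cone G w v₁ → (∀ e → v e ≡ 0ℚ → v₁ e ≡ 0ℚ) →
        Cone (λ J → G J × (∀ e → v e ≡ 0ℚ → J e ≡ 0)) w v₁
      go (nil h) _ = nil h
      go (cons {v = v₁} {v′ = v′} c J p g C q h) k = cons c J p (g , zeroJ) (go C zero′) q h
        where
        small : ∀ e → v e ≡ 0ℚ → c * toℚ (J e) + v′ e ≤ 0ℚ
        small e z = subst (_ ≤_) (k e z) (h e)
        zero′ : ∀ e → v e ≡ 0ℚ → v′ e ≡ 0ℚ
        zero′ e z = ℚP.≤-antisym
          (ℚP.≤-trans (≤-by (0≤* (ℚP.<⇒≤ p) (0≤toℚ (J e))) (ℚP.+-comm _ (v′ e))) (small e z))
          (cone-nonneg C e)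
        zeroJ : ∀ e → v e ≡ 0ℚ → J e ≡ 0
        zeroJ e z with J e in eq
        ... | zero  = refl
        ... | suc j = ⊥-elim (<⇒≱ (0<* p (ℚP.≤-<-trans (0≤toℚ j) (toℚ-suc j)))
          (ℚP.≤-trans (≤-by (cone-nonneg C e) (cong (λ i → c * toℚ i + v′ e) eq)) (small e z)))

  cone-map : ∀ {G H : (Fin M → ℕ) → Set} {w v} → (∀ {J} → G J → H J) → Cone G w v → Cone H w v
  cone-map f (nil h) = nil h
  cone-map f (cons c J p g C q h) = cons c J p (f g) (cone-map f C) q h

  -- Weights proportional to `b` and `a` make the two displacements `a * d` and `b * (- d)` cancel.
  cone-between : ∀ {G : (Fin M → ℕ) → Set} {x d : Vec M} a b → 0ℚ < a → 0ℚ < b →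
    Cone G 1ℚ (λ e → x e + a * d e) → Cone G 1ℚ (λ e → x e + b * (- d e)) → Cone G 1ℚ x
  cone-between {G} {x} {d} a b pa pb C D with inverse⁺ (a + b) (ℚP.+-mono-< pa pb)
  ... | r , pr , e = subst (λ w → Cone G w x) (trans (lemw r a b) e)
    (cone-up (cone-++ (cone-scale (r * b) (0<* pr pb) C) (cone-scale (r * a) (0<* pr pa) D))
      (λ i → ℚP.≤-reflexive (trans (lemv r a b (x i) (d i))
        (trans (cong (_* x i) e) (ℚP.*-identityˡ (x i))))))
    where
    lemw : ∀ r a b → (r * b) * 1ℚ + (r * a) * 1ℚ ≡ r * (a + b)
    lemw = solve-∀ ℚ-ring
    lemv : ∀ r a b x d → (r * b) * (x + a * d) + (r * a) * (x + b * (- d)) ≡ (r * (a + b)) * x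
    lemv = solve-∀ ℚ-ring

-- Moving along a ray until a new constraint becomes tight

sign? : ∀ q → 0ℚ ≤ q ⊎ q < 0ℚ
sign? q with 0ℚ ℚP.≤? q
... | yes p = inj₁ p
... | no p  = inj₂ (ℚP.≰⇒> p)

hitting-time : ∀ {s ρ} → s ≢ 0ℚ → 0ℚ ≤ s → ρ < 0ℚ → ∃[ t ] 0ℚ < t × s + t * ρ ≡ 0ℚ
hitting-time {s} {ρ} nz p neg with inverse⁺ (- ρ) (subst (0ℚ <_) (ℚP.+-identityˡ (- ρ)) (0<- neg))
... | r , pr , e = s * r , 0<* (≤∧≢⇒< p (nz ∘ sym)) pr ,
  trans (lem s r ρ) (trans (cong (λ k → s * (1ℚ - k)) e) (ℚP.*-zeroʳ s))
  where
  lem : ∀ s r p → s + (s * r) * p ≡ s * (1ℚ - r * (- p))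
  lem = solve-∀ ℚ-ring

nonneg-before : ∀ {s ρ t t′} → 0ℚ ≤ t′ → t′ ≤ t → 0ℚ ≤ s → 0ℚ ≤ s + t * ρ → 0ℚ ≤ s + t′ * ρ
nonneg-before {s} {ρ} {t} {t′} a b p u with ℚP.≤-total 0ℚ ρ
... | inj₁ pos = 0≤+ p (0≤* a pos)
... | inj₂ neg = ℚP.≤-trans u (≤-by (0≤* (0≤- b) (0≤- neg)) (lem s t t′ ρ))
  where
  lem : ∀ s t t′ p → s + t′ * p ≡ s + t * p + (t - t′) * (0ℚ - p)
  lem = solve-∀ ℚ-ring

module _ {A : Set} (σ ρ : A → ℚ) where

  private
    Ahead Hit : ℚ → A → Set
    Ahead t c = 0ℚ ≤ σ c + t * ρ c
    Hit t c = σ c ≢ 0ℚ × σ c + t * ρ c ≡ 0ℚ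

    ahead : ∀ {t c} → 0ℚ < t → 0ℚ ≤ σ c → 0ℚ ≤ ρ c → Ahead t c
    ahead p a b = 0≤+ a (0≤* (ℚP.<⇒≤ p) b)

  -- Minimum ratio test. Constraints that are tight at the start stay tight along `ρ`, so a
  -- decreasing slack is positive and has a positive hitting time; the least of these times is
  -- feasible for all constraints and makes a new one tight. If no slack decreases, the ray never
  -- leaves the region.
  ray : (L : List A) → All (λ c → 0ℚ ≤ σ c) L → All (λ c → σ c ≡ 0ℚ → ρ c ≡ 0ℚ) L →
    All (λ c → 0ℚ ≤ ρ c) L ⊎ (∃[ t ] 0ℚ < t × All (Ahead t) L × Any (Hit t) L)
  ray [] [] [] = inj₁ []
  ray (c ∷ L) (p ∷ P) (q ∷ Q) with ray L P Q | sign? (ρ c)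
  ... | inj₁ ps | inj₁ r = inj₁ (r ∷ ps)
  ... | inj₂ (t , pt , feas , hit) | inj₁ r = inj₂ (t , pt , ahead pt p r ∷ feas , there hit)
  ... | tail | inj₂ r = inj₂ (combine (hitting-time nz p r) tail)
    where
    nz : σ c ≢ 0ℚ
    nz z = ℚP.<-irrefl (q z) r
    combine : ∃[ u ] 0ℚ < u × σ c + u * ρ c ≡ 0ℚ →
      All (λ c → 0ℚ ≤ ρ c) L ⊎ (∃[ t ] 0ℚ < t × All (Ahead t) L × Any (Hit t) L) →
      ∃[ t ] 0ℚ < t × All (Ahead t) (c ∷ L) × Any (Hit t) (c ∷ L)
    combine (u , pu , z) (inj₁ ps) =
      u , pu , (ℚP.≤-reflexive (sym z) ∷ All.zipWith (λ (a , b) → ahead pu a b) (P , ps)) , here (nz , z)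
    combine (u , pu , z) (inj₂ (t , pt , feas , hit)) with ℚP.≤-total u t
    ... | inj₁ l = u , pu ,
      (ℚP.≤-reflexive (sym z) ∷ All.zipWith (λ (a , b) → nonneg-before (ℚP.<⇒≤ pu) l a b) (P , feas)) , here
        (nz , z)
    ... | inj₂ g = t , pt , (nonneg-before (ℚP.<⇒≤ pt) g p (ℚP.≤-reflexive (sym z)) ∷ feas) , there hit

module _ {A : Set} where

  nonzeros : (A → ℚ) → List A → ℕ
  nonzeros σ [] = 0
  nonzeros σ (c ∷ L) = ⟦ not (does (σ c ℚP.≟ 0ℚ)) ⟧ℕ ℕ.+ nonzeros σ L

  nonzeros-≤ : ∀ {σ τ} L → All (λ c → σ c ≡ 0ℚ → τ c ≡ 0ℚ) L → nonzeros τ L ℕ.≤ nonzeros σ L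
  nonzeros-≤ [] [] = ℕ.z≤n
  nonzeros-≤ {σ} {τ} (c ∷ L) (p ∷ P) = ℕP.+-mono-≤ head (nonzeros-≤ L P)
    where
    head : ⟦ not (does (τ c ℚP.≟ 0ℚ)) ⟧ℕ ℕ.≤ ⟦ not (does (σ c ℚP.≟ 0ℚ)) ⟧ℕ
    head with σ c ℚP.≟ 0ℚ | τ c ℚP.≟ 0ℚ
    ... | yes z | no nz = ⊥-elim (nz (p z))
    ... | yes _ | yes _ = ℕP.≤-refl
    ... | no _  | yes _ = ℕ.z≤n
    ... | no _  | no _  = ℕP.≤-refl

  nonzeros-< : ∀ {σ τ} L → All (λ c → σ c ≡ 0ℚ → τ c ≡ 0ℚ) L → Any (λ c → σ c ≢ 0ℚ × τ c ≡ 0ℚ) L →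
    nonzeros τ L ℕ.< nonzeros σ L
  nonzeros-< {σ} {τ} (c ∷ L) (p ∷ P) (there h) with σ c ℚP.≟ 0ℚ | τ c ℚP.≟ 0ℚ
  ... | yes z | no nz = ⊥-elim (nz (p z))
  ... | yes _ | yes _ = nonzeros-< L P h
  ... | no _  | yes _ = ℕP.m≤n⇒m≤1+n (nonzeros-< L P h)
  ... | no _  | no _  = ℕ.s≤s (nonzeros-< L P h)
  nonzeros-< {σ} {τ} (c ∷ L) (p ∷ P) (here (nz , z)) with σ c ℚP.≟ 0ℚ | τ c ℚP.≟ 0ℚ
  ... | yes z′ | _      = ⊥-elim (nz z′)
  ... | no _   | yes _  = ℕ.s≤s (nonzeros-≤ L P)
  ... | no _   | no nz′ = ⊥-elim (nz′ z)

-- Induction on the number of constraints that are not tight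

Constraint : ℕ → Set
Constraint M = Vec M × ℚ

module _ {M : ℕ} where

  slack : Vec M → Constraint M → ℚ
  slack x (a , b) = dot a x - b

  Feasible : List (Constraint M) → Vec M → Set
  Feasible Cs x = All (λ c → 0ℚ ≤ slack x c) Cs

  unit : Fin M → Vec M
  unit e i = ⟦ i == e ⟧

  dot-unit : ∀ e x → dot (unit e) x ≡ x e
  dot-unit e x = ∑-single e x

  Admissible : List (Constraint M) → Vec M → Vec M → Set
  Admissible Cs x d = All (λ c → slack x c ≡ 0ℚ → dot (proj₁ c) d ≡ 0ℚ) Cs

  private
    slack-move : ∀ x t d c → slack (λ e → x e + t * d e) c ≡ slack x c + t * dot (proj₁ c) d
    slack-move x t d (a , b) = trans (cong (_- b) (dot-move a x t d)) (lem (dot a x) (t * dot a d) b)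
      where
      lem : ∀ p q r → p + q - r ≡ p - r + q
      lem = solve-∀ ℚ-ring

  -- If both senses of `d` stop at a new tight constraint, x lies between two points with fewer
  -- nonzero slacks. If the sense `d` never stops, the unit constraints give d ≥ 0, so the point
  -- reached by moving along `- d` lies below x and its combination is also dominated by x. Both
  -- senses cannot be unbounded, since `d` is nonzero.
  polyhedral-induction : (Cs : List (Constraint M)) → (∀ e → (unit e , 0ℚ) ∈ Cs) → (G : (Fin M → ℕ) → Set) →
    (∀ x → Feasible Cs x → Cone G 1ℚ x ⊎ (∃[ d ] (∃[ e ] d e ≢ 0ℚ) × Admissible Cs x d)) →
    ∀ x → Feasible Cs x → Cone G 1ℚ x
  polyhedral-induction Cs units G step x f = go (suc (size x)) x ℕP.≤-refl f
    where
    size : Vec M → ℕ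
    size x = nonzeros (slack x) Cs

    Next : Vec M → Vec M → Set
    Next x d = ∃[ t ] 0ℚ < t × Feasible Cs (λ e → x e + t * d e) × size (λ e → x e + t * d e) ℕ.< size x

    move : ∀ x d → Feasible Cs x → Admissible Cs x d → (∀ e → 0ℚ ≤ d e) ⊎ Next x d
    move x d f adm with ray (slack x) (λ c → dot (proj₁ c) d) Cs f adm
    ... | inj₁ pos = inj₁ (λ e → subst (0ℚ ≤_) (dot-unit e d) (All.lookup pos (units e)))
    ... | inj₂ (t , pt , feas , hit) = inj₂ (t , pt ,
      All.map (λ {c} h → subst (0ℚ ≤_) (sym (slack-move x t d c)) h) feas ,
      nonzeros-< Cs
        (All.map (λ {c} k z → trans (slack-move x t d c)
          (trans (cong₂ _+_ z (trans (cong (t *_) (k z)) (ℚP.*-zeroʳ t))) (ℚP.+-identityʳ 0ℚ))) adm)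
        (Any.map (λ {c} (nz , z) → nz , trans (slack-move x t d c) z) hit))

    neg-adm : ∀ x d → Admissible Cs x d → Admissible Cs x (λ e → - d e)
    neg-adm x d = All.map (λ {c} h z → trans (∑-cong (λ e → lem (proj₁ c e) (d e)))
        (trans (∑-* (- 1ℚ) (λ e → proj₁ c e * d e)) (trans (cong ((- 1ℚ) *_) (h z)) (ℚP.*-zeroʳ (- 1ℚ)))))
      where
      lem : ∀ a d → a * (- d) ≡ (- 1ℚ) * (a * d)
      lem = solve-∀ ℚ-ring

    go : ∀ k x → size x ℕ.< k → Feasible Cs x → Cone G 1ℚ x
    go (suc k) x (ℕ.s≤s b) f = decide (step x f)
      where
      combine : ∀ d → (∃[ e ] d e ≢ 0ℚ) → (∀ e → 0ℚ ≤ d e) ⊎ Next x d → (∀ e → 0ℚ ≤ - d e) ⊎ Next x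
        (λ e → - d e) →
        Cone G 1ℚ x
      combine d _ (inj₂ (t , pt , f₁ , s₁)) (inj₂ (u , pu , f₂ , s₂)) =
        cone-between {d = d} t u pt pu (go k _ (ℕP.<-≤-trans s₁ b) f₁) (go k _ (ℕP.<-≤-trans s₂ b) f₂)
      combine d _ (inj₁ pos) (inj₂ (u , pu , f₂ , s₂)) = cone-up (go k _ (ℕP.<-≤-trans s₂ b) f₂)
        (λ i → ≤-by (0≤* (ℚP.<⇒≤ pu) (pos i)) (lem (x i) u (d i)))
        where
        lem : ∀ x u d → x ≡ x + u * (- d) + u * d
        lem = solve-∀ ℚ-ring
      combine d _ (inj₂ (t , pt , f₁ , s₁)) (inj₁ neg) = cone-up (go k _ (ℕP.<-≤-trans s₁ b) f₁)
        (λ i → ≤-by (0≤* (ℚP.<⇒≤ pt) (neg i)) (lem (x i) t (d i)))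
        where
        lem : ∀ x u d → x ≡ x + u * d + u * (- d)
        lem = solve-∀ ℚ-ring
      combine d (e , nz) (inj₁ pos) (inj₁ neg) = ⊥-elim (nz (ℚP.≤-antisym
        (≤-by (neg e) (sym (ℚP.+-inverseʳ (d e)))) (pos e)))
      decide : Cone G 1ℚ x ⊎ (∃[ d ] (∃[ e ] d e ≢ 0ℚ) × Admissible Cs x d) → Cone G 1ℚ x
      decide (inj₁ C) = C
      decide (inj₂ (d , nz , adm)) = combine d nz (move x d f adm) (move x (λ e → - d e) f (neg-adm x d adm))

-- Finite sets, linear systems and circulations

Row : ℕ → Set
Row M = Fin M → Bool

module _ {M : ℕ} where

  size : Row M → ℕ
  size P = ∑ℕ (λ e → ⟦ P e ⟧ℕ)

  _∖_ : Row M → Fin M → Row M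
  (P ∖ e) i = P i ∧ not (i == e)

  size-∖ : ∀ {P e} → P e ≡ true → size P ≡ suc (size (P ∖ e))
  size-∖ {P} {e} h = trans (∑ℕ-cong pt)
    (trans (∑ℕ-+ (λ i → ⟦ i == e ⟧ℕ ℕ.* 1) (λ i → ⟦ (P ∖ e) i ⟧ℕ))
      (cong (ℕ._+ size (P ∖ e)) (∑ℕ-single e (λ _ → 1))))
    where
    pt : ∀ i → ⟦ P i ⟧ℕ ≡ ⟦ i == e ⟧ℕ ℕ.* 1 ℕ.+ ⟦ (P ∖ e) i ⟧ℕ
    pt i with i F.≟ e
    ... | yes refl rewrite h = refl
    ... | no _ with P i
    ... | true  = refl
    ... | false = refl

  ∖-≢ : ∀ {P e i} → i ≢ e → P i ≡ true → (P ∖ e) i ≡ true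
  ∖-≢ {P} {e} {i} ne h rewrite ==-≢ ne | h = refl

  member≤size : ∀ {P e} → P e ≡ true → 1 ℕ.≤ size P
  member≤size {P} h = subst (1 ℕ.≤_) (sym (size-∖ {P} h)) (ℕ.s≤s ℕ.z≤n)

  two≤size : ∀ {P e f} → e ≢ f → P e ≡ true → P f ≡ true → 2 ℕ.≤ size P
  two≤size {P} {e} ne p q = subst (2 ℕ.≤_) (sym (size-∖ {P} p))
    (ℕ.s≤s (member≤size (∖-≢ {P} (ne ∘ sym) q)))

  size≡2⇒ : ∀ {P e f} → e ≢ f → P e ≡ true → P f ≡ true → size P ≡ 2 → ∀ g → P g ≡ true → g ≡ e ⊎ g ≡ f
  size≡2⇒ {P} {e} {f} ne p q s g r with g F.≟ e | g F.≟ f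
  ... | yes a | _ = inj₁ a
  ... | no _  | yes b = inj₂ b
  ... | no a  | no b = ⊥-elim (ℕP.<-irrefl (sym s) (subst (3 ℕ.≤_) (sym (size-∖ {P} p))
    (ℕ.s≤s (two≤size b (∖-≢ {P} a r) (∖-≢ {P} (ne ∘ sym) q)))))

  nonempty : ∀ {P} → 1 ℕ.≤ size P → ∃[ e ] P e ≡ true
  nonempty {P} h with FP.any? (λ e → P e B.≟ true)
  ... | yes r = r
  ... | no r  = ⊥-elim (ℕP.<-irrefl refl (subst (1 ℕ.≤_)
    (∑ℕ-zero (λ e → cong ⟦_⟧ℕ (≢true (λ t → r (e , t))))) h))

  SupportedOn : Row M → Vec M → Set
  SupportedOn Φ d = ∀ e → Φ e ≡ false → d e ≡ 0ℚ

  Nonzero : Vec M → Set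
  Nonzero d = ∃[ e ] d e ≢ 0ℚ

  -- Gaussian elimination.
  kernel : ∀ k (eqs : List (Vec M)) → length eqs ≡ k → (Φ : Row M) → k ℕ.< size Φ →
    ∃[ d ] SupportedOn Φ d × Nonzero d × All (λ q → dot q d ≡ 0ℚ) eqs
  kernel zero [] refl Φ lt with nonempty {Φ} lt
  ... | p , t = unit p , supp , (p , λ z → 1≢0 (trans (cong ⟦_⟧ (sym (==-refl p))) z)) , []
    where
    supp : SupportedOn Φ (unit p)
    supp e h = cong ⟦_⟧ (==-≢ {i = e} {p} (λ { refl → true≢false t h }))
  kernel (suc k) (q ∷ eqs) len Φ lt with FP.any? (λ e → (Φ e B.≟ true) ×-dec ¬? (q e ℚP.≟ 0ℚ))
  ... | no none = extend (kernel k eqs (ℕP.suc-injective len) Φ (ℕP.<-trans (ℕP.n<1+n _) lt))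
    where
    extend : ∃[ d ] SupportedOn Φ d × Nonzero d × All (λ q → dot q d ≡ 0ℚ) eqs →
      ∃[ d ] SupportedOn Φ d × Nonzero d × All (λ q → dot q d ≡ 0ℚ) (q ∷ eqs)
    extend (d , supp , nz , zs) = d , supp , nz , ∑-zero term ∷ zs
      where
      term : ∀ e → q e * d e ≡ 0ℚ
      term e with q e ℚP.≟ 0ℚ | Φ e B.≟ true
      ... | yes z | _     = trans (cong (_* d e) z) (ℚP.*-zeroˡ (d e))
      ... | no nz | yes t = ⊥-elim (none (e , t , nz))
      ... | no _  | no f  = trans (cong (q e *_) (supp e (≢true f))) (ℚP.*-zeroʳ (q e))
  ... | yes (p , t , nz) with inverse (q p) nz
  ... | r , inv = extend (kernel k (map reduce eqs)
    (trans (LP.length-map reduce eqs) (ℕP.suc-injective len)) (Φ ∖ p)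
      (ℕP.≤-pred (subst (suc k ℕ.<_) (size-∖ {Φ} t) lt)))
    where
    reduce : Vec M → Vec M
    reduce q′ e = q′ e + (- (q′ p * r)) * q e

    extend : ∃[ d ] SupportedOn (Φ ∖ p) d × Nonzero d × All (λ q → dot q d ≡ 0ℚ) (map reduce eqs) →
      ∃[ d ] SupportedOn Φ d × Nonzero d × All (λ q → dot q d ≡ 0ℚ) (q ∷ eqs)
    extend (d , supp , (e , ne) , zs) = d⁺ , supp⁺ , (e , nz⁺) , first ∷ All.map (λ {q′} → rest q′)
      (AllP.map⁻ zs)
      where
      -- The value at the pivot `p` that satisfies the eliminated equation `q`; `r` is the
      -- reciprocal of `q p`.
      c = - (r * dot q d)
      d⁺ : Vec M
      d⁺ i = d i + c * unit p i
      supp⁺ : SupportedOn Φ d⁺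
      supp⁺ i h = trans (cong₂ (λ a b → a + c * ⟦ b ⟧) (supp i (cong (_∧ not (i == p)) h))
        (==-≢ {i = i} {p} (λ { refl → true≢false t h }))) (lem c)
        where
        lem : ∀ c → 0ℚ + c * 0ℚ ≡ 0ℚ
        lem = solve-∀ ℚ-ring
      -- The smaller solution vanishes at the pivot, so its nonzero coordinate is elsewhere and is
      -- not affected by the correction.
      nz⁺ : d⁺ e ≢ 0ℚ
      nz⁺ z with e == p in eq
      ... | true  = ne (supp e (trans (cong (λ b → Φ e ∧ not b) eq) (BP.∧-zeroʳ (Φ e))))
      ... | false = ne (trans (lem (d e) c) z)
        where
        lem : ∀ a c → a ≡ a + c * 0ℚ
        lem = solve-∀ ℚ-ring
      value : ∀ q′ → dot q′ d⁺ ≡ dot q′ d + c * q′ p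
      value q′ = trans (dot-move q′ d c (unit p)) (cong (λ k → dot q′ d + c * k)
        (trans (∑-cong (λ i → ℚP.*-comm (q′ i) (unit p i))) (dot-unit p q′)))
      first : dot q d⁺ ≡ 0ℚ
      first = trans (value q) (trans (lem r (dot q d) (q p))
        (trans (cong (λ k → (1ℚ - k) * dot q d) inv) (ℚP.*-zeroˡ (dot q d))))
        where
        lem : ∀ r s p → s + (- (r * s)) * p ≡ (1ℚ - r * p) * s
        lem = solve-∀ ℚ-ring
      rest : ∀ q′ → dot (reduce q′) d ≡ 0ℚ → dot q′ d⁺ ≡ 0ℚ
      rest q′ z = trans (value q′) (trans (lem r (dot q d) (dot q′ d) (q′ p)) (trans (sym expand) z))
        where
        lem : ∀ r s s′ p → s′ + (- (r * s)) * p ≡ s′ + (- (p * r)) * s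
        lem = solve-∀ ℚ-ring
        lem₂ : ∀ a b c d → (a + b * c) * d ≡ a * d + b * (c * d)
        lem₂ = solve-∀ ℚ-ring
        expand : dot (reduce q′) d ≡ dot q′ d + (- (q′ p * r)) * dot q d
        expand = trans (∑-cong (λ i → lem₂ (q′ i) (- (q′ p * r)) (q i) (d i)))
          (trans (∑-+ (λ i → q′ i * d i) (λ i → (- (q′ p * r)) * (q i * d i)))
            (cong (λ k → dot q′ d + k) (∑-* (- (q′ p * r)) (λ i → q i * d i))))

  indicator : Row M → Vec M
  indicator r e = ⟦ r e ⟧

  rowSum : Row M → Vec M → ℚ
  rowSum r d = dot (indicator r) d

  incidence : List (Row M) → Fin M → ℕ
  incidence [] e       = 0
  incidence (r ∷ rs) e = ⟦ r e ⟧ℕ ℕ.+ incidence rs e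

  AtLeastTwo ExactlyTwo : Row M → Row M → Set
  AtLeastTwo Φ r = ∃[ e ] ∃[ f ] e ≢ f × (Φ e ≡ true × r e ≡ true) × (Φ f ≡ true × r f ≡ true)
  ExactlyTwo Φ r = ∃[ e ] ∃[ f ] e ≢ f × (Φ e ≡ true × r e ≡ true) × (Φ f ≡ true × r f ≡ true) ×
    (∀ g → Φ g ≡ true → r g ≡ true → g ≡ e ⊎ g ≡ f)

  rowSum-two : ∀ {Φ r : Row M} {d : Vec M} {a b} → SupportedOn Φ d → a ≢ b → r a ≡ true → r b ≡ true →
    (∀ i → Φ i ≡ true → r i ≡ true → i ≡ a ⊎ i ≡ b) → rowSum r d ≡ d a + d b
  rowSum-two {Φ} {r} {d} {a} {b} supp ne ra rb only = trans (∑-two a b ne others)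
    (cong₂ _+_ (at a ra) (at b rb))
    where
    at : ∀ i → r i ≡ true → ⟦ r i ⟧ * d i ≡ d i
    at i h = trans (cong (λ b → ⟦ b ⟧ * d i) h) (ℚP.*-identityˡ (d i))
    others : ∀ i → i ≢ a → i ≢ b → ⟦ r i ⟧ * d i ≡ 0ℚ
    others i na nb with r i in eq | Φ i in eq′
    ... | false | _ = ℚP.*-zeroˡ (d i)
    ... | true | false = trans (cong (1ℚ *_) (supp i eq′)) (ℚP.*-zeroʳ 1ℚ)
    ... | true | true with only i eq′ eq
    ... | inj₁ p = ⊥-elim (na p)
    ... | inj₂ p = ⊥-elim (nb p)

  Circulation : Row M → List (Row M) → Set
  Circulation Φ rows = ∃[ d ] SupportedOn Φ d × Nonzero d × All (λ r → rowSum r d ≡ 0ℚ) rows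

  -- The extremal case of the degree count: there are as many rows as elements, so counting yields a
  -- kernel vector only after one row `r₀` has been dropped. Whether the sum over `r₀` vanishes too
  -- has to be decided from the structure of the graph, by parity for T-joins and by bipartiteness
  -- for matroid intersection.
  TwoRegular : Row M → List (Row M) → Set
  TwoRegular Φ rows = ∃[ r₀ ] ∃[ rs ] rows ≡ r₀ ∷ rs × Circulation Φ rs ×
    (∀ e → Φ e ≡ true → incidence rows e ≡ 2) × All (ExactlyTwo Φ) rows

  private
    -- The number of incidences counted by rows; `volume≡` counts them by elements, which is the
    -- handshake identity.
    volume : Row M → List (Row M) → ℕ
    volume Φ []       = 0
    volume Φ (r ∷ rs) = size (λ e → Φ e ∧ r e) ℕ.+ volume Φ rs

    volume≡ : ∀ Φ rows → volume Φ rows ≡ ∑ℕ (λ e → ⟦ Φ e ⟧ℕ ℕ.* incidence rows e)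
    volume≡ Φ [] = sym (∑ℕ-zero (λ e → ℕP.*-zeroʳ ⟦ Φ e ⟧ℕ))
    volume≡ Φ (r ∷ rs) = trans (cong (size (λ e → Φ e ∧ r e) ℕ.+_) (volume≡ Φ rs))
      (trans (sym (∑ℕ-+ (λ e → ⟦ Φ e ∧ r e ⟧ℕ) (λ e → ⟦ Φ e ⟧ℕ ℕ.* incidence rs e))) (∑ℕ-cong pt))
      where
      pt : ∀ e → ⟦ Φ e ∧ r e ⟧ℕ ℕ.+ ⟦ Φ e ⟧ℕ ℕ.* incidence rs e ≡ ⟦ Φ e ⟧ℕ ℕ.* (⟦ r e ⟧ℕ ℕ.+ incidence rs e)
      pt e with Φ e
      ... | true  = trans (cong (⟦ r e ⟧ℕ ℕ.+_) (ℕP.*-identityˡ _)) (sym (ℕP.*-identityˡ _))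
      ... | false = refl

    ∧-intro : ∀ {a b} → a ≡ true × b ≡ true → a ∧ b ≡ true
    ∧-intro (refl , refl) = refl

    two≤row : ∀ {Φ r} → AtLeastTwo Φ r → 2 ℕ.≤ size (λ e → Φ e ∧ r e)
    two≤row {Φ} {r} (e , f , ne , p , q) = two≤size ne (∧-intro p) (∧-intro q)

    2length≤ : ∀ {Φ} rows → All (AtLeastTwo Φ) rows → 2 ℕ.* length rows ℕ.≤ volume Φ rows
    2length≤ [] [] = ℕ.z≤n
    2length≤ {Φ} (r ∷ rs) (p ∷ ps) = subst (ℕ._≤ volume Φ (r ∷ rs)) (sym (ℕP.*-suc 2 (length rs)))
      (ℕP.+-mono-≤ (two≤row p) (2length≤ rs ps))

    -- When the incidences number at most twice the rows, no row can exceed its minimum of two.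
    exact : ∀ {Φ} rows → All (AtLeastTwo Φ) rows → volume Φ rows ℕ.≤ 2 ℕ.* length rows → All (ExactlyTwo Φ)
      rows
    exact [] [] _ = []
    exact {Φ} (r ∷ rs) (p@(e , f , ne , pe , pf) ∷ ps) h =
      (e , f , ne , pe , pf , λ g a b → size≡2⇒ ne (∧-intro pe) (∧-intro pf)
        (ℕP.≤-antisym small (two≤row p)) g (∧-intro (a , b)))
      ∷ exact rs ps (ℕP.+-cancelˡ-≤ 2 _ _ (ℕP.≤-trans (ℕP.+-monoˡ-≤ (volume Φ rs) (two≤row p)) h′))
      where
      h′ : size (λ e → Φ e ∧ r e) ℕ.+ volume Φ rs ℕ.≤ 2 ℕ.+ 2 ℕ.* length rs
      h′ = subst (volume Φ (r ∷ rs) ℕ.≤_) (ℕP.*-suc 2 (length rs)) h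
      small : size (λ e → Φ e ∧ r e) ℕ.≤ 2
      small = ℕP.+-cancelʳ-≤ (2 ℕ.* length rs) _ _ (ℕP.≤-trans (ℕP.+-monoʳ-≤ _ (2length≤ rs ps)) h′)

  -- Read rows as vertices and elements of Φ as edges: a graph of minimum degree two carries a
  -- nonzero edge weighting with zero vertex sums unless it is two-regular.
  circulation : (Φ : Row M) (rows : List (Row M)) → ∃[ e ] Φ e ≡ true → All (AtLeastTwo Φ) rows →
    (∀ e → Φ e ≡ true → incidence rows e ℕ.≤ 2) → Circulation Φ rows ⊎ TwoRegular Φ rows
  circulation Φ rows (e , t) deg inc = decide rows refl
    where
    N = size Φ
    solveFor : ∀ rs → length rs ℕ.< N → Circulation Φ rs
    solveFor rs lt with kernel (length rs) (map indicator rs) (LP.length-map indicator rs) Φ lt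
    ... | d , supp , nz , zs = d , supp , nz , AllP.map⁻ zs
    bounded : ∀ e → ⟦ Φ e ⟧ℕ ℕ.* incidence rows e ℕ.≤ 2 ℕ.* ⟦ Φ e ⟧ℕ
    bounded e with Φ e in eq
    ... | true  = subst (ℕ._≤ 2) (sym (ℕP.*-identityˡ _)) (inc e eq)
    ... | false = ℕ.z≤n
    volume≤ : volume Φ rows ℕ.≤ 2 ℕ.* N
    volume≤ = subst₂ ℕ._≤_ (sym (volume≡ Φ rows)) (∑ℕ-* 2 (λ e → ⟦ Φ e ⟧ℕ)) (∑ℕ-mono bounded)
    length≤ : length rows ℕ.≤ N
    length≤ = ℕP.*-cancelˡ-≤ 2 (ℕP.≤-trans (2length≤ rows deg) volume≤)
    saturated : N ℕ.≤ length rows → ∀ e → Φ e ≡ true → incidence rows e ≡ 2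
    saturated h e t = trans (sym (trans (cong (λ b → ⟦ b ⟧ℕ ℕ.* incidence rows e) t) (ℕP.*-identityˡ _)))
      (trans (∑ℕ-tight bounded (subst₂ ℕ._≤_ (sym (∑ℕ-* 2 (λ e → ⟦ Φ e ⟧ℕ))) (volume≡ Φ rows)
        (ℕP.≤-trans (ℕP.*-monoʳ-≤ 2 h) (2length≤ rows deg))) e) (cong (λ b → 2 ℕ.* ⟦ b ⟧ℕ) t))
    decide : ∀ rs → rs ≡ rows → Circulation Φ rows ⊎ TwoRegular Φ rows
    decide [] refl = inj₁ (solveFor [] (member≤size t))
    decide (r₀ ∷ rs) refl with length rows ℕP.<? N
    ... | yes lt = inj₁ (solveFor rows lt)
    ... | no ge  = inj₂ (r₀ , rs , refl , solveFor rs length≤ , saturated (ℕP.≮⇒≥ ge) ,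
      exact rows deg (ℕP.≤-trans volume≤ (ℕP.*-monoʳ-≤ 2 (ℕP.≮⇒≥ ge))))

-- Disintegration of a cone along a set of unit total weight

module _ {M : ℕ} where

  opaque
    unfolding ∑
    cone-∑ : ∀ {k} {G : (Fin M → ℕ) → Set} (ω : Fin k → ℚ) (β : Fin k → Vec M) → (∀ e → Cone G (ω e) (β e)) →
      Cone G (∑ ω) (λ i → ∑ (λ e → β e i))
    cone-∑ {zero}  ω β h = nil (λ _ → ℚP.≤-refl)
    cone-∑ {suc k} ω β h = cone-++ (h zero) (cone-∑ (ω ∘ suc) (β ∘ suc) (h ∘ suc))

  weight≤ : ∀ {G : (Fin M → ℕ) → Set} {w v} e → (∀ {J} → G J → 1 ℕ.≤ J e) → Cone G w v → w ≤ v e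
  weight≤ e big (nil h) = h e
  weight≤ e big (cons {v = v} c J p g C q h) = subst (_≤ v e) (sym q)
    (ℚP.≤-trans (ℚP.+-mono-≤ (subst (_≤ c * toℚ (J e)) (ℚP.*-identityʳ c)
      (*-mono-≤ʳ (ℚP.<⇒≤ p) (toℚ-mono (big g)))) (weight≤ e big C)) (h e))

  two-terms≤∑ : ∀ {f : Fin M → ℚ} → (∀ i → 0ℚ ≤ f i) → ∀ {a b} → a ≢ b → f a + f b ≤ ∑ f
  two-terms≤∑ {f} h {a} {b} ne = subst (_≤ ∑ f) (trans (∑-two a b ne zeros) (cong₂ _+_ at-a at-b))
    (∑-mono below)
    where
    g : Fin M → ℚ
    g i = ⟦ (i == a) ∨ (i == b) ⟧ * f i
    zeros : ∀ i → i ≢ a → i ≢ b → g i ≡ 0ℚ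
    zeros i p q rewrite ==-≢ p | ==-≢ q = ℚP.*-zeroˡ (f i)
    at-a : g a ≡ f a
    at-a rewrite ==-refl a = ℚP.*-identityˡ (f a)
    at-b : g b ≡ f b
    at-b rewrite ==-refl b | BP.∨-zeroʳ (b == a) = ℚP.*-identityˡ (f b)
    below : ∀ i → g i ≤ f i
    below i with (i == a) ∨ (i == b)
    ... | true  = ℚP.≤-reflexive (ℚP.*-identityˡ (f i))
    ... | false = subst (_≤ f i) (sym (ℚP.*-zeroˡ (f i))) (h i)

  -- Every point of a combination is filed under one element: `ω e` is the total weight filed under
  -- `e`, and `β e` is the share of `v` that these points use up.
  Slices : ((Fin M → ℕ) → Fin M → Set) → ℚ → Vec M → Set
  Slices G w v = Σ[ ω ∈ (Fin M → ℚ) ] Σ[ β ∈ (Fin M → Vec M) ]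
    (∀ e → Cone (λ J → G J e) (ω e) (β e)) × ∑ ω ≡ w × (∀ i → ∑ (λ e → β e i) ≤ v i)

  slices : ∀ {G : (Fin M → ℕ) → Set} (H : (Fin M → ℕ) → Fin M → Set) → (∀ {J} → G J → ∃ (H J)) →
    ∀ {w v} → Cone G w v → Slices H w v
  slices H pick (nil {v} h) = (λ _ → 0ℚ) , (λ _ _ → 0ℚ) , (λ _ → nil (λ _ → ℚP.≤-refl)) ,
    ∑-zero (λ _ → refl) , (λ i → subst (_≤ v i) (sym (∑-zero {M} (λ _ → refl))) (h i))
  slices H pick (cons {w} {v} {w′} {v′} c J p g C q h) = add (slices H pick C) (pick g)
    where
    add : Slices H w′ v′ → ∃ (H J) → Slices H w v
    add (ω , β , cones , total , below) (e₀ , he₀) = ω⁺ , β⁺ , cones⁺ , total⁺ , below⁺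
      where
      ω⁺ : Fin M → ℚ
      ω⁺ e = ⟦ e == e₀ ⟧ * c + ω e
      β⁺ : Fin M → Vec M
      β⁺ e i = ⟦ e == e₀ ⟧ * (c * toℚ (J i)) + β e i
      cones⁺ : ∀ e → Cone (λ J → H J e) (ω⁺ e) (β⁺ e)
      cones⁺ e with e F.≟ e₀
      ... | yes refl = cons c J p he₀ (cones e) (cong (_+ ω e) (ℚP.*-identityˡ c))
        (λ i → ℚP.≤-reflexive (cong (_+ β e i) (sym (ℚP.*-identityˡ (c * toℚ (J i))))))
      ... | no _ = subst (λ u → Cone (λ J → H J e) u (λ i → 0ℚ * (c * toℚ (J i)) + β e i)) (lem c (ω e))
        (cone-up (cones e) (λ i → ℚP.≤-reflexive (lem (c * toℚ (J i)) (β e i))))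
        where
        lem : ∀ c u → u ≡ 0ℚ * c + u
        lem = solve-∀ ℚ-ring
      total⁺ : ∑ ω⁺ ≡ w
      total⁺ = trans (∑-+ (λ e → ⟦ e == e₀ ⟧ * c) ω) (trans (cong₂ _+_ (∑-single e₀ (λ _ → c)) total) (sym q))
      below⁺ : ∀ i → ∑ (λ e → β⁺ e i) ≤ v i
      below⁺ i = subst (_≤ v i) (sym (trans (∑-+ (λ e → ⟦ e == e₀ ⟧ * (c * toℚ (J i))) (λ e → β e i))
          (cong (_+ ∑ (λ e → β e i)) (∑-single e₀ (λ _ → c * toℚ (J i))))))
        (ℚP.≤-trans (ℚP.+-monoʳ-≤ (c * toℚ (J i)) (below i)) (h i))

  Only : Row M → (Fin M → ℕ) → Fin M → Set
  Only D J e = D e ≡ true × 1 ℕ.≤ J e × (∀ f → D f ≡ true → f ≢ e → J f ≡ 0)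

  -- If every point uses D and D has total weight one, each point uses exactly one element of D.
  disintegrate : ∀ {G : (Fin M → ℕ) → Set} {z : Vec M} (D : Row M) →
    (∀ {J} → G J → ∃[ e ] D e ≡ true × 1 ℕ.≤ J e) →
    dot (indicator D) z ≡ 1ℚ → Cone G 1ℚ z →
    Σ[ β ∈ (Fin M → Vec M) ] (∀ e → Cone (λ J → G J × Only D J e) (indicator D e * z e) (β e)) ×
      (∀ i → ∑ (λ e → β e i) ≤ z i)
  disintegrate {G} {z} D pick unit-D C = finish (slices (λ J e → G J × D e ≡ true × 1 ℕ.≤ J e)
      (λ g → let (e , d , b) = pick g in e , g , d , b) C)
    where
    finish : Slices (λ J e → G J × D e ≡ true × 1 ℕ.≤ J e) 1ℚ z →
      Σ[ β ∈ (Fin M → Vec M) ] (∀ e → Cone (λ J → G J × Only D J e) (indicator D e * z e) (β e)) ×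
        (∀ i → ∑ (λ e → β e i) ≤ z i)
    finish (ω , β , cones , total , below) = β ,
      (λ e → subst (λ u → Cone _ u (β e)) (weights e) (cone-map (refine e) (cone-support (cones e)))) , below
      where
      β≥0 : ∀ e i → 0ℚ ≤ β e i
      β≥0 e = cone-nonneg (cones e)
      ω≤β : ∀ e → ω e ≤ β e e
      ω≤β e = weight≤ e (proj₂ ∘ proj₂) (cones e)
      ω≤ : ∀ e → ω e ≤ indicator D e * z e
      ω≤ e with D e in eq
      ... | true = subst (ω e ≤_) (sym (ℚP.*-identityˡ (z e)))
        (ℚP.≤-trans (ω≤β e) (ℚP.≤-trans (term≤∑ (λ f → β≥0 f e) e) (below e)))
      ... | false with sign? (ω e) | ω e ℚP.≟ 0ℚ
      ... | _ | yes z₀ = ℚP.≤-reflexive (trans z₀ (sym (ℚP.*-zeroˡ (z e))))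
      ... | inj₂ neg | no _ = ⊥-elim (<⇒≱ neg (weight-nonneg (cones e)))
      ... | inj₁ pos | no nz = ⊥-elim
        (true≢false (proj₁ (proj₂ (proj₂ (weight-pos (≤∧≢⇒< pos (nz ∘ sym)) (cones e))))) eq)
      -- `ω≤` holds termwise and both sides have total one, so every term is an equality.
      weights : ∀ e → ω e ≡ indicator D e * z e
      weights e = sym (-≡0⇒≡ (∑≡0⇒ (λ i → 0≤- (ω≤ i)) gap e))
        where
        lem : ∀ a b → a - b ≡ a + (- 1ℚ) * b
        lem = solve-∀ ℚ-ring
        gap : ∑ (λ i → indicator D i * z i - ω i) ≡ 0ℚ
        gap = trans (∑-cong (λ i → lem (indicator D i * z i) (ω i)))
          (trans (∑-+ (λ i → indicator D i * z i) (λ i → (- 1ℚ) * ω i))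
            (trans (cong₂ _+_ unit-D (trans (∑-* (- 1ℚ) ω) (cong ((- 1ℚ) *_) total))) refl))
      -- The slice of `f` alone already exhausts the available `z f`, which leaves nothing of `f`
      -- for the slice of `e`.
      β≡0 : ∀ e f → D f ≡ true → f ≢ e → β e f ≡ 0ℚ
      β≡0 e f d ne = ℚP.≤-antisym (≤-by (0≤- both) (lem (β e f) (z f))) (β≥0 e f)
        where
        zf : ω f ≡ z f
        zf = trans (weights f) (trans (cong (λ b → ⟦ b ⟧ * z f) d) (ℚP.*-identityˡ (z f)))
        both : z f + β e f ≤ z f
        both = ℚP.≤-trans (ℚP.+-monoˡ-≤ (β e f) (subst (_≤ β f f) zf (ω≤β f)))
          (ℚP.≤-trans (two-terms≤∑ (λ i → β≥0 i f) ne) (below f))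
        lem : ∀ b z → 0ℚ ≡ b + (z - (z + b))
        lem = solve-∀ ℚ-ring
      refine : ∀ e {J} → (G J × D e ≡ true × 1 ℕ.≤ J e) × (∀ i → β e i ≡ 0ℚ → J i ≡ 0) → G J × Only D J e
      refine e ((g , d , b) , supp) = g , d , b , λ f df ne → supp f (β≡0 e f df ne)

  splice : ∀ {A : Set} → Row M → (Fin M → A) → (Fin M → A) → Fin M → A
  splice P y x i = if P i then y i else x i

  module _ (P : Row M) {G₁ G₂ G : (Fin M → ℕ) → Set}
    (combine : ∀ {J K} → G₁ J → G₂ K → G (splice P K J)) where

    private
      inner : ∀ {J w β} → G₁ J → Cone G₂ w β → Cone G w (splice P β (λ i → w * toℚ (J i)))
      inner {J} g (nil {v} h) = nil below
        where
        below : ∀ i → 0ℚ ≤ splice P v (λ i → 0ℚ * toℚ (J i)) i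
        below i with P i
        ... | true  = h i
        ... | false = ℚP.≤-reflexive (sym (ℚP.*-zeroˡ (toℚ (J i))))
      inner {J} g (cons {w} {v} {w′} {v′} c K p k C q h) = cons c (splice P K J) p (combine g k) (inner g C)
        q below
        where
        lem : ∀ c w j → c * j + w * j ≡ (c + w) * j
        lem = solve-∀ ℚ-ring
        below : ∀ i → c * toℚ (splice P K J i) + splice P v′ (λ i → w′ * toℚ (J i)) i ≤ splice P v
          (λ i → w * toℚ (J i)) i
        below i with P i
        ... | true  = h i
        ... | false = ℚP.≤-reflexive (trans (lem c w′ (toℚ (J i))) (cong (_* toℚ (J i)) (sym q)))

      outer : ∀ {u w α β} → Cone G₁ u α → Cone G₂ w β → Cone G (u * w)
        (splice P (λ i → u * β i) (λ i → w * α i))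
      outer {w = w} {β = β} (nil {v} h) D = subst
        (λ k → Cone G k (splice P (λ i → 0ℚ * β i) (λ i → w * v i))) (sym (ℚP.*-zeroˡ w)) (nil below)
        where
        below : ∀ i → 0ℚ ≤ splice P (λ i → 0ℚ * β i) (λ i → w * v i) i
        below i with P i
        ... | true  = ℚP.≤-reflexive (sym (ℚP.*-zeroˡ (β i)))
        ... | false = 0≤* (weight-nonneg D) (h i)
      outer {w = w} {β = β} (cons {u} {v} {u′} {v′} c J p g C q h) D =
        subst (λ k → Cone G k (splice P (λ i → u * β i) (λ i → w * v i)))
          (trans (sym (ℚP.*-distribʳ-+ w c u′)) (cong (_* w) (sym q)))
          (cone-up (cone-++ (cone-scale c p (inner g D)) (outer C D)) below)
        where
        lem : ∀ c u b → c * b + u * b ≡ (c + u) * b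
        lem = solve-∀ ℚ-ring
        lem₂ : ∀ c w j v → c * (w * j) + w * v ≡ w * (c * j + v)
        lem₂ = solve-∀ ℚ-ring
        below : ∀ i → c * splice P β (λ i → w * toℚ (J i)) i + splice P (λ i → u′ * β i) (λ i → w * v′ i) i
                  ≤ splice P (λ i → u * β i) (λ i → w * v i) i
        below i with P i
        ... | true  = ℚP.≤-reflexive (trans (lem c u′ (β i)) (cong (_* β i) (sym q)))
        ... | false = subst (_≤ w * v i) (sym (lem₂ c w (toℚ (J i)) (v′ i)))
          (*-mono-≤ʳ (weight-nonneg D) (h i))

    -- Independent coupling: every point of the first combination is spliced with every point of the
    -- second, with the product of their weights. `outer` thus produces total weight w squared, and
    -- division by w restores the marginals, `β` on `P` and `α` off it. Weight zero is treated apart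
    -- because it has no reciprocal.
    cone-splice : ∀ {w α β} → Cone G₁ w α → Cone G₂ w β → Cone G w (splice P β α)
    cone-splice {w} {α} {β} C D with w ℚP.≟ 0ℚ
    ... | yes refl = nil below
      where
      below : ∀ i → 0ℚ ≤ splice P β α i
      below i with P i
      ... | true  = cone-nonneg D i
      ... | false = cone-nonneg C i
    ... | no nz = rescale (inverse⁺ w (≤∧≢⇒< (weight-nonneg C) (nz ∘ sym)))
      where
      lem : ∀ r w a → r * (w * a) ≡ (r * w) * a
      lem = solve-∀ ℚ-ring
      rescale : ∃[ r ] 0ℚ < r × r * w ≡ 1ℚ → Cone G w (splice P β α)
      rescale (r , pr , e) = subst (λ k → Cone G k (splice P β α)) (cancel w)
        (cone-up (cone-scale r pr (outer C D)) below)
        where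
        cancel : ∀ a → r * (w * a) ≡ a
        cancel a = trans (lem r w a) (trans (cong (_* a) e) (ℚP.*-identityˡ a))
        below : ∀ i → r * splice P (λ i → w * β i) (λ i → w * α i) i ≤ splice P β α i
        below i with P i
        ... | true  = ℚP.≤-reflexive (cancel (β i))
        ... | false = ℚP.≤-reflexive (cancel (α i))

  -- Both combinations disintegrate over `D` with the same weights `z e`, so slices belonging to the
  -- same element can be coupled. Hence only points that use the same element of `D` are ever
  -- spliced together.
  glue : ∀ {G₁ G₂ G : (Fin M → ℕ) → Set} {z : Vec M} (D P : Row M) →
    (∀ {J} → G₁ J → ∃[ e ] D e ≡ true × 1 ℕ.≤ J e) → (∀ {J} → G₂ J → ∃[ e ] D e ≡ true × 1 ℕ.≤ J e) →
    (∀ {J K e} → G₁ J × Only D J e → G₂ K × Only D K e → G (splice P K J)) →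
    dot (indicator D) z ≡ 1ℚ → Cone G₁ 1ℚ z → Cone G₂ 1ℚ z → Cone G 1ℚ z
  glue {G₁} {G₂} {G} {z} D P pick₁ pick₂ combine unit-D C₁ C₂ =
    assemble (disintegrate D pick₁ unit-D C₁) (disintegrate D pick₂ unit-D C₂)
    where
    Family : ((Fin M → ℕ) → Set) → Set
    Family G = Σ[ β ∈ (Fin M → Vec M) ] (∀ e → Cone (λ J → G J × Only D J e) (indicator D e * z e) (β e)) ×
      (∀ i → ∑ (λ e → β e i) ≤ z i)
    assemble : Family G₁ → Family G₂ → Cone G 1ℚ z
    assemble (α , cones₁ , below₁) (β , cones₂ , below₂) =
      subst (λ k → Cone G k z) unit-D (cone-up
        (cone-∑ (λ e → indicator D e * z e) (λ e → splice P (β e) (α e))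
          (λ e → cone-splice P combine (cones₁ e) (cones₂ e))) below)
      where
      below : ∀ i → ∑ (λ e → splice P (β e) (α e) i) ≤ z i
      below i with P i
      ... | true  = below₂ i
      ... | false = below₁ i

-- Cuts and parities

consᵇ : ∀ {n} → Bool → (Fin n → Bool) → Fin (suc n) → Bool
consᵇ b U zero    = b
consᵇ b U (suc i) = U i

subsets : ∀ n → List (Fin n → Bool)
subsets zero    = (λ ()) ∷ []
subsets (suc n) = map (consᵇ false) (subsets n) ++ map (consᵇ true) (subsets n)

-- Subsets are functions and are found in the list only up to pointwise equality; this is why cut
-- values, parities and set functions come with congruence lemmas.
subsets-complete : ∀ {n} (U : Fin n → Bool) → ∃[ U′ ] U′ ∈ subsets n × (∀ v → U′ v ≡ U v)
subsets-complete {zero}  U = (λ ()) , here refl , λ ()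
subsets-complete {suc n} U with subsets-complete (U ∘ suc) | U zero in eq
... | U′ , m , h | false = consᵇ false U′ , MP.∈-++⁺ˡ (MP.∈-map⁺ (consᵇ false) m) , λ
  { zero → sym eq ; (suc v) → h v }
... | U′ , m , h | true  = consᵇ true U′ , MP.∈-++⁺ʳ (map (consᵇ false) (subsets n))
  (MP.∈-map⁺ (consᵇ true) m) ,
  λ { zero → sym eq ; (suc v) → h v }

odd : ℕ → Bool
odd zero    = false
odd (suc k) = not (odd k)

⨁-one : ∀ {n} {f : Fin n → Bool} a → (∀ i → i ≢ a → f i ≡ false) → ⨁ f ≡ f a
⨁-one {f = f} a h = trans (⨁-cong pt) (⨁-single a f)
  where
  pt : ∀ i → f i ≡ (i == a) ∧ f i
  pt i with i F.≟ a
  ... | yes _ = refl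
  ... | no ne = h i ne

⨁-true : ∀ {n} {f : Fin n → Bool} → ⨁ f ≡ true → ∃[ i ] f i ≡ true
⨁-true {f = f} h with FP.any? (λ i → f i B.≟ true)
... | yes r = r
... | no r  = ⊥-elim (true≢false h (⨁-zero (λ i → ≢true (λ t → r (i , t)))))

xor-swap : ∀ a b c d → (a xor b) xor (c xor d) ≡ (a xor c) xor (b xor d)
xor-swap true  true  true  d = refl
xor-swap true  true  false d = sym (BP.not-involutive d)
xor-swap true  false c     d = BP.not-distribˡ-xor c d
xor-swap false true  c     d = BP.not-distribʳ-xor c d
xor-swap false false c     d = refl

xor≡false⇒ : ∀ {a b} → a xor b ≡ false → a ≡ b
xor≡false⇒ {true}  {true}  _ = refl
xor≡false⇒ {false} {false} _ = refl

module _ {n M : ℕ} (s t : Fin M → Fin n) where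

  cross : (Fin n → Bool) → Row M
  cross U e = U (s e) xor U (t e)

  parity : (Fin M → ℕ) → (Fin n → Bool) → Bool
  parity J U = ⨁ (λ e → odd (J e) ∧ cross U e)

  cutval : Vec M → (Fin n → Bool) → ℚ
  cutval z U = dot (indicator (cross U)) z

  cross-cong : ∀ {U U′} → (∀ v → U v ≡ U′ v) → ∀ e → cross U e ≡ cross U′ e
  cross-cong h e = cong₂ _xor_ (h (s e)) (h (t e))

  cross-xor : ∀ U U′ e → cross (λ v → U v xor U′ v) e ≡ cross U e xor cross U′ e
  cross-xor U U′ e = xor-swap (U (s e)) (U′ (s e)) (U (t e)) (U′ (t e))

  parity-cong : ∀ {J U U′} → (∀ v → U v ≡ U′ v) → parity J U ≡ parity J U′
  parity-cong {J} h = ⨁-cong (λ e → cong (odd (J e) ∧_) (cross-cong h e))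

  cutval-cong : ∀ {z U U′} → (∀ v → U v ≡ U′ v) → cutval z U ≡ cutval z U′
  cutval-cong {z} h = ∑-cong (λ e → cong (λ b → ⟦ b ⟧ * z e) (cross-cong h e))

  -- Crossing is linear over the two-element field: the cut of a symmetric difference is the
  -- symmetric difference of the cuts.
  parity-xor : ∀ J U U′ → parity J (λ v → U v xor U′ v) ≡ parity J U xor parity J U′
  parity-xor J U U′ = trans (⨁-cong (λ e → trans (cong (odd (J e) ∧_) (cross-xor U U′ e))
      (BP.∧-distribˡ-xor (odd (J e)) (cross U e) (cross U′ e))))
    (⨁-xor (λ e → odd (J e) ∧ cross U e) (λ e → odd (J e) ∧ cross U′ e))

  parity-const : ∀ J b → parity J (λ _ → b) ≡ false
  parity-const J b = ⨁-zero (λ e → trans (cong (odd (J e) ∧_) (BP.xor-same b)) (BP.∧-zeroʳ (odd (J e))))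

  cross-not : ∀ U e → cross (not ∘ U) e ≡ cross U e
  cross-not U e = lem (U (s e)) (U (t e))
    where
    lem : ∀ a b → not a xor not b ≡ a xor b
    lem true  b = refl
    lem false b = BP.not-involutive b

  -- T-joins, for T the set of odd-degree nodes of F, after contracting the fibres of φ

  module _ (F : Fin M → ℕ) where

    -- Instead of naming T and prescribing degrees, agreement with `F` modulo two is required on
    -- every cut. The sets `U ∘ φ` are those saturated by the contraction, that is, the node sets of
    -- the contracted graph.
    IsJoin : (Fin n → Fin n) → (Fin M → ℕ) → Set
    IsJoin φ J = ∀ U → parity J (U ∘ φ) ≡ parity F (U ∘ φ)

    Dominates : (Fin n → Fin n) → Vec M → Set
    Dominates φ z = (∀ e → 0ℚ ≤ z e) × (∀ U → parity F (U ∘ φ) ≡ true → 1ℚ ≤ cutval z (U ∘ φ))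

    Idempotent : (Fin n → Fin n) → Set
    Idempotent φ = ∀ v → φ (φ v) ≡ φ v

    -- A coarser contraction has fewer saturated sets, hence fewer cut constraints.
    dominates-coarser : ∀ {φ φ′ z} → (∀ v → φ′ (φ v) ≡ φ′ v) → Dominates φ z → Dominates φ′ z
    dominates-coarser {φ} {φ′} {z} h (pos , cut) = pos , λ U o →
      subst (1ℚ ≤_) (cutval-cong {z} (λ v → cong U (h v)))
        (cut (U ∘ φ′) (trans (parity-cong {F} (λ v → cong U (h v))) o))

    module _ (φ : Fin n → Fin n) (idem : Idempotent φ) (W : Fin n → Bool) (resp : ∀ v → W (φ v) ≡ W v) where

      contract : Fin n → Fin n → Fin n
      contract u v = if W v then u else φ v

      contract-absorbs : ∀ u v → contract u (φ v) ≡ contract u v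
      contract-absorbs u v rewrite resp v with W v
      ... | true  = refl
      ... | false = idem v

      contract-idem : ∀ {u} → W u ≡ true → Idempotent (contract u)
      contract-idem {u} wu v with W v in eq
      ... | true  rewrite wu = refl
      ... | false rewrite trans (resp v) eq = idem v

      contract-resp : ∀ {u} → W u ≡ true → ∀ v → W (contract u v) ≡ W v
      contract-resp wu v with W v in eq
      ... | true  = wu
      ... | false = trans (resp v) eq

      outside : (Fin n → Bool) → Fin n → Bool
      outside U v = U (φ v) ∧ not (W v)

      outside-contract : ∀ {u} → W u ≡ true → ∀ U v → outside U (contract u v) ≡ outside U v
      outside-contract {u} wu U v with W v in eq
      ... | true  rewrite wu = trans (BP.∧-zeroʳ (U (φ u))) (sym (BP.∧-zeroʳ (U (φ v))))
      ... | false rewrite trans (resp v) eq = cong (λ w → U w ∧ true) (idem v)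

      -- What a join retains of the graph with `W` shrunk to one node once that node is forgotten:
      -- it is odd on the cut of `W` and agrees with `F` on the saturated sets avoiding `W`.
      Outer : (Fin M → ℕ) → Set
      Outer J = parity J W ≡ true × (∀ U → parity J (outside U) ≡ parity F (outside U))

      outer : ∀ {u J} → W u ≡ true → parity F W ≡ true → IsJoin (contract u) J → Outer J
      outer {u} {J} wu o join =
        trans (sym (parity-cong {J} (contract-resp wu)))
          (trans (join W) (trans (parity-cong {F} (contract-resp wu)) o)) ,
        λ U → trans (sym (parity-cong {J} (outside-contract wu U)))
          (trans (join (outside U)) (parity-cong {F} (outside-contract wu U)))

    parity-pick : ∀ {J W} → parity J W ≡ true → ∃[ e ] cross W e ≡ true × 1 ℕ.≤ J e
    parity-pick {J} {W} h with ⨁-true h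
    ... | e , q with ∧-true {odd (J e)} {cross W e} q
    ... | o , c = e , c , positive′ (J e) o
      where
      positive′ : ∀ k → odd k ≡ true → 1 ℕ.≤ k
      positive′ (suc k) _ = ℕ.s≤s ℕ.z≤n

    -- The total over the cut is odd and comes from the single edge `e`, so the multiplicity of `e`
    -- is itself odd. Two joins using the same edge of the cut therefore have equal parities on all
    -- of it.
    only-odd : ∀ {J W e} → parity J W ≡ true → Only (cross W) J e → ∀ f → cross W f ≡ true → odd (J f) ≡
      (f == e)
    only-odd {J} {W} {e} h (d , _ , zero-else) f df with f F.≟ e
    ... | no ne = cong odd (zero-else f df ne)
    ... | yes refl = sym (trans (sym h)
      (trans (⨁-one e others) (trans (cong (odd (J e) ∧_) d) (BP.∧-identityʳ (odd (J e))))))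
      where
      others : ∀ i → i ≢ e → odd (J i) ∧ cross W i ≡ false
      others i ne with cross W i in eq
      ... | true  rewrite zero-else i eq ne = refl
      ... | false = BP.∧-zeroʳ (odd (J i))

    module _ (φ : Fin n → Fin n) (idem : Idempotent φ) (W : Fin n → Bool) (resp : ∀ v → W (φ v) ≡ W v) where

      private
        nW : Fin n → Bool
        nW = not ∘ W
        nresp : ∀ v → nW (φ v) ≡ nW v
        nresp v = cong not (resp v)
        inside : Row M
        inside e = W (s e) ∧ W (t e)

      -- Split the set into its part `X` in `W` and its part `Y` outside; parities of cuts add.
      -- Edges crossing `X` have an end in `W`: inside `W` the splice is `K`, and on the cut of `W`
      -- it is `J`, which has the parities of `K` there because both use only `e`. Edges crossing
      -- `Y` see `J` outright.
      splice-join : ∀ {J K e} → Outer φ idem W resp J × Only (cross W) J e →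
        Outer φ idem nW nresp K × Only (cross W) K e → IsJoin φ (splice inside K J)
      splice-join {J} {K} {e} ((oJ , outJ) , onlyJ) ((oK′ , outK) , onlyK) U = begin
        parity L (U ∘ φ)                          ≡⟨ parity-cong {L} split ⟩
        parity L (λ v → X v xor Y v)              ≡⟨ parity-xor L X Y ⟩
        parity L X xor parity L Y                 ≡⟨ cong₂ _xor_ (trans (⨁-cong agreeK) (outK U))
          (trans (⨁-cong agreeJ) (outJ U)) ⟩
        parity F X xor parity F Y                 ≡⟨ sym (parity-xor F X Y) ⟩
        parity F (λ v → X v xor Y v)              ≡⟨ parity-cong {F} (sym ∘ split) ⟩
        parity F (U ∘ φ)                          ∎
        where
        open ≡-Reasoning
        L = splice inside K J
        X = outside φ idem nW nresp U
        Y = outside φ idem W resp U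
        split : ∀ v → U (φ v) ≡ X v xor Y v
        split v with U (φ v) | W v
        ... | true  | true  = refl
        ... | true  | false = refl
        ... | false | true  = refl
        ... | false | false = refl
        oK : parity K W ≡ true
        oK = trans (sym (⨁-cong (λ f → cong (odd (K f) ∧_) (cross-not W f)))) oK′
        same : ∀ f → cross W f ≡ true → odd (J f) ≡ odd (K f)
        same f c = trans (only-odd {J} {W} {e} oJ onlyJ f c) (sym (only-odd {K} {W} {e} oK onlyK f c))
        agreeK : ∀ f → odd (L f) ∧ cross X f ≡ odd (K f) ∧ cross X f
        agreeK f with W (s f) | W (t f) | same f
        ... | true  | true  | _ = refl
        ... | true  | false | h = cong (_∧ _) (h refl)
        ... | false | true  | h = cong (_∧ _) (h refl)
        ... | false | false | _ = trans (cong (odd (J f) ∧_) no-cross) (trans (BP.∧-zeroʳ (odd (J f)))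
              (sym (trans (cong (odd (K f) ∧_) no-cross) (BP.∧-zeroʳ (odd (K f))))))
          where
          no-cross : (U (φ (s f)) ∧ false) xor (U (φ (t f)) ∧ false) ≡ false
          no-cross rewrite BP.∧-zeroʳ (U (φ (s f))) | BP.∧-zeroʳ (U (φ (t f))) = refl
        agreeJ : ∀ f → odd (L f) ∧ cross Y f ≡ odd (J f) ∧ cross Y f
        agreeJ f with W (s f) | W (t f) | same f
        ... | true  | true  | _ = trans (cong (odd (K f) ∧_) no-cross) (trans (BP.∧-zeroʳ (odd (K f)))
              (sym (trans (cong (odd (J f) ∧_) no-cross) (BP.∧-zeroʳ (odd (J f))))))
          where
          no-cross : (U (φ (s f)) ∧ false) xor (U (φ (t f)) ∧ false) ≡ false
          no-cross rewrite BP.∧-zeroʳ (U (φ (s f))) | BP.∧-zeroʳ (U (φ (t f))) = refl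
        ... | true  | false | _ = refl
        ... | false | true  | _ = refl
        ... | false | false | _ = refl

      -- On a tight odd cut the total weight is one while every join must use the cut, so each join
      -- uses exactly one of its edges. The two graphs obtained by shrinking either side can then be
      -- solved separately and matched along that common edge.
      glue-joins : ∀ {z u w} → W u ≡ true → W w ≡ false → parity F W ≡ true → cutval z W ≡ 1ℚ →
        Cone (IsJoin (contract φ idem W resp u)) 1ℚ z → Cone (IsJoin (contract φ idem nW nresp w)) 1ℚ z →
        Cone (IsJoin φ) 1ℚ z
      glue-joins {z} {u} {w} wu ww o tight C₁ C₂ = glue (cross W) inside
        (λ {J} g → parity-pick {J} {W} (proj₁ g))
        (λ {J} g → let (e , c , b) = parity-pick {J} {nW} (proj₁ g) in e , trans (sym (cross-not W e)) c , b)
        (λ {J} {K} {e} → splice-join {J} {K} {e}) tight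
        (cone-map (λ {J} → outer φ idem W resp {u} {J} wu o) C₁)
        (cone-map (λ {J} → outer φ idem nW nresp {w} {J} (cong not ww)
          (trans (⨁-cong (λ e → cong (odd (F e) ∧_) (cross-not W e))) o)) C₂)

    -- An edge of weight at least one may be contracted, its own parity being chosen last.
    module _ (φ : Fin n → Fin n) (idem : Idempotent φ) (e₀ : Fin M) where

      private
        a = φ (s e₀)
        b = φ (t e₀)
        star : Fin n → Bool
        star v = φ v == a

      merge : Fin n → Fin n
      merge v = if φ v == a then b else φ v

      merge-absorbs : ∀ v → merge (φ v) ≡ merge v
      merge-absorbs v rewrite idem v = refl

      merge-idem : a ≢ b → Idempotent merge
      merge-idem ne v with φ v == a in eq
      ... | true  rewrite idem (t e₀) | ==-≢ (ne ∘ sym) = refl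
      ... | false rewrite idem v | eq = refl

      module _ (ne : a ≢ b) where

        -- `fix` resets the multiplicity of `e₀` to the 0 or 1 that gives the cut around `a` the
        -- parity it has in `F`. Cuts that keep `a` and `b` together do not contain `e₀` and are not
        -- affected.
        clear fix : (Fin M → ℕ) → Fin M → ℕ
        clear J e = if e == e₀ then 0 else J e
        fix J e = if e == e₀ then ⟦ parity F star xor parity (clear J) star ⟧ℕ else J e

        private
          odd-⟦⟧ : ∀ q → odd ⟦ q ⟧ℕ ≡ q
          odd-⟦⟧ true  = refl
          odd-⟦⟧ false = refl

          uncrossed : ∀ {Y} J K → cross Y e₀ ≡ false → (∀ e → e ≢ e₀ → J e ≡ K e) → parity J Y ≡ parity K Y
          uncrossed {Y} J K h same = ⨁-cong pt
            where
            pt : ∀ e → odd (J e) ∧ cross Y e ≡ odd (K e) ∧ cross Y e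
            pt e with e F.≟ e₀
            ... | yes refl rewrite h = trans (BP.∧-zeroʳ (odd (J e))) (sym (BP.∧-zeroʳ (odd (K e))))
            ... | no p rewrite same e p = refl

          star-crosses : cross star e₀ ≡ true
          star-crosses rewrite ==-refl a | ==-≢ (ne ∘ sym) = refl

          fix-other : ∀ J e → e ≢ e₀ → fix J e ≡ J e
          fix-other J e p rewrite ==-≢ p = refl

          fix-star : ∀ J → parity (fix J) star ≡ parity F star
          fix-star J = trans (⨁-cong pt)
            (trans (⨁-xor (λ e → (e == e₀) ∧ q) (λ e → odd (clear J e) ∧ cross star e))
              (trans (cong (_xor parity (clear J) star) (⨁-single e₀ (λ _ → q)))
                (lem (parity F star) (parity (clear J) star))))
            where
            q = parity F star xor parity (clear J) star
            lem : ∀ x y → (x xor y) xor y ≡ x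
            lem x y = trans (BP.xor-assoc x y y) (trans (cong (x xor_) (BP.xor-same y)) (BP.xor-identityʳ x))
            pt : ∀ e → odd (fix J e) ∧ cross star e ≡ ((e == e₀) ∧ q) xor (odd (clear J e) ∧ cross star e)
            pt e with e F.≟ e₀
            ... | yes refl rewrite star-crosses | odd-⟦⟧ q = trans (BP.∧-identityʳ q)
              (sym (BP.xor-identityʳ q))
            ... | no _ = refl

          fix-join′ : ∀ {J} → IsJoin merge J → ∀ U → U a ≡ U b → parity (fix J) (U ∘ φ) ≡ parity F (U ∘ φ)
          fix-join′ {J} join U h = trans (uncrossed {U ∘ φ} (fix J) J flat (fix-other J))
              (trans (parity-cong {J} {U ∘ φ} {U ∘ merge} eq)
                (trans (join U) (parity-cong {F} {U ∘ merge} {U ∘ φ} (sym ∘ eq))))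
            where
            flat : cross (U ∘ φ) e₀ ≡ false
            flat rewrite h = BP.xor-same (U b)
            eq : ∀ v → U (φ v) ≡ U (merge v)
            eq v with φ v F.≟ a
            ... | yes p = trans (cong U p) h
            ... | no _  = refl

          -- A set separating `a` from `b` differs by the node `a` from one that does not. The
          -- latter is a set of the merged graph, and the cut around `a` was made right by `fix`.
          fix-join : ∀ {J} → IsJoin merge J → IsJoin φ (fix J)
          fix-join {J} join U with U a B.≟ U b
          ... | yes h = fix-join′ join U h
          ... | no h = begin
            parity (fix J) (U ∘ φ)                                ≡⟨ parity-cong {fix J} split ⟩
            parity (fix J) (λ v → U′ (φ v) xor star v)            ≡⟨ parity-xor (fix J) (U′ ∘ φ) star ⟩
            parity (fix J) (U′ ∘ φ) xor parity (fix J) star       ≡⟨ cong₂ _xor_ (fix-join′ join U′ flat)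
              (fix-star J) ⟩
            parity F (U′ ∘ φ) xor parity F star                   ≡⟨ sym (parity-xor F (U′ ∘ φ) star) ⟩
            parity F (λ v → U′ (φ v) xor star v)                  ≡⟨ parity-cong {F} (sym ∘ split) ⟩
            parity F (U ∘ φ)                                      ∎
            where
            open ≡-Reasoning
            U′ : Fin n → Bool
            U′ v = U v xor (v == a)
            split : ∀ v → U (φ v) ≡ U′ (φ v) xor star v
            split v = sym (trans (BP.xor-assoc (U (φ v)) (star v) (star v))
              (trans (cong (U (φ v) xor_) (BP.xor-same (star v))) (BP.xor-identityʳ (U (φ v)))))
            flip : ∀ x y → x ≢ y → x xor true ≡ y xor false
            flip true  true  k = ⊥-elim (k refl)
            flip true  false k = refl
            flip false true  k = refl
            flip false false k = ⊥-elim (k refl)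
            flat : U′ a ≡ U′ b
            flat rewrite ==-refl a | ==-≢ (ne ∘ sym) = flip (U a) (U b) h

          -- The repaired joins use `e₀` at most once each, so the total weight `w` is enough there.
          fixed : ∀ {w v} → Cone (IsJoin merge) w v → Cone (IsJoin φ) w (λ e → if e == e₀ then w else v e)
          fixed (nil {v} h) = nil below
            where
            below : ∀ e → 0ℚ ≤ (if e == e₀ then 0ℚ else v e)
            below e with e == e₀
            ... | true  = ℚP.≤-refl
            ... | false = h e
          fixed (cons {w} {v} {w′} {v′} c J p g C q h) = cons c (fix J) p (fix-join g) (fixed C) q below
            where
            at-most : ∀ b → c * toℚ ⟦ b ⟧ℕ ≤ c
            at-most true  = ℚP.≤-reflexive (ℚP.*-identityʳ c)
            at-most false = subst (_≤ c) (sym (ℚP.*-zeroʳ c)) (ℚP.<⇒≤ p)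
            below : ∀ e → c * toℚ (fix J e) + (if e == e₀ then w′ else v′ e) ≤ (if e == e₀ then w else v e)
            below e with e == e₀
            ... | true  = ℚP.≤-trans (ℚP.+-monoˡ-≤ w′ (at-most (parity F star xor parity (clear J) star)))
              (ℚP.≤-reflexive (sym q))
            ... | false = h e

        uncontract : ∀ {z} → 1ℚ ≤ z e₀ → Cone (IsJoin merge) 1ℚ z → Cone (IsJoin φ) 1ℚ z
        uncontract {z} big C = cone-up (fixed C) below
          where
          below : ∀ e → (if e == e₀ then 1ℚ else z e) ≤ z e
          below e with e F.≟ e₀
          ... | yes refl = big
          ... | no _ = ℚP.≤-refl

-- Parity sums and the exclusion of odd cycles of tight nodes

size-< : ∀ {n} {P Q : Row n} u → (∀ v → P v ≡ true → Q v ≡ true) → Q u ≡ true → P u ≡ false → size P ℕ.<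
  size Q
size-< {P = P} {Q} u sub qu pu = subst (size P ℕ.<_) (sym (size-∖ {P = Q} qu)) (ℕ.s≤s (∑ℕ-mono pt))
  where
  pt : ∀ v → ⟦ P v ⟧ℕ ℕ.≤ ⟦ (Q ∖ u) v ⟧ℕ
  pt v with P v in eq | v F.≟ u
  ... | false | _ = ℕ.z≤n
  ... | true  | yes refl = ⊥-elim (true≢false eq pu)
  ... | true  | no _ rewrite sub v eq = ℕP.≤-refl

Distinct : ∀ {n} → (Fin n → Bool) → Set
Distinct P = ∃[ u ] ∃[ v ] u ≢ v × P u ≡ true × P v ≡ true

AtMostOne : ∀ {n} → (Fin n → Bool) → Set
AtMostOne P = (∃[ v ] P v ≡ true × (∀ w → P w ≡ true → w ≡ v)) ⊎ (∀ w → P w ≡ false)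

classify : ∀ {n} (P : Fin n → Bool) → Distinct P ⊎ AtMostOne P
classify P with FP.any? (λ u → P u B.≟ true)
... | no none = inj₂ (inj₂ (λ w → ≢true (λ t → none (w , t))))
... | yes (u , pu) with FP.any? (λ v → ¬? (v F.≟ u) ×-dec (P v B.≟ true))
... | yes (v , ne , pv) = inj₁ (u , v , (λ e → ne (sym e)) , pu , pv)
... | no none = inj₂ (inj₁ (u , pu , only))
  where
  only : ∀ w → P w ≡ true → w ≡ u
  only w pw with w F.≟ u
  ... | yes e = e
  ... | no ne = ⊥-elim (none (w , ne , pw))

xsum : {A : Set} → (A → Bool) → List A → Bool
xsum c []      = false
xsum c (v ∷ L) = c v xor xsum c L

xsum-cong : {A : Set} {c c′ : A → Bool} {L : List A} → All (λ v → c v ≡ c′ v) L → xsum c L ≡ xsum c′ L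
xsum-cong []       = refl
xsum-cong (p ∷ ps) = cong₂ _xor_ p (xsum-cong ps)

xsum-∧ : {A : Set} (b : Bool) (c : A → Bool) (L : List A) → xsum (λ v → b ∧ c v) L ≡ b ∧ xsum c L
xsum-∧ b c []      = sym (BP.∧-zeroʳ b)
xsum-∧ b c (v ∷ L) = trans (cong ((b ∧ c v) xor_) (xsum-∧ b c L)) (sym (BP.∧-distribˡ-xor b (c v) (xsum c L)))

⨁-xsum : ∀ {M} {A : Set} (c : A → Fin M → Bool) (L : List A) → ⨁ (λ i → xsum (λ v → c v i) L) ≡ xsum
  (λ v → ⨁ (c v)) L
⨁-xsum c []      = ⨁-zero (λ _ → refl)
⨁-xsum c (v ∷ L) = trans (⨁-xor (c v) (λ i → xsum (λ v → c v i) L)) (cong (⨁ (c v) xor_) (⨁-xsum c L))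

odd-⟦⟧+ : ∀ b k → odd (⟦ b ⟧ℕ ℕ.+ k) ≡ b xor odd k
odd-⟦⟧+ true  k = refl
odd-⟦⟧+ false k = refl

odd-incidence : ∀ {M} {A : Set} (g : A → Row M) (L : List A) i → odd (incidence (map g L) i) ≡ xsum
  (λ v → g v i) L
odd-incidence g []      i = refl
odd-incidence g (v ∷ L) i = trans (odd-⟦⟧+ (g v i) (incidence (map g L) i))
  (cong (g v i xor_) (odd-incidence g L i))

incidence-filter : ∀ {M} {A : Set} {P : A → Set} (P? : ∀ v → Dec (P v)) (g : A → Row M) (L : List A) i →
  incidence (map g (filter P? L)) i ℕ.≤ incidence (map g L) i
incidence-filter P? g []      i = ℕ.z≤n
incidence-filter P? g (v ∷ L) i with does (P? v)
... | true  = ℕP.+-monoʳ-≤ ⟦ g v i ⟧ℕ (incidence-filter P? g L i)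
... | false = ℕP.≤-trans (incidence-filter P? g L i) (ℕP.m≤n+m _ ⟦ g v i ⟧ℕ)

opaque
  unfolding ∑ℕ
  incidence-tabulate : ∀ {M n} {A : Set} (g : A → Row M) (h : Fin n → A) i →
    incidence (map g (tabulate h)) i ≡ ∑ℕ (λ v → ⟦ g (h v) i ⟧ℕ)
  incidence-tabulate {n = zero}  g h i = refl
  incidence-tabulate {n = suc n} g h i = cong (⟦ g (h zero) i ⟧ℕ ℕ.+_) (incidence-tabulate g (h ∘ suc) i)

module _ {n M : ℕ} (s t : Fin M → Fin n) (F : Fin M → ℕ) where

  parity-xsum : ∀ {A : Set} (c : A → Bool) (S : A → Fin n → Bool) (L : List A) →
    parity s t F (λ w → xsum (λ v → c v ∧ S v w) L) ≡ xsum (λ v → c v ∧ parity s t F (S v)) L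
  parity-xsum c S []      = parity-const s t F false
  parity-xsum c S (v ∷ L) = trans (parity-xor s t F (λ w → c v ∧ S v w) (λ w → xsum (λ v → c v ∧ S v w) L))
    (cong₂ _xor_ (scale (c v)) (parity-xsum c S L))
    where
    scale : ∀ b → parity s t F (λ w → b ∧ S v w) ≡ b ∧ parity s t F (S v)
    scale true  = refl
    scale false = parity-const s t F false

  cross-xsum : ∀ {A : Set} (c : A → Bool) (S : A → Fin n → Bool) (L : List A) e →
    cross s t (λ w → xsum (λ v → c v ∧ S v w) L) e ≡ xsum (λ v → c v ∧ cross s t (S v) e) L
  cross-xsum c S []      e = refl
  cross-xsum c S (v ∷ L) e = trans (cross-xor s t (λ w → c v ∧ S v w) (λ w → xsum (λ v → c v ∧ S v w) L) e)
    (cong₂ _xor_ (sym (BP.∧-distribˡ-xor (c v) (S v (s e)) (S v (t e)))) (cross-xsum c S L e))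

  module Step (φ : Fin n → Fin n) (idem : Idempotent s t F φ) where

    -- Fixed points of the idempotent `φ` stand for the nodes of the contracted graph; the star of
    -- such a node is its whole fibre.
    active : Fin n → Bool
    active v = φ v == v

    star : Fin n → Fin n → Bool
    star v w = φ w == v

    module _ (z : Vec M) (dom : Dominates s t F φ z) where

      private
        z≥0 = proj₁ dom
        cutOK = proj₂ dom
        par = parity s t F
        cut = cutval s t z
        g : Fin n → Row M
        g v = cross s t (star v)

      support : Row M
      support e = not (does (z e ℚP.≟ 0ℚ))

      off-support : ∀ e → support e ≡ false → z e ≡ 0ℚ
      off-support e h with z e ℚP.≟ 0ℚ
      ... | yes p = p

      on-support : ∀ e → z e ≡ 0ℚ → support e ≡ false
      on-support e h with z e ℚP.≟ 0ℚ
      ... | yes p = refl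
      ... | no p  = ⊥-elim (p h)

      -- An odd cycle of tight nodes would be an odd cut of value zero; U is the node set of the cycle
      -- through v₀ along which d takes the values ±δ.
      module _ (v₀ : Fin n) (vs : List (Fin n)) (odds : All (λ v → par (star v) ≡ true) (v₀ ∷ vs))
        (d : Vec M) (supp : SupportedOn support d) (zs : All (λ v → rowSum (g v) d ≡ 0ℚ) vs)
        (two : ∀ e → support e ≡ true → incidence (map g (v₀ ∷ vs)) e ≡ 2)
        (exact : All (λ v → ExactlyTwo support (g v)) vs)
        (e f : Fin M) (e≢f : e ≢ f) (ge : g v₀ e ≡ true) (gf : g v₀ f ≡ true)
        (only : ∀ i → support i ≡ true → g v₀ i ≡ true → i ≡ e ⊎ i ≡ f)
        (de : d e ≢ 0ℚ) (sum≢0 : d e + d f ≢ 0ℚ) where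

        private
          δ = d e
          is : ℚ → Fin M → Bool
          is q i = does (d i ℚP.≟ q)
          -- The parity of the number of edges at `v` on which `d` takes the value `q`, needed for
          -- `q` equal to δ and to - δ.
          P : ℚ → Fin n → Bool
          P q v = ⨁ (λ i → is q i ∧ g v i)

          is⇒ : ∀ {q i} → is q i ≡ true → d i ≡ q
          is⇒ {q} {i} h with d i ℚP.≟ q
          ... | yes p = p
          ⇒is : ∀ {q i} → d i ≡ q → is q i ≡ true
          ⇒is {q} {i} h with d i ℚP.≟ q
          ... | yes _ = refl
          ... | no p  = ⊥-elim (p h)
          ⇒¬is : ∀ {q i} → d i ≢ q → is q i ≡ false
          ⇒¬is {q} {i} h with d i ℚP.≟ q
          ... | yes p = ⊥-elim (h p)
          ... | no _  = refl

          nonzero⇒support : ∀ {i} → d i ≢ 0ℚ → support i ≡ true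
          nonzero⇒support {i} h with support i in eq
          ... | true  = refl
          ... | false = ⊥-elim (h (supp i eq))

          odd-two : ∀ i → support i ≡ true → xsum (λ v → g v i) (v₀ ∷ vs) ≡ false
          odd-two i h = trans (sym (odd-incidence g (v₀ ∷ vs) i)) (cong odd (two i h))

          P-total : ∀ q → q ≢ 0ℚ → xsum (P q) (v₀ ∷ vs) ≡ false
          P-total q nz = trans (sym (⨁-xsum (λ v i → is q i ∧ g v i) (v₀ ∷ vs))) (⨁-zero pt)
            where
            pt : ∀ i → xsum (λ v → is q i ∧ g v i) (v₀ ∷ vs) ≡ false
            pt i = trans (xsum-∧ (is q i) (λ v → g v i) (v₀ ∷ vs)) (help (is q i) refl)
              where
              help : ∀ b → is q i ≡ b → b ∧ xsum (λ v → g v i) (v₀ ∷ vs) ≡ false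
              help false _ = refl
              help true h  = odd-two i (nonzero⇒support (λ z → nz (trans (sym (is⇒ h)) z)))

          -δ≢0 : - δ ≢ 0ℚ
          -δ≢0 h = de (trans (lem δ) (cong -_ h))
            where
            lem : ∀ x → x ≡ - (- x)
            lem = solve-∀ ℚ-ring

          P-two : ∀ q {v a b} → a ≢ b → g v a ≡ true → g v b ≡ true → q ≢ 0ℚ →
            (∀ i → support i ≡ true → g v i ≡ true → i ≡ a ⊎ i ≡ b) → P q v ≡ is q a xor is q b
          P-two q {v} {a} {b} ne ga gb nz o = trans (⨁-two a b ne others)
              (cong₂ _xor_ (trans (cong (is q a ∧_) ga) (BP.∧-identityʳ _))
                (trans (cong (is q b ∧_) gb) (BP.∧-identityʳ _)))
            where
            others : ∀ i → i ≢ a → i ≢ b → is q i ∧ g v i ≡ false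
            others i na nb with is q i in eq | g v i in eq′
            ... | false | _ = refl
            ... | true | false = refl
            ... | true | true with o i (nonzero⇒support (λ z → nz (trans (sym (is⇒ eq)) z))) eq′
            ... | inj₁ r = ⊥-elim (na r)
            ... | inj₂ r = ⊥-elim (nb r)

          nz : Fin M → Bool
          nz i = is δ i xor is (- δ) i

          opposite : ∀ {a b} → d a + d b ≡ 0ℚ → (is δ b ≡ is (- δ) a) × (is (- δ) b ≡ is δ a)
          opposite {a} {b} h = flip₁ , flip₂
            where
            neg : d b ≡ - d a
            neg = trans (lem (d a) (d b)) (trans (cong (_- d a) h) (ℚP.+-identityˡ (- d a)))
              where
              lem : ∀ x y → y ≡ (x + y) - x
              lem = solve-∀ ℚ-ring
            neg′ : d a ≡ - d b
            neg′ = trans (lem (d a)) (cong -_ (sym neg))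
              where
              lem : ∀ x → x ≡ - (- x)
              lem = solve-∀ ℚ-ring
            flip₁ : is δ b ≡ is (- δ) a
            flip₁ with is (- δ) a in eq
            ... | true  = ⇒is (trans neg (trans (cong -_ (is⇒ eq)) (lem δ)))
              where
              lem : ∀ x → - (- x) ≡ x
              lem = solve-∀ ℚ-ring
            ... | false = ⇒¬is (λ k → true≢false (⇒is (trans neg′ (cong -_ k))) eq)
            flip₂ : is (- δ) b ≡ is δ a
            flip₂ with is δ a in eq
            ... | true  = ⇒is (trans neg (cong -_ (is⇒ eq)))
            ... | false = ⇒¬is (λ k → true≢false (⇒is (trans neg′ (trans (cong -_ k) (lem δ)))) eq)
              where
              lem : ∀ x → - (- x) ≡ x
              lem = solve-∀ ℚ-ring

          -- The two support edges of a node with zero sum carry opposite values. So either both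
          -- have values ±δ, one of each sign, or neither does, and `P δ v` tells which: it says
          -- that `v` lies on the cycle.
          Uniform : Fin n → Set
          Uniform v = P δ v ≡ P (- δ) v × (∀ i → support i ≡ true → g v i ≡ true → P δ v ≡ nz i)

          uniform : ∀ {v} → rowSum (g v) d ≡ 0ℚ → ExactlyTwo support (g v) → Uniform v
          uniform {v} z₀ (a , b , ne , (_ , ga) , (_ , gb) , o) = trans pδ
            (sym (trans p-δ (trans (cong₂ _xor_ (sym o₁) o₂) (BP.xor-comm (is δ b) (is δ a))))) , at
            where
            opp = opposite {a} {b} (trans (sym (rowSum-two {Φ = support} supp ne ga gb o)) z₀)
            o₁ = proj₁ opp
            o₂ = proj₂ opp
            pδ = P-two δ {v} ne ga gb de o
            p-δ = P-two (- δ) {v} ne ga gb -δ≢0 o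
            at : ∀ i → support i ≡ true → g v i ≡ true → P δ v ≡ nz i
            at i si gi with o i si gi
            ... | inj₁ refl = trans pδ (cong (is δ i xor_) o₁)
            ... | inj₂ refl = trans pδ (trans (BP.xor-comm (is δ a) (is δ i)) (cong (is δ i xor_) (sym o₂)))

          uniforms : All Uniform vs
          uniforms = All.zipWith (λ (a , b) → uniform a b) (zs , exact)

          -- Every support edge lies in two of the listed stars, so the ends of δ-edges and of (-
          -- δ)-edges both sum to zero modulo two. The two counts agree at each node of `vs`, hence
          -- also at `v₀`.
          P₀ : P δ v₀ ≡ P (- δ) v₀
          P₀ = trans (xor≡false⇒ (P-total δ de))
            (trans (xsum-cong (All.map proj₁ uniforms)) (sym (xor≡false⇒ (P-total (- δ) -δ≢0))))

          δ≢-δ : δ ≢ - δ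
          δ≢-δ h = de (double (trans (cong (δ +_) h) (ℚP.+-inverseʳ δ)))
            where
            double : δ + δ ≡ 0ℚ → δ ≡ 0ℚ
            double k = trans (lem δ) (trans (cong (½ *_) k) (ℚP.*-zeroʳ ½))
              where
              lem : ∀ x → x ≡ ½ * (x + x)
              lem x = trans (sym (ℚP.*-identityˡ x))
                (trans (ℚP.*-distribʳ-+ x ½ ½) (sym (ℚP.*-distribˡ-+ ½ x x)))

          ¬neg-f : is (- δ) f ≡ false
          ¬neg-f = ⇒¬is (λ k → sum≢0 (trans (cong (δ +_) k) (ℚP.+-inverseʳ δ)))

          ¬neg-e : is (- δ) e ≡ false
          ¬neg-e = ⇒¬is δ≢-δ

          P₀≡false : P δ v₀ ≡ false
          P₀≡false = trans P₀ (trans (P-two (- δ) {v₀} e≢f ge gf -δ≢0 only) (cong₂ _xor_ ¬neg-e ¬neg-f))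

          pos-f : is δ f ≡ true
          pos-f = trans (sym (xor≡false⇒ (trans (sym (P-two δ {v₀} e≢f ge gf de only)) P₀≡false))) (⇒is refl)

          nz₀ : ∀ i → support i ≡ true → g v₀ i ≡ true → nz i ≡ true
          nz₀ i si gi with only i si gi
          ... | inj₁ refl = cong₂ _xor_ (⇒is {δ} {i} refl) ¬neg-e
          ... | inj₂ refl = cong₂ _xor_ pos-f ¬neg-f

          U : Fin n → Bool
          U w = (w == v₀) xor xsum (λ v → P δ v ∧ (w == v)) vs

          -- The cycle has an odd number of nodes: `P₀≡false` together with the handshake makes the
          -- number of those in `vs` even, and `v₀` adds one. Each single node is odd.
          U-odd : par (U ∘ φ) ≡ true
          U-odd = trans (parity-xor s t F (star v₀) (λ w → xsum (λ v → P δ v ∧ star v w) vs))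
            (cong₂ _xor_ (All.head odds) (trans (parity-xsum (P δ) star vs)
              (trans (xsum-cong (All.map (λ {v} h → trans (cong (P δ v ∧_) h) (BP.∧-identityʳ (P δ v)))
                (All.tail odds)))
                (trans (sym (xor≡false⇒ (P-total δ de))) P₀≡false))))

          -- The two stars containing a support edge both belong to nodes of `U` if `d` is ±δ on
          -- that edge, and neither does otherwise.
          U-uncrossed : ∀ i → support i ≡ true → cross s t (U ∘ φ) i ≡ false
          U-uncrossed i si = trans (cross-xor s t (star v₀) (λ w → xsum (λ v → P δ v ∧ star v w) vs) i)
            (trans (cong₂ _xor_ (first (g v₀ i) refl)
              (trans (cross-xsum (P δ) star vs i)
                (xsum-cong (All.map (λ {v} u → rest v (proj₂ u) (g v i) refl) uniforms))))
              (trans (xsum-∧ (nz i) (λ v → g v i) (v₀ ∷ vs))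
                (trans (cong (nz i ∧_) (odd-two i si)) (BP.∧-zeroʳ (nz i)))))
            where
            first : ∀ b → g v₀ i ≡ b → g v₀ i ≡ nz i ∧ g v₀ i
            first true h  = trans h (sym (cong₂ _∧_ (nz₀ i si h) h))
            first false h = trans h (sym (trans (cong (nz i ∧_) h) (BP.∧-zeroʳ (nz i))))
            rest : ∀ v → (∀ j → support j ≡ true → g v j ≡ true → P δ v ≡ nz j) → ∀ b → g v i ≡ b → P δ v ∧
              g v i ≡ nz i ∧ g v i
            rest v u true h  = cong (_∧ g v i) (u i si h)
            rest v u false h = trans (cong (P δ v ∧_) h)
              (trans (BP.∧-zeroʳ (P δ v)) (sym (trans (cong (nz i ∧_) h) (BP.∧-zeroʳ (nz i)))))

        no-odd-cycle : ⊥
        no-odd-cycle = <⇒≱ 0<1 (subst (1ℚ ≤_) (∑-zero flat) (cutOK U U-odd))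
          where
          flat : ∀ i → ⟦ cross s t (U ∘ φ) i ⟧ * z i ≡ 0ℚ
          flat i = help (support i) refl
            where
            help : ∀ b → support i ≡ b → ⟦ cross s t (U ∘ φ) i ⟧ * z i ≡ 0ℚ
            help true h  = trans (cong (λ b → ⟦ b ⟧ * z i) (U-uncrossed i h)) (ℚP.*-zeroˡ (z i))
            help false h = trans (cong (⟦ cross s t (U ∘ φ) i ⟧ *_) (off-support i h))
              (ℚP.*-zeroʳ ⟦ cross s t (U ∘ φ) i ⟧)

      -- The kernel vector obtained without the row of `v₀` is already a circulation if its values
      -- on the two edges at `v₀` cancel. Otherwise one of these values is nonzero, and following
      -- the cycle from that edge gives the contradiction.
      untangle : ∀ {R} → All (λ v → par (star v) ≡ true) R → TwoRegular support (map g R) → Circulation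
        support (map g R)
      untangle {[]} odds (_ , _ , () , _)
      untangle {v₀ ∷ vs} odds (_ , _ , refl , (d , supp , nz , zs) , two ,
        ((e , f , ne , (se , ge) , (sf , gf) , only) ∷ exact))
        = decide (d e + d f ℚP.≟ 0ℚ)
        where
        swap : ∀ {i} → i ≡ e ⊎ i ≡ f → i ≡ f ⊎ i ≡ e
        swap (inj₁ r) = inj₂ r
        swap (inj₂ r) = inj₁ r
        decide : Dec (d e + d f ≡ 0ℚ) → Circulation support (map g (v₀ ∷ vs))
        decide (yes z₀) = d , supp , nz , trans (rowSum-two {Φ = support} supp ne ge gf only) z₀ ∷ zs
        decide (no nz′) with d e ℚP.≟ 0ℚ
        ... | no de = ⊥-elim (no-odd-cycle v₀ vs odds d supp (AllP.map⁻ zs) two (AllP.map⁻ exact) e f ne ge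
          gf only de nz′)
        ... | yes de = ⊥-elim (no-odd-cycle v₀ vs odds d supp (AllP.map⁻ zs) two (AllP.map⁻ exact) f e
          (ne ∘ sym) gf ge
          (λ i a b → swap (only i a b))
          (λ df → nz′ (trans (cong₂ _+_ de df) (ℚP.+-identityʳ 0ℚ)))
            (λ k → nz′ (trans (ℚP.+-comm (d e) (d f)) k)))

-- The dominant of the T-join polytope, by induction on contractions

module TJoins where

  module _ {n M : ℕ} (s t : Fin M → Fin n) (F : Fin M → ℕ) where

    private
      par = parity s t F

    Claim : (Fin n → Fin n) → Set
    Claim φ = ∀ z → Dominates s t F φ z → Cone (IsJoin s t F φ) 1ℚ z

    -- The number of nodes of the contracted graph, which drops in both kinds of contraction.
    activity : (Fin n → Fin n) → ℕ
    activity φ = size (λ v → φ v == v)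

    module _ (φ : Fin n → Fin n) (idem : Idempotent s t F φ)
      (ih : ∀ φ′ → Idempotent s t F φ′ → activity φ′ ℕ.< activity φ → Claim φ′) where

      open Step s t F φ idem

      private
        inactive-image : ∀ {v} → φ v ≡ v → active v ≡ true
        inactive-image {v} h = trans (cong (_== v) h) (==-refl v)

        active-image : ∀ v → active (φ v) ≡ true
        active-image v = inactive-image (idem v)

      Tight : Vec M → (Fin n → Bool) → Set
      Tight z U = par (U ∘ φ) ≡ true × cutval s t z (U ∘ φ) ≡ 1ℚ

      private
        within : (Fin n → Bool) → Fin n → Bool
        within U v = active v ∧ U v

      -- A splitting set has at least two contracted nodes on either side, so shrinking either side
      -- makes the graph smaller. A tight set that does not split is, up to complement, a single
      -- contracted node.
      Splitting Trivial : (Fin n → Bool) → Set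
      Splitting U = Distinct (within U) × Distinct (within (not ∘ U))
      Trivial U = AtMostOne (within U) ⊎ AtMostOne (within (not ∘ U))

      contract-activity : ∀ W (saturated : ∀ v → W (φ v) ≡ W v) {u u′} → u ≢ u′ → active u ∧ W u ≡ true →
        active u′ ∧ W u′ ≡ true →
        activity (contract s t F φ idem W saturated u) ℕ.< activity φ
      contract-activity W saturated {u} {u′} ne h h′ = size-< u′ sub (proj₁ (∧-true {active u′} h′)) drop
        where
        sub : ∀ v → (contract s t F φ idem W saturated u v == v) ≡ true → active v ≡ true
        sub v k with W v
        ... | true rewrite ==⇒≡ {i = u} {v} k = proj₁ (∧-true {active v} h)
        ... | false = k
        drop : (contract s t F φ idem W saturated u u′ == u′) ≡ false
        drop rewrite proj₂ (∧-true {active u′} h′) = ==-≢ ne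

      split-case : ∀ z → Dominates s t F φ z → ∀ U → Tight z U → Splitting U → Cone (IsJoin s t F φ) 1ℚ z
      split-case z dom U (o , tight) ((u , u′ , ne , hu , hu′) , (w , w′ , ne′ , hw , hw′)) =
        glue-joins s t F φ idem W saturated wu (not-true ww) o tight
          (ih (contract s t F φ idem W saturated u) (contract-idem s t F φ idem W saturated wu)
            (contract-activity W saturated ne (lift U hu) (lift U hu′)) z
            (dominates-coarser s t F (contract-absorbs s t F φ idem W saturated u) dom))
          (ih (contract s t F φ idem nW nsaturated w) (contract-idem s t F φ idem nW nsaturated ww)
            (contract-activity nW nsaturated ne′ (lift (not ∘ U) hw) (lift (not ∘ U) hw′)) z
            (dominates-coarser s t F (contract-absorbs s t F φ idem nW nsaturated w) dom))
        where
        W nW : Fin n → Bool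
        W = U ∘ φ
        nW = not ∘ W
        saturated : ∀ v → W (φ v) ≡ W v
        saturated v = cong U (idem v)
        nsaturated : ∀ v → nW (φ v) ≡ nW v
        nsaturated v = cong not (saturated v)
        lift : ∀ (X : Fin n → Bool) {v} → active v ∧ X v ≡ true → active v ∧ X (φ v) ≡ true
        lift X {v} h with ∧-true {active v} h
        ... | a , x = cong₂ _∧_ a (trans (cong X (==⇒≡ a)) x)
        wu : W u ≡ true
        wu = proj₂ (∧-true {active u} (lift U hu))
        ww : nW w ≡ true
        ww = proj₂ (∧-true {active w} (lift (not ∘ U) hw))
        not-true : ∀ {b} → not b ≡ true → b ≡ false
        not-true {false} _ = refl

      merge-activity : ∀ e → φ (s e) ≢ φ (t e) → activity (merge s t F φ idem e) ℕ.< activity φ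
      merge-activity e ne = size-< (φ (s e)) sub (active-image (s e)) drop
        where
        sub : ∀ v → (merge s t F φ idem e v == v) ≡ true → active v ≡ true
        sub v k with φ v == φ (s e)
        ... | true rewrite sym (==⇒≡ {i = φ (t e)} {v} k) = active-image (t e)
        ... | false = k
        drop : (merge s t F φ idem e (φ (s e)) == φ (s e)) ≡ false
        drop rewrite idem (s e) | ==-refl (φ (s e)) = ==-≢ (ne ∘ sym)

      heavy-case : ∀ z → Dominates s t F φ z → ∀ e → φ (s e) ≢ φ (t e) → 1ℚ ≤ z e → Cone (IsJoin s t F φ) 1ℚ z
      heavy-case z dom e ne big = uncontract s t F φ idem e ne big
        (ih (merge s t F φ idem e) (merge-idem s t F φ idem e ne) (merge-activity e ne) z
          (dominates-coarser s t F (merge-absorbs s t F φ idem e) dom))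

      nonneg-con : Fin M → Constraint M
      nonneg-con e = unit e , 0ℚ

      cut-con : (Fin n → Bool) → Constraint M
      cut-con U = indicator (cross s t (U ∘ φ)) , 1ℚ

      oddSets : List (Fin n → Bool)
      oddSets = filter (λ U → par (U ∘ φ) B.≟ true) (subsets n)

      constraints : List (Constraint M)
      constraints = map nonneg-con (allFin M) ++ map cut-con oddSets

      all-oddSets : {P : (Fin n → Bool) → Set} → (∀ U → par (U ∘ φ) ≡ true → P U) → All P oddSets
      all-oddSets h = All.tabulate (λ {U} m → h U
        (proj₂ (MP.∈-filter⁻ (λ U → par (U ∘ φ) B.≟ true) {xs = subsets n} m)))

      dominates⇒feasible : ∀ {z} → Dominates s t F φ z → Feasible constraints z
      dominates⇒feasible {z} (pos , cut) = AllP.++⁺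
        (AllP.map⁺ (All.tabulate (λ {e} _ → 0≤- (subst (0ℚ ≤_) (sym (dot-unit e z)) (pos e)))))
        (AllP.map⁺ (all-oddSets (λ U o → 0≤- (cut U o))))

      feasible⇒dominates : ∀ {z} → Feasible constraints z → Dominates s t F φ z
      feasible⇒dominates {z} f = pos , cut
        where
        pos : ∀ e → 0ℚ ≤ z e
        pos e = subst (0ℚ ≤_) (dot-unit e z)
          (0≤-⁻ (All.lookup (AllP.map⁻ (AllP.++⁻ˡ (map nonneg-con (allFin M)) f)) (MP.∈-allFin e)))
        cut : ∀ U → par (U ∘ φ) ≡ true → 1ℚ ≤ cutval s t z (U ∘ φ)
        cut U o with subsets-complete U
        ... | U′ , m , eq = subst (1ℚ ≤_) (cutval-cong s t {z} (λ v → eq (φ v)))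
          (0≤-⁻ (All.lookup (AllP.map⁻ (AllP.++⁻ʳ (map nonneg-con (allFin M)) f))
            (MP.∈-filter⁺ (λ U → par (U ∘ φ) B.≟ true) m (trans (parity-cong s t {F} (λ v → eq (φ v))) o))))

      check : ∀ z U → (Tight z U × Splitting U) ⊎ (Tight z U → Trivial U)
      check z U with par (U ∘ φ) B.≟ true
      ... | no o = inj₂ (λ h → ⊥-elim (o (proj₁ h)))
      ... | yes o with cutval s t z (U ∘ φ) ℚP.≟ 1ℚ
      ... | no v = inj₂ (λ h → ⊥-elim (v (proj₂ h)))
      ... | yes v with classify (within U) | classify (within (not ∘ U))
      ... | inj₁ a | inj₁ b = inj₁ ((o , v) , (a , b))
      ... | inj₂ a | _      = inj₂ (λ _ → inj₁ a)
      ... | inj₁ _ | inj₂ b = inj₂ (λ _ → inj₂ b)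

      search : {A : Set} {P Q : A → Set} → (∀ a → P a ⊎ Q a) → (L : List A) → ∃ P ⊎ All Q L
      search f [] = inj₂ []
      search f (a ∷ L) with f a | search f L
      ... | inj₁ p | _      = inj₁ (a , p)
      ... | inj₂ _ | inj₁ r = inj₁ r
      ... | inj₂ q | inj₂ r = inj₂ (q ∷ r)

      module _ (z : Vec M) (dom : Dominates s t F φ z) (light : ∀ e → φ (s e) ≢ φ (t e) → z e < 1ℚ) where

        private
          supp = support z dom
          z≥0 = proj₁ dom
          g : Fin n → Row M
          g v = cross s t (star v)

        tightNode : Fin n → Bool
        tightNode v = active v ∧ (par (star v) ∧ does (cutval s t z (star v) ℚP.≟ 1ℚ))

        nodes : List (Fin n)
        nodes = filter (λ v → tightNode v B.≟ true) (allFin n)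

        tight⁺ : ∀ {v} → active v ≡ true → par (star v) ≡ true → cutval s t z (star v) ≡ 1ℚ → tightNode v ≡
          true
        tight⁺ {v} a o c with cutval s t z (star v) ℚP.≟ 1ℚ
        ... | yes _ = cong₂ _∧_ a (cong (_∧ true) o)
        ... | no h  = ⊥-elim (h c)

        tight⁻ : ∀ {v} → tightNode v ≡ true → par (star v) ≡ true × cutval s t z (star v) ≡ 1ℚ
        tight⁻ {v} h with ∧-true {active v} h
        ... | _ , h′ with ∧-true {par (star v)} h′
        ... | o , c with cutval s t z (star v) ℚP.≟ 1ℚ
        ... | yes p = o , p

        tightNodes : All (λ v → par (star v) ≡ true × cutval s t z (star v) ≡ 1ℚ) nodes
        tightNodes = All.map (λ {v} → tight⁻ {v}) (AllP.all-filter (λ v → tightNode v B.≟ true) (allFin n))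

        crossing⇒nonloop : ∀ {v e} → g v e ≡ true → φ (s e) ≢ φ (t e)
        crossing⇒nonloop {v} {e} h eq = true≢false h
          (trans (cong (λ w → (w == v) xor (φ (t e) == v)) eq) (BP.xor-same (φ (t e) == v)))

        -- With only one support edge the value one of the star would rest on that edge, which
        -- `light` excludes. This gives the minimum degree two needed for a direction.
        two-edges : ∀ {v} → cutval s t z (star v) ≡ 1ℚ → AtLeastTwo supp (g v)
        two-edges {v} tight = decide (classify (λ e → supp e ∧ g v e))
          where
          outside-zero : ∀ e → supp e ∧ g v e ≡ false → ⟦ g v e ⟧ * z e ≡ 0ℚ
          outside-zero e h with supp e in eq | g v e
          ... | true  | false = ℚP.*-zeroˡ (z e)
          ... | false | b = trans (cong (⟦ b ⟧ *_) (off-support z dom e eq)) (ℚP.*-zeroʳ ⟦ b ⟧)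
          decide : Distinct (λ e → supp e ∧ g v e) ⊎ AtMostOne (λ e → supp e ∧ g v e) → AtLeastTwo supp (g v)
          decide (inj₁ (e , f , ne , he , hf)) = e , f , ne , ∧-true {supp e} he , ∧-true {supp f} hf
          decide (inj₂ (inj₂ none)) = ⊥-elim
            (1≢0 (trans (sym tight) (∑-zero (λ e → outside-zero e (none e)))))
          decide (inj₂ (inj₁ (e , he , only))) = ⊥-elim
            (ℚP.<-irrefl (trans (sym value) tight)
              (light e (crossing⇒nonloop {v} {e} (proj₂ (∧-true {supp e} he)))))
            where
            value : cutval s t z (star v) ≡ z e
            value = trans (∑-cong pt) (∑-single e z)
              where
              pt : ∀ i → ⟦ g v i ⟧ * z i ≡ ⟦ i == e ⟧ * z i
              pt i with i F.≟ e
              ... | yes refl = cong (λ b → ⟦ b ⟧ * z i) (proj₂ (∧-true {supp i} he))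
              ... | no ne = trans (outside-zero i (≢true (λ h → ne (only i h)))) (sym (ℚP.*-zeroˡ (z i)))

        incidence≤2 : ∀ e → incidence (map g nodes) e ℕ.≤ 2
        incidence≤2 e = ℕP.≤-trans (incidence-filter (λ v → tightNode v B.≟ true) g (allFin n) e)
          (subst₂ ℕ._≤_ (sym (incidence-tabulate g (λ v → v) e)) total (∑ℕ-mono pt))
          where
          a = φ (s e)
          b = φ (t e)
          xor≤ : ∀ x y → ⟦ x xor y ⟧ℕ ℕ.≤ ⟦ x ⟧ℕ ℕ.* 1 ℕ.+ ⟦ y ⟧ℕ ℕ.* 1
          xor≤ true  true  = ℕ.z≤n
          xor≤ true  false = ℕP.≤-refl
          xor≤ false true  = ℕP.≤-refl
          xor≤ false false = ℕP.≤-refl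
          pt : ∀ v → ⟦ g v e ⟧ℕ ℕ.≤ ⟦ v == a ⟧ℕ ℕ.* 1 ℕ.+ ⟦ v == b ⟧ℕ ℕ.* 1
          pt v rewrite ==-sym v a | ==-sym v b = xor≤ (a == v) (b == v)
          total : ∑ℕ (λ v → ⟦ v == a ⟧ℕ ℕ.* 1 ℕ.+ ⟦ v == b ⟧ℕ ℕ.* 1) ≡ 2
          total = trans (∑ℕ-+ (λ v → ⟦ v == a ⟧ℕ ℕ.* 1) (λ v → ⟦ v == b ⟧ℕ ℕ.* 1))
            (cong₂ ℕ._+_ (∑ℕ-single a (λ _ → 1)) (∑ℕ-single b (λ _ → 1)))

        direction : ∃[ e ] supp e ≡ true → Circulation supp (map g nodes)
        direction ne = pick (circulation supp (map g nodes) ne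
          (AllP.map⁺ (All.map (λ {v} h → two-edges {v} (proj₂ h)) tightNodes)) (λ e _ → incidence≤2 e))
          where
          pick : Circulation supp (map g nodes) ⊎ TwoRegular supp (map g nodes) → Circulation supp
            (map g nodes)
          pick (inj₁ c) = c
          pick (inj₂ r) = untangle z dom {nodes} (All.map proj₁ tightNodes) r

        single⇒star : ∀ U {v} → within U v ≡ true → (∀ w → within U w ≡ true → w ≡ v) → ∀ w → U (φ w) ≡ star
          v w
        single⇒star U {v} hv only w with φ w F.≟ v
        ... | yes refl = proj₂ (∧-true {active (φ w)} hv)
        ... | no ne = ≢true (λ h → ne (only (φ w) (cong₂ _∧_ (active-image w) h)))

        none⇒even : ∀ U → (∀ w → within U w ≡ false) → par (U ∘ φ) ≡ false
        none⇒even U none = trans (parity-cong s t {F}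
          (λ w → ≢true (λ h → true≢false (cong₂ _∧_ (active-image w) h) (none (φ w)))))
            (parity-const s t F false)

        -- An odd cut cannot have an empty side, so the set is the fibre of one contracted node.
        -- That node is tight, and the sum of `d` around it is among those known to vanish.
        star-value : ∀ {d} → All (λ v → rowSum (g v) d ≡ 0ℚ) nodes → ∀ U → AtMostOne (within U) → Tight z U
          → cutval s t d (U ∘ φ) ≡ 0ℚ
        star-value zs U (inj₂ none) (o , _) = ⊥-elim (true≢false o (none⇒even U none))
        star-value {d} zs U (inj₁ (v , hv , only)) (o , c) = trans (cutval-cong s t {d} eq)
          (All.lookup zs (MP.∈-filter⁺ (λ v → tightNode v B.≟ true) (MP.∈-allFin v)
            (tight⁺ (proj₁ (∧-true {active v} hv)) (trans (sym (parity-cong s t {F} eq)) o)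
              (trans (sym (cutval-cong s t {z} eq)) c))))
          where
          eq = single⇒star U hv only

        cutval-not : ∀ x (U : Fin n → Bool) → cutval s t x (not ∘ U) ≡ cutval s t x U
        cutval-not x U = ∑-cong (λ e → cong (λ b → ⟦ b ⟧ * x e) (cross-not s t U e))

        parity-not : ∀ (U : Fin n → Bool) → par (not ∘ U) ≡ par U
        parity-not U = ⨁-cong (λ e → cong (odd (F e) ∧_) (cross-not s t U e))

        trivial-value : ∀ {d} → All (λ v → rowSum (g v) d ≡ 0ℚ) nodes → ∀ U → Trivial U → Tight z U → cutval
          s t d (U ∘ φ) ≡ 0ℚ
        trivial-value zs U (inj₁ a) h = star-value zs U a h
        trivial-value {d} zs U (inj₂ b) (o , c) = trans (sym (cutval-not d (U ∘ φ)))
          (star-value zs (not ∘ U) b (trans (parity-not (U ∘ φ)) o , trans (cutval-not z (U ∘ φ)) c))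

        -- If the support is empty, every cut has value zero, so no cut is odd and the empty join
        -- will do. Otherwise all tight cuts are stars and a circulation keeps them tight.
        light-case : All (λ U → Tight z U → Trivial U) oddSets →
          Cone (IsJoin s t F φ) 1ℚ z ⊎ (∃[ d ] (∃[ e ] d e ≢ 0ℚ) × Admissible constraints z d)
        light-case trivial with FP.any? (λ e → supp e B.≟ true)
        ... | yes ne = inj₂ (finish (direction ne))
          where
          finish : Circulation supp (map g nodes) → ∃[ d ] (∃[ e ] d e ≢ 0ℚ) × Admissible constraints z d
          finish (d , sp , nz , zs) = d , nz , AllP.++⁺
            (AllP.map⁺ (All.tabulate (λ {e} _ h → trans (dot-unit e d)
              (sp e (on-support z dom e (trans (sym (dot-unit e z)) (-≡0⇒≡ h)))))))
            (AllP.map⁺ (All.zipWith (λ { {U} (o , tr) h → trivial-value (AllP.map⁻ zs) U (tr (o , -≡0⇒≡ h))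
              (o , -≡0⇒≡ h) })
              (all-oddSets (λ U o → o) , trivial)))
        ... | no none = inj₁ (cone-point (λ _ → 0) join (λ e → z≥0 e))
          where
          zero-z : ∀ e → z e ≡ 0ℚ
          zero-z e = off-support z dom e (≢true (λ h → none (e , h)))
          join : IsJoin s t F φ (λ _ → 0)
          join U = trans (⨁-zero (λ _ → refl)) (sym (≢true (λ o → <⇒≱ 0<1
            (subst (1ℚ ≤_) (∑-zero (λ e → trans (cong (⟦ cross s t (U ∘ φ) e ⟧ *_) (zero-z e))
              (ℚP.*-zeroʳ ⟦ cross s t (U ∘ φ) e ⟧))) (proj₂ dom U o)))))

      -- Tight cuts with several nodes on both sides and edges of weight at least one are removed by
      -- contraction. Without them the tight constraints are stars of degree at least two, where a
      -- circulation can be found.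
      step : ∀ z → Feasible constraints z → Cone (IsJoin s t F φ) 1ℚ z ⊎
        (∃[ d ] (∃[ e ] d e ≢ 0ℚ) × Admissible constraints z d)
      step z f = decide (search (check z) oddSets)
        (FP.any? (λ e → ¬? (φ (s e) F.≟ φ (t e)) ×-dec (1ℚ ℚP.≤? z e)))
        where
        dom = feasible⇒dominates f
        decide : ∃ (λ U → Tight z U × Splitting U) ⊎ All (λ U → Tight z U → Trivial U) oddSets →
          Dec (∃[ e ] φ (s e) ≢ φ (t e) × 1ℚ ≤ z e) →
          Cone (IsJoin s t F φ) 1ℚ z ⊎ (∃[ d ] (∃[ e ] d e ≢ 0ℚ) × Admissible constraints z d)
        decide (inj₁ (U , tight , split)) _ = inj₁ (split-case z dom U tight split)
        decide (inj₂ _) (yes (e , ne , big)) = inj₁ (heavy-case z dom e ne big)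
        decide (inj₂ trivial) (no light) = light-case z dom (λ e ne → ℚP.≰⇒> (λ h → light (e , ne , h)))
          trivial

      claim : Claim φ
      claim z dom = polyhedral-induction constraints (λ e → MP.∈-++⁺ˡ (MP.∈-map⁺ nonneg-con (MP.∈-allFin e)))
        (IsJoin s t F φ) step z (dominates⇒feasible dom)

    -- The dominant of the T-join polytope is described by the T-cut inequalities (Edmonds and Johnson).
    joins-dominated : ∀ {z} → (∀ e → 0ℚ ≤ z e) → (∀ U → par U ≡ true → 1ℚ ≤ cutval s t z U) →
      Cone (λ J → ∀ U → parity s t J U ≡ par U) 1ℚ z
    joins-dominated {z} pos cut = go (suc (activity (λ v → v))) (λ v → v) (λ _ → refl) ℕP.≤-refl z (pos , cut)
      where
      go : ∀ k φ → Idempotent s t F φ → activity φ ℕ.< k → Claim φ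
      go (suc k) φ idem (ℕ.s≤s b) = claim φ idem (λ φ′ idem′ lt → go k φ′ idem′ (ℕP.<-≤-trans lt b))

open TJoins using (joins-dominated)

-- Integral rationals, sums over lists and modularity of mass

data IsInt (q : ℚ) : Set where
  int : ∀ a b → q + toℚ b ≡ toℚ a → IsInt q

int-ℕ : ∀ k → IsInt (toℚ k)
int-ℕ k = int k 0 (ℚP.+-identityʳ (toℚ k))

int-+ : ∀ {p q} → IsInt p → IsInt q → IsInt (p + q)
int-+ {p} {q} (int a b h) (int c d k) = int (a ℕ.+ c) (b ℕ.+ d)
  (trans (cong (p + q +_) (toℚ-+ b d))
    (trans (lem p q (toℚ b) (toℚ d)) (trans (cong₂ _+_ h k) (sym (toℚ-+ a c)))))
  where
  lem : ∀ p q b d → p + q + (b + d) ≡ (p + b) + (q + d)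
  lem = solve-∀ ℚ-ring

int-neg : ∀ {p} → IsInt p → IsInt (- p)
int-neg {p} (int a b h) = int b a (trans (cong (- p +_) (sym h)) (lem p (toℚ b)))
  where
  lem : ∀ p b → - p + (p + b) ≡ b
  lem = solve-∀ ℚ-ring

int-- : ∀ {p q} → IsInt p → IsInt q → IsInt (p - q)
int-- h k = int-+ h (int-neg k)

opaque
  unfolding ∑
  int-∑ : ∀ {n} {f : Fin n → ℚ} → (∀ i → IsInt (f i)) → IsInt (∑ f)
  int-∑ {zero}  h = int-ℕ 0
  int-∑ {suc n} h = int-+ (h zero) (int-∑ (h ∘ suc))

no-int-between : ∀ {q} → 0ℚ < q → q < 1ℚ → IsInt q → ⊥
no-int-between {q} pos small (int a b h) = <⇒≱ small (≤-by (0≤- (toℚ-mono b<a)) eq)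
  where
  b<a : suc b ℕ.≤ a
  b<a with a ℕP.≤? b
  ... | no p  = ℕP.≰⇒> p
  ... | yes p = ⊥-elim (<⇒≱ (<-by pos (ℚP.+-comm q (toℚ b))) (subst (_≤ toℚ b) (sym h) (toℚ-mono p)))
  lem : ∀ q b → q ≡ 1ℚ + (q + b - (1ℚ + b))
  lem = solve-∀ ℚ-ring
  eq : q ≡ 1ℚ + (toℚ a - toℚ (suc b))
  eq = trans (lem q (toℚ b)) (cong (1ℚ +_) (cong₂ _-_ h (sym (toℚ-+ 1 b))))

lsum : {A : Set} → (A → ℚ) → List A → ℚ
lsum f []      = 0ℚ
lsum f (a ∷ L) = f a + lsum f L

lsum-zero : {A : Set} {f : A → ℚ} {L : List A} → All (λ a → f a ≡ 0ℚ) L → lsum f L ≡ 0ℚ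
lsum-zero []       = refl
lsum-zero (p ∷ ps) = trans (cong₂ _+_ p (lsum-zero ps)) (ℚP.+-identityʳ 0ℚ)

lsum-cong : {A : Set} {f g : A → ℚ} (L : List A) → (∀ a → f a ≡ g a) → lsum f L ≡ lsum g L
lsum-cong []      h = refl
lsum-cong (a ∷ L) h = cong₂ _+_ (h a) (lsum-cong L h)

lsum-++ : {A : Set} (f : A → ℚ) (L K : List A) → lsum f (L ++ K) ≡ lsum f L + lsum f K
lsum-++ f []      K = sym (ℚP.+-identityˡ (lsum f K))
lsum-++ f (a ∷ L) K = trans (cong (f a +_) (lsum-++ f L K)) (sym (ℚP.+-assoc (f a) (lsum f L) (lsum f K)))

opaque
  unfolding ∑
  lsum-tabulate : ∀ {k} {A : Set} (f : A → ℚ) (h : Fin k → A) → lsum f (tabulate h) ≡ ∑ (f ∘ h)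
  lsum-tabulate {zero}  f h = refl
  lsum-tabulate {suc k} f h = cong (f (h zero) +_) (lsum-tabulate f (h ∘ suc))

∑-lsum : ∀ {n} {A : Set} (f : A → Fin n → ℚ) (L : List A) → ∑ (λ i → lsum (λ a → f a i) L) ≡ lsum
  (λ a → ∑ (f a)) L
∑-lsum f []      = ∑-zero (λ _ → refl)
∑-lsum f (a ∷ L) = trans (∑-+ (f a) (λ i → lsum (λ a → f a i) L)) (cong (∑ (f a) +_) (∑-lsum f L))

lsum-incidence : ∀ {n} {A : Set} (g : A → Row n) (L : List A) i q →
  lsum (λ a → ⟦ g a i ⟧ * q) L ≡ toℚ (incidence (map g L) i) * q
lsum-incidence g []      i q = sym (ℚP.*-zeroˡ q)
lsum-incidence g (a ∷ L) i q = trans (cong₂ _+_ (cong (_* q) (sym (⟦⟧-toℚ (g a i)))) (lsum-incidence g L i q))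
  (trans (sym (ℚP.*-distribʳ-+ q (toℚ ⟦ g a i ⟧ℕ) (toℚ (incidence (map g L) i))))
    (cong (_* q) (sym (toℚ-+ ⟦ g a i ⟧ℕ (incidence (map g L) i)))))

lsum-rowSum : ∀ {n} {A : Set} (g : A → Row n) (L : List A) (d : Vec n) →
  lsum (λ a → rowSum (g a) d) L ≡ ∑ (λ i → toℚ (incidence (map g L) i) * d i)
lsum-rowSum g L d = trans (sym (∑-lsum (λ a i → ⟦ g a i ⟧ * d i) L))
  (∑-cong (λ i → lsum-incidence g L i (d i)))

incidence-++ : ∀ {n} (L K : List (Row n)) i → incidence (L ++ K) i ≡ incidence L i ℕ.+ incidence K i
incidence-++ []      K i = refl
incidence-++ (r ∷ L) K i = trans (cong (⟦ r i ⟧ℕ ℕ.+_) (incidence-++ L K i))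
  (sym (ℕP.+-assoc ⟦ r i ⟧ℕ (incidence L i) (incidence K i)))

_∪_ _∩_ : ∀ {n} → Row n → Row n → Row n
(S ∪ T) i = S i ∨ T i
(S ∩ T) i = S i ∧ T i

mass : ∀ {n} → Row n → Vec n → ℚ
mass S y = dot (indicator S) y

mass-cong : ∀ {n} {S T : Row n} {y} → (∀ i → S i ≡ T i) → mass S y ≡ mass T y
mass-cong {y = y} h = ∑-cong (λ i → cong (λ b → ⟦ b ⟧ * y i) (h i))

mass-modular : ∀ {n} (S T : Row n) y → mass (S ∪ T) y + mass (S ∩ T) y ≡ mass S y + mass T y
mass-modular S T y = trans (sym (∑-+ (λ i → ⟦ S i ∨ T i ⟧ * y i) (λ i → ⟦ S i ∧ T i ⟧ * y i)))
  (trans (∑-cong pt) (∑-+ (λ i → ⟦ S i ⟧ * y i) (λ i → ⟦ T i ⟧ * y i)))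
  where
  pt : ∀ i → ⟦ S i ∨ T i ⟧ * y i + ⟦ S i ∧ T i ⟧ * y i ≡ ⟦ S i ⟧ * y i + ⟦ T i ⟧ * y i
  pt i with S i | T i
  ... | true  | true  = refl
  ... | true  | false = refl
  ... | false | true  = ℚP.+-comm (1ℚ * y i) (0ℚ * y i)
  ... | false | false = refl

pairRow : ∀ {n} → Fin n × Fin n → Row n
pairRow (a , b) i = (i == a) ∨ (i == b)

pairRow-sum : ∀ {n} {a b : Fin n} → a ≢ b → ∀ y → rowSum (pairRow (a , b)) y ≡ y a + y b
pairRow-sum {a = a} {b} ne y = trans (∑-two a b ne others) (cong₂ _+_ at-a at-b)
  where
  others : ∀ i → i ≢ a → i ≢ b → ⟦ (i == a) ∨ (i == b) ⟧ * y i ≡ 0ℚ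
  others i p q rewrite ==-≢ p | ==-≢ q = ℚP.*-zeroˡ (y i)
  at-a : ⟦ (a == a) ∨ (a == b) ⟧ * y a ≡ y a
  at-a rewrite ==-refl a = ℚP.*-identityˡ (y a)
  at-b : ⟦ (b == a) ∨ (b == b) ⟧ * y b ≡ y b
  at-b rewrite ==-refl b | BP.∨-zeroʳ (b == a) = ℚP.*-identityˡ (y b)

-- Intersection of a contrapolymatroid with a partition into pairs

module RainbowForests where

  module _ {M : ℕ} (g : Row M → ℚ) (g-cong : ∀ {S T} → (∀ i → S i ≡ T i) → g S ≡ g T)
    (g-int : ∀ S → IsInt (g S)) (supermodular : ∀ S T → g S + g T ≤ g (S ∪ T) + g (S ∩ T))
    (pairs : List (Fin M × Fin M)) (distinct : All (λ p → proj₁ p ≢ proj₂ p) pairs)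
    (disjoint : ∀ i → incidence (map pairRow pairs) i ℕ.≤ 1) where

    -- The bounds by a supermodular integral `g` describe a contrapolymatroid. When `g` is `demand`,
    -- its 0/1 points are connected spanning edge sets, and the pair equations ask for one edge of
    -- each pair.
    Bounded : Vec M → Set
    Bounded y = (∀ e → 0ℚ ≤ y e × y e ≤ 1ℚ) × (∀ S → g S ≤ mass S y) × All
      (λ p → y (proj₁ p) + y (proj₂ p) ≡ 1ℚ) pairs

    Rainbow : (Fin M → ℕ) → Set
    Rainbow F = (∀ S → g S ≤ mass S (λ e → toℚ (F e))) × All (λ p → F (proj₁ p) ℕ.+ F (proj₂ p) ≡ 1) pairs

    module _ (y : Vec M) (bounded : Bounded y) where

      private
        y≥0 : ∀ e → 0ℚ ≤ y e
        y≥0 e = proj₁ (proj₁ bounded e)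
        y≤1 : ∀ e → y e ≤ 1ℚ
        y≤1 e = proj₂ (proj₁ bounded e)
        above = proj₁ (proj₂ bounded)
        pairSums = proj₂ (proj₂ bounded)

      fractional : Row M
      fractional e = not (does (y e ℚP.≟ 0ℚ)) ∧ not (does (y e ℚP.≟ 1ℚ))

      integral : ∀ {e} → fractional e ≡ false → y e ≡ 0ℚ ⊎ y e ≡ 1ℚ
      integral {e} h with y e ℚP.≟ 0ℚ | y e ℚP.≟ 1ℚ
      ... | yes p | _     = inj₁ p
      ... | no _  | yes p = inj₂ p

      fractional⇒ : ∀ {e} → fractional e ≡ true → y e ≢ 0ℚ × y e ≢ 1ℚ
      fractional⇒ {e} h with y e ℚP.≟ 0ℚ | y e ℚP.≟ 1ℚ
      ... | no p | no q = p , q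

      ⇒fractional : ∀ {e} → y e ≢ 0ℚ → y e ≢ 1ℚ → fractional e ≡ true
      ⇒fractional {e} p q with fractional e in eq
      ... | true = refl
      ... | false with integral eq
      ... | inj₁ z = ⊥-elim (p z)
      ... | inj₂ o = ⊥-elim (q o)

      int-value : ∀ {e} → fractional e ≡ false → IsInt (y e)
      int-value h with integral h
      ... | inj₁ z = subst IsInt (sym z) (int-ℕ 0)
      ... | inj₂ o = subst IsInt (sym o) (int-ℕ 1)

      Tight : Row M → Set
      Tight S = mass S y ≡ g S

      tight? : ∀ S → Dec (Tight S)
      tight? S = mass S y ℚP.≟ g S

      tight-cong : ∀ {S T} → (∀ i → S i ≡ T i) → Tight S → Tight T
      tight-cong h k = trans (sym (mass-cong {y = y} h)) (trans k (g-cong h))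

      private
        squeeze : ∀ {a b c d} → a ≤ b → c ≤ d → b + d ≤ a + c → b ≡ a
        squeeze {a} {b} {c} {d} p q r = ℚP.≤-antisym
          (≤-by (0≤+ (0≤- r) (0≤- q)) (lem a b c d)) p
          where
          lem : ∀ a b c d → a ≡ b + (a + c - (b + d) + (d - c))
          lem = solve-∀ ℚ-ring

        uncross : ∀ {S T} → Tight S → Tight T → mass (S ∪ T) y + mass (S ∩ T) y ≤ g (S ∪ T) + g (S ∩ T)
        uncross {S} {T} p q = subst (_≤ g (S ∪ T) + g (S ∩ T))
          (sym (trans (mass-modular S T y) (cong₂ _+_ p q))) (supermodular S T)

      -- Uncrossing: mass is modular and `g` supermodular, so two tight sets leave no slack for the
      -- sum of the bounds on union and intersection, and hence for neither of them.
      tight-∪ : ∀ {S T} → Tight S → Tight T → Tight (S ∪ T)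
      tight-∪ {S} {T} p q = squeeze (above (S ∪ T)) (above (S ∩ T)) (uncross p q)

      tight-∩ : ∀ {S T} → Tight S → Tight T → Tight (S ∩ T)
      tight-∩ {S} {T} p q = squeeze (above (S ∩ T)) (above (S ∪ T))
        (subst₂ _≤_ (ℚP.+-comm (mass (S ∪ T) y) (mass (S ∩ T) y)) (ℚP.+-comm (g (S ∪ T)) (g (S ∩ T)))
          (uncross p q))

      same? : ∀ e f → Dec (All (λ S → Tight S → S e ≡ S f) (subsets M))
      same? e f = All.all? (λ S → tight? S →-dec (S e B.≟ S f)) (subsets M)

      same : Fin M → Row M
      same e f = does (same? e f)

      same⇒ : ∀ {e f} → same e f ≡ true → ∀ S → Tight S → S e ≡ S f
      same⇒ {e} {f} h S k with same? e f | subsets-complete S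
      ... | yes p | S′ , m , eq = trans (sym (eq e)) (trans (All.lookup p m (tight-cong (sym ∘ eq) k)) (eq f))

      ⇒same : ∀ {e f} → (∀ S → Tight S → S e ≡ S f) → same e f ≡ true
      ⇒same {e} {f} h with same? e f
      ... | yes _ = refl
      ... | no p  = ⊥-elim (p (All.tabulate (λ {S} _ → h S)))

      -- The tight sets containing e meet in D, those avoiding e have union N, and the class of e is D ∖ N.
      class-int : ∀ {e} S₀ → Tight S₀ → S₀ e ≡ true → IsInt (mass (same e) y)
      class-int {e} S₀ t₀ h₀ = subst IsInt (sym value) (int-- (tight-int (D-tight (subsets M))) intDN)
        where
        D N : List (Row M) → Row M
        D [] = S₀
        D (S ∷ L) with tight? S | S e
        ... | yes _ | true = D L ∩ S
        ... | _     | _    = D L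
        N [] _ = false
        N (S ∷ L) with tight? S | S e
        ... | yes _ | false = N L ∪ S
        ... | _     | _     = N L

        D-tight : ∀ L → Tight (D L)
        D-tight [] = t₀
        D-tight (S ∷ L) with tight? S | S e
        ... | yes p | true  = tight-∩ (D-tight L) p
        ... | yes _ | false = D-tight L
        ... | no _  | _     = D-tight L

        Empty : Row M → Set
        Empty S = ∀ i → S i ≡ false

        -- `N` may be an empty union, and the empty set need not be tight; hence the alternative.
        N-tight : ∀ L → Tight (N L) ⊎ Empty (N L)
        N-tight [] = inj₂ (λ _ → refl)
        N-tight (S ∷ L) with tight? S | S e
        ... | no _  | _     = N-tight L
        ... | yes _ | true  = N-tight L
        ... | yes p | false with N-tight L
        ... | inj₁ q = inj₁ (tight-∪ q p)
        ... | inj₂ q = inj₁ (tight-cong (λ i → cong (_∨ S i) (sym (q i))) p)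

        tight-int : ∀ {S} → Tight S → IsInt (mass S y)
        tight-int {S} k = subst IsInt (sym k) (g-int S)

        D* = D (subsets M)
        N* = N (subsets M)

        intDN : IsInt (mass (D* ∩ N*) y)
        intDN with N-tight (subsets M)
        ... | inj₁ p = tight-int (tight-∩ (D-tight (subsets M)) p)
        ... | inj₂ p = subst IsInt (sym
          (∑-zero (λ i → trans (cong (λ b → ⟦ b ⟧ * y i) (trans (cong (D* i ∧_) (p i)) (BP.∧-zeroʳ (D* i))))
            (ℚP.*-zeroˡ (y i))))) (int-ℕ 0)

        D-in : ∀ f → (∀ S → Tight S → S e ≡ S f) → ∀ L → D L f ≡ true
        D-in f h [] = trans (sym (h S₀ t₀)) h₀
        D-in f h (S ∷ L) with tight? S | S e in eq
        ... | yes p | true  = cong₂ _∧_ (D-in f h L) (trans (sym (h S p)) eq)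
        ... | yes _ | false = D-in f h L
        ... | no _  | _     = D-in f h L

        N-out : ∀ f → (∀ S → Tight S → S e ≡ S f) → ∀ L → N L f ≡ false
        N-out f h [] = refl
        N-out f h (S ∷ L) with tight? S | S e in eq
        ... | no _  | _     = N-out f h L
        ... | yes _ | true  = N-out f h L
        ... | yes p | false = cong₂ _∨_ (N-out f h L) (trans (sym (h S p)) eq)

        back : ∀ f L → D L f ≡ true → N L f ≡ false → All (λ S → Tight S → S e ≡ S f) L
        back f [] _ _ = []
        back f (S ∷ L) d n with tight? S | S e in eq
        ... | no p  | _     = (λ k → ⊥-elim (p k)) ∷ back f L d n
        ... | yes p | true  with ∧-true {D L f} d
        ... | d′ , sf = (λ _ → trans eq (sym sf)) ∷ back f L d′ n
        back f (S ∷ L) d n | yes p | false with ∨-false {N L f} n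
          where
          ∨-false : ∀ {a b} → a ∨ b ≡ false → a ≡ false × b ≡ false
          ∨-false {false} {false} _ = refl , refl
        ... | n′ , sf = (λ _ → trans eq (sym sf)) ∷ back f L d n′

        pointwise : ∀ f → same e f ≡ D* f ∧ not (N* f)
        pointwise f with same? e f
        ... | yes p = sym (cong₂ (λ a b → a ∧ not b) (D-in f h (subsets M)) (N-out f h (subsets M)))
          where
          h : ∀ S → Tight S → S e ≡ S f
          h S k with subsets-complete S
          ... | S′ , m , eq = trans (sym (eq e)) (trans (All.lookup p m (tight-cong (sym ∘ eq) k)) (eq f))
        ... | no p with D* f in eq | N* f in eq′
        ... | true  | false = ⊥-elim (p (back f (subsets M) eq eq′))
        ... | true  | true  = refl
        ... | false | _     = refl

        value : mass (same e) y ≡ mass D* y - mass (D* ∩ N*) y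
        value = trans (∑-cong pt) (trans (∑-+ (λ i → ⟦ D* i ⟧ * y i) (λ i → (- 1ℚ) * (⟦ (D* ∩ N*) i ⟧ * y i)))
          (cong (mass D* y +_) (trans (∑-* (- 1ℚ) (λ i → ⟦ (D* ∩ N*) i ⟧ * y i)) (neg (mass (D* ∩ N*) y)))))
          where
          neg : ∀ q → (- 1ℚ) * q ≡ - q
          neg = solve-∀ ℚ-ring
          lem₁ : ∀ q → 0ℚ * q ≡ 0ℚ * q + (- 1ℚ) * (0ℚ * q)
          lem₁ = solve-∀ ℚ-ring
          lem₃ : ∀ q → 1ℚ * q ≡ 1ℚ * q + (- 1ℚ) * (0ℚ * q)
          lem₃ = solve-∀ ℚ-ring
          lem₄ : ∀ q → 0ℚ * q ≡ 1ℚ * q + (- 1ℚ) * (1ℚ * q)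
          lem₄ = solve-∀ ℚ-ring
          pt : ∀ i → ⟦ same e i ⟧ * y i ≡ ⟦ D* i ⟧ * y i + (- 1ℚ) * (⟦ (D* ∩ N*) i ⟧ * y i)
          pt i = trans (cong (λ b → ⟦ b ⟧ * y i) (pointwise i)) (cases (D* i) (N* i))
            where
            cases : ∀ a b → ⟦ a ∧ not b ⟧ * y i ≡ ⟦ a ⟧ * y i + (- 1ℚ) * (⟦ a ∧ b ⟧ * y i)
            cases true  true  = lem₄ (y i)
            cases true  false = lem₃ (y i)
            cases false b     = lem₁ (y i)

      covered? : ∀ e → Dec (Any (λ S → Tight S × S e ≡ true) (subsets M))
      covered? e = Any.any? (λ S → tight? S ×-dec (S e B.≟ true)) (subsets M)

      same-refl : ∀ e → same e e ≡ true
      same-refl e = ⇒same (λ _ _ → refl)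

      -- The mass of the class is an integer and so are its non-fractional entries. A lone
      -- fractional entry would be an integer strictly between 0 and 1.
      class-two : ∀ {e} → fractional e ≡ true → Any (λ S → Tight S × S e ≡ true) (subsets M) → AtLeastTwo
        fractional (same e)
      class-two {e} fe cov = decide (classify (λ f → fractional f ∧ same e f))
        where
        S₀ = Any.satisfied cov
        decide : Distinct (λ f → fractional f ∧ same e f) ⊎ AtMostOne (λ f → fractional f ∧ same e f) →
          AtLeastTwo fractional (same e)
        decide (inj₁ (a , b , ne , ha , hb)) = a , b , ne , ∧-true {fractional a} ha , ∧-true {fractional b}
          hb
        decide (inj₂ (inj₂ none)) = ⊥-elim (true≢false (cong₂ _∧_ fe (same-refl e)) (none e))
        decide (inj₂ (inj₁ (v , hv , only))) = ⊥-elim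
          (no-int-between (≤∧≢⇒< (y≥0 e) (proj₁ (fractional⇒ fe) ∘ sym))
            (≤∧≢⇒< (y≤1 e) (proj₂ (fractional⇒ fe)))
            (subst IsInt (sym value) (int-- (class-int (proj₁ S₀) (proj₁ (proj₂ S₀)) (proj₂ (proj₂ S₀)))
              (int-∑ int-rest))))
          where
          only-e : ∀ f → fractional f ∧ same e f ≡ true → f ≡ e
          only-e f h = trans (only f h) (sym (only e (cong₂ _∧_ fe (same-refl e))))
          rest : Vec M
          rest f = ⟦ same e f ∧ not (f == e) ⟧ * y f
          int-rest : ∀ f → IsInt (rest f)
          int-rest f with same e f in eq | f F.≟ e | fractional f in eq′
          ... | false | _ | _ = subst IsInt (sym (ℚP.*-zeroˡ (y f))) (int-ℕ 0)
          ... | true | yes _ | _ = subst IsInt (sym (ℚP.*-zeroˡ (y f))) (int-ℕ 0)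
          ... | true | no _ | false = subst IsInt (sym (ℚP.*-identityˡ (y f))) (int-value eq′)
          ... | true | no ne | true = ⊥-elim (ne (only-e f (cong₂ _∧_ eq′ eq)))
          split : ∀ f → ⟦ same e f ⟧ * y f ≡ ⟦ f == e ⟧ * y f + rest f
          split f with f F.≟ e
          ... | yes refl rewrite same-refl f = lem (y f)
            where
            lem : ∀ q → 1ℚ * q ≡ 1ℚ * q + 0ℚ * q
            lem = solve-∀ ℚ-ring
          ... | no _ rewrite BP.∧-identityʳ (same e f) = lem (⟦ same e f ⟧ * y f) (y f)
            where
            lem : ∀ p q → p ≡ 0ℚ * q + p
            lem = solve-∀ ℚ-ring
          total : mass (same e) y ≡ y e + ∑ rest
          total = trans (∑-cong split) (trans (∑-+ (λ f → ⟦ f == e ⟧ * y f) rest)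
            (cong (_+ ∑ rest) (∑-single e y)))
          value : y e ≡ mass (same e) y - ∑ rest
          value = trans (lem (y e) (∑ rest)) (cong (_- ∑ rest) (sym total))
            where
            lem : ∀ p q → p ≡ p + q - q
            lem = solve-∀ ℚ-ring

      Eligible : Fin M → Set
      Eligible e = fractional e ≡ true × Any (λ S → Tight S × S e ≡ true) (subsets M)

      New : Fin M → List (Fin M) → Set
      New e R = Eligible e × ¬ Any (λ r → same r e ≡ true) R

      new? : ∀ e R → Dec (New e R)
      new? e R = ((fractional e B.≟ true) ×-dec covered? e) ×-dec ¬? (Any.any? (λ r → same r e B.≟ true) R)

      insert : ∀ e R → Dec (New e R) → List (Fin M)
      insert e R (yes _) = e ∷ R
      insert e R (no _)  = R

      -- A greedy choice of one representative for each class that contains a fractional element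
      -- covered by some tight set.
      reps : List (Fin M) → List (Fin M)
      reps []      = []
      reps (e ∷ L) = insert e (reps L) (new? e (reps L))

      reps-eligible : ∀ L → All Eligible (reps L)
      reps-eligible []      = []
      reps-eligible (e ∷ L) = extend (reps L) (new? e (reps L)) (reps-eligible L)
        where
        extend : ∀ R (d : Dec (New e R)) → All Eligible R → All Eligible (insert e R d)
        extend R (yes (p , _)) ps = p ∷ ps
        extend R (no _)        ps = ps

      none-incidence : ∀ R f → (∀ {r} → r ∈ R → same r f ≡ false) → incidence (map same R) f ≡ 0
      none-incidence []      f h = refl
      none-incidence (r ∷ R) f h = cong₂ (λ b k → ⟦ b ⟧ℕ ℕ.+ k) (h (here refl))
        (none-incidence R f (h ∘ there))

      reps-once : ∀ L f → incidence (map same (reps L)) f ℕ.≤ 1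
      reps-once []      f = ℕ.z≤n
      reps-once (e ∷ L) f = extend (reps L) (new? e (reps L)) (reps-once L f)
        where
        add : ∀ R b → same e f ≡ b → ¬ Any (λ r → same r e ≡ true) R → incidence (map same R) f ℕ.≤ 1 →
          ⟦ b ⟧ℕ ℕ.+ incidence (map same R) f ℕ.≤ 1
        add R false _ _ k = k
        add R true eq new _ = ℕP.≤-reflexive
          (cong suc (none-incidence R f (λ m → ≢true (λ h → new (Any.map (λ { refl →
          ⇒same (λ S k → trans (same⇒ h S k) (sym (same⇒ eq S k))) }) m)))))
        extend : ∀ R (d : Dec (New e R)) → incidence (map same R) f ℕ.≤ 1 → incidence
          (map same (insert e R d)) f ℕ.≤ 1
        extend R (no _)          k = k
        extend R (yes (_ , new)) k = add R (same e f) refl new k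

      some-incidence : ∀ R f → Any (λ r → same r f ≡ true) R → 1 ℕ.≤ incidence (map same R) f
      some-incidence (r ∷ R) f (here h)  = subst (λ b → 1 ℕ.≤ ⟦ b ⟧ℕ ℕ.+ incidence (map same R) f) (sym h)
        (ℕ.s≤s ℕ.z≤n)
      some-incidence (r ∷ R) f (there h) = ℕP.≤-trans (some-incidence R f h) (ℕP.m≤n+m _ ⟦ same r f ⟧ℕ)

      reps-cover : ∀ L {e} → e ∈ L → Eligible e → Any (λ r → same r e ≡ true) (reps L)
      reps-cover (e ∷ L) (here refl) el = found (reps L) (new? e (reps L))
        where
        found : ∀ R (d : Dec (New e R)) → Any (λ r → same r e ≡ true) (insert e R d)
        found R (yes _) = here (same-refl e)
        found R (no old) with Any.any? (λ r → same r e B.≟ true) R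
        ... | yes p = p
        ... | no p  = ⊥-elim (old (el , p))
      reps-cover (e ∷ L) {e′} (there m) el = keep (reps L) (new? e (reps L)) (reps-cover L m el)
        where
        keep : ∀ R (d : Dec (New e R)) → Any (λ r → same r e′ ≡ true) R → Any (λ r → same r e′ ≡ true)
          (insert e R d)
        keep R (yes _) p = there p
        keep R (no _)  p = p

      R : List (Fin M)
      R = reps (allFin M)

      -- A tight set is a union of classes, and each of its fractional elements lies in exactly one
      -- represented class. Since `d` lives on fractional elements, its sum over the set splits into
      -- class sums, all of which vanish.
      tight-sum : ∀ {d} → SupportedOn fractional d → All (λ r → rowSum (same r) d ≡ 0ℚ) R → ∀ S → Tight S →
        mass S d ≡ 0ℚ
      tight-sum {d} supp zs S k = trans (∑-cong pt) (trans (∑-lsum (λ r f → ⟦ same r f ⟧ * (⟦ S r ⟧ * d f)) R)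
          (lsum-zero (All.map (λ {r} h → vanish r h) zs)))
        where
        swap : ∀ a b c → a * (b * c) ≡ b * (a * c)
        swap = solve-∀ ℚ-ring
        vanish : ∀ r → rowSum (same r) d ≡ 0ℚ → ∑ (λ f → ⟦ same r f ⟧ * (⟦ S r ⟧ * d f)) ≡ 0ℚ
        vanish r h = trans (∑-cong (λ f → swap ⟦ same r f ⟧ ⟦ S r ⟧ (d f)))
          (trans (∑-* ⟦ S r ⟧ (λ f → ⟦ same r f ⟧ * d f))
          (trans (cong (⟦ S r ⟧ *_) h) (ℚP.*-zeroʳ ⟦ S r ⟧)))
        once : ∀ f → fractional f ≡ true → S f ≡ true → incidence (map same R) f ≡ 1
        once f ff sf = ℕP.≤-antisym (reps-once (allFin M) f)
          (some-incidence R f (reps-cover (allFin M) (MP.∈-allFin f) (ff , cover)))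
          where
          cover : Any (λ S → Tight S × S f ≡ true) (subsets M)
          cover with subsets-complete S
          ... | S′ , m , eq = Any.map (λ { refl → tight-cong (sym ∘ eq) k , trans (eq f) sf }) m
        same-S : ∀ f r → ⟦ same r f ⟧ * (⟦ S f ⟧ * d f) ≡ ⟦ same r f ⟧ * (⟦ S r ⟧ * d f)
        same-S f r = by (same r f) refl
          where
          by : ∀ b → same r f ≡ b → ⟦ b ⟧ * (⟦ S f ⟧ * d f) ≡ ⟦ b ⟧ * (⟦ S r ⟧ * d f)
          by true  eq = cong (λ b → 1ℚ * (⟦ b ⟧ * d f)) (sym (same⇒ eq S k))
          by false eq = trans (ℚP.*-zeroˡ (⟦ S f ⟧ * d f)) (sym (ℚP.*-zeroˡ (⟦ S r ⟧ * d f)))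
        pt : ∀ f → ⟦ S f ⟧ * d f ≡ lsum (λ r → ⟦ same r f ⟧ * (⟦ S r ⟧ * d f)) R
        pt f = trans (sym (scale (fractional f) (S f) refl refl))
          (trans (sym (lsum-incidence same R f (⟦ S f ⟧ * d f))) (lsum-cong R (same-S f)))
          where
          times : ∀ {q} → q ≡ 0ℚ → ∀ k → toℚ k * q ≡ q
          times refl k = ℚP.*-zeroʳ (toℚ k)
          scale : ∀ a b → fractional f ≡ a → S f ≡ b → toℚ (incidence (map same R) f) * (⟦ S f ⟧ * d f) ≡ ⟦
            S f ⟧ * d f
          scale true true ff sf = trans (cong (λ k → toℚ k * (⟦ S f ⟧ * d f)) (once f ff sf))
            (ℚP.*-identityˡ (⟦ S f ⟧ * d f))
          scale false b ff _ = times (trans (cong (⟦ S f ⟧ *_) (supp f ff)) (ℚP.*-zeroʳ ⟦ S f ⟧))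
            (incidence (map same R) f)
          scale true false _ sf = times (trans (cong (λ b → ⟦ b ⟧ * d f) sf) (ℚP.*-zeroˡ (d f)))
            (incidence (map same R) f)

      activePairs : List (Fin M × Fin M)
      activePairs = filter (λ p → fractional (proj₁ p) B.≟ true) pairs

      rows : List (Row M)
      rows = map same R ++ map pairRow activePairs

      pair-two : ∀ {a b} → a ≢ b → y a + y b ≡ 1ℚ → fractional a ≡ true → AtLeastTwo fractional
        (pairRow (a , b))
      pair-two {a} {b} ne h fa = a , b , ne , (fa , cong (_∨ (a == b)) (==-refl a)) ,
          (⇒fractional (λ z → proj₂ (fractional⇒ fa)
            (trans (sym (ℚP.+-identityʳ (y a))) (trans (cong (y a +_) (sym z)) h)))
                       (λ o → proj₁ (fractional⇒ fa) (trans (lem (y a) (y b)) (trans (cong₂ _-_ h o) refl))) ,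
           trans (cong ((b == a) ∨_) (==-refl b)) (BP.∨-zeroʳ (b == a)))
        where
        lem : ∀ p q → p ≡ p + q - q
        lem = solve-∀ ℚ-ring

      pair-once : ∀ f → incidence (map pairRow activePairs) f ℕ.≤ 1
      pair-once f = ℕP.≤-trans (incidence-filter (λ p → fractional (proj₁ p) B.≟ true) pairRow pairs f)
        (disjoint f)

      rows-two : All (AtLeastTwo fractional) rows
      rows-two = AllP.++⁺ (AllP.map⁺ (All.map (λ (a , b) → class-two a b) (reps-eligible (allFin M))))
        (AllP.map⁺ (All.zipWith (λ ((ne , h) , fa) → pair-two ne h fa)
          (AllP.filter⁺ (λ p → fractional (proj₁ p) B.≟ true) (All.zip (distinct , pairSums)) ,
           AllP.all-filter (λ p → fractional (proj₁ p) B.≟ true) pairs)))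

      rows-inc : ∀ f → incidence rows f ℕ.≤ 2
      rows-inc f = subst (ℕ._≤ 2) (sym (incidence-++ (map same R) (map pairRow activePairs) f))
        (ℕP.+-mono-≤ (reps-once (allFin M) f) (pair-once f))

      -- Class rows and pair rows both sum to the total of d, so the last row sum vanishes as well.
      balance : ∃[ e ] fractional e ≡ true → TwoRegular fractional rows → Circulation fractional rows
      balance (e , fe) (r₀ , rs , eq , (d , supp , nz , zs) , two , _) = close R refl eq
        where
        one-one : ∀ {a b} → a ℕ.≤ 1 → b ℕ.≤ 1 → a ℕ.+ b ≡ 2 → a ≡ 1 × b ≡ 1
        one-one {suc zero} {suc zero} _ _ _ = refl , refl
        one-one {zero} {suc (suc b)} _ (ℕ.s≤s ()) _
        one-one {suc zero} {suc (suc b)} _ (ℕ.s≤s ()) _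
        one-one {suc (suc a)} (ℕ.s≤s ())
        each : ∀ f → fractional f ≡ true → incidence (map same R) f ≡ 1 × incidence
          (map pairRow activePairs) f ≡ 1
        each f ff = one-one (reps-once (allFin M) f) (pair-once f)
          (trans (sym (incidence-++ (map same R) (map pairRow activePairs) f)) (two f ff))
        total : ∀ {A : Set} (g : A → Row M) L → (∀ f → fractional f ≡ true → incidence (map g L) f ≡ 1) →
          lsum (λ a → rowSum (g a) d) L ≡ ∑ d
        total g L h = trans (lsum-rowSum g L d) (∑-cong pt)
          where
          pt : ∀ f → toℚ (incidence (map g L) f) * d f ≡ d f
          pt f = by (fractional f) refl
            where
            by : ∀ b → fractional f ≡ b → toℚ (incidence (map g L) f) * d f ≡ d f
            by true eq  = trans (cong (λ k → toℚ k * d f) (h f eq)) (ℚP.*-identityˡ (d f))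
            by false eq = trans (cong (toℚ (incidence (map g L) f) *_) (supp f eq))
              (trans (ℚP.*-zeroʳ (toℚ (incidence (map g L) f))) (sym (supp f eq)))
        close : ∀ R′ → R′ ≡ R → map same R ++ map pairRow activePairs ≡ r₀ ∷ rs → Circulation fractional rows
        close [] refR _ with trans (cong (λ L → incidence (map same L) e) refR) (proj₁ (each e fe))
        ... | ()
        close (r ∷ R′) refR eq′ = d , supp , nz , subst
          (λ L → All (λ r → rowSum r d ≡ 0ℚ) (map same L ++ map pairRow activePairs)) refR (first ∷ zs′)
          where
          eq″ : same r ∷ (map same R′ ++ map pairRow activePairs) ≡ r₀ ∷ rs
          eq″ = trans (cong (λ L → map same L ++ map pairRow activePairs) refR) eq′
          zs′ : All (λ r → rowSum r d ≡ 0ℚ) (map same R′ ++ map pairRow activePairs)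
          zs′ = subst (All (λ r → rowSum r d ≡ 0ℚ)) (sym (LP.∷-injectiveʳ eq″)) zs
          pairTotal : ∑ d ≡ 0ℚ
          pairTotal = trans (sym (total pairRow activePairs (λ f ff → proj₂ (each f ff))))
            (lsum-zero (AllP.map⁻ (AllP.++⁻ʳ (map same R′) zs′)))
          classTotal : rowSum (same r) d + lsum (λ a → rowSum (same a) d) R′ ≡ ∑ d
          classTotal = total same (r ∷ R′)
            (λ f ff → trans (cong (λ L → incidence (map same L) f) refR) (proj₁ (each f ff)))
          first : rowSum (same r) d ≡ 0ℚ
          first = trans (sym (ℚP.+-identityʳ (rowSum (same r) d)))
            (trans (cong (rowSum (same r) d +_) (sym (lsum-zero (AllP.map⁻ (AllP.++⁻ˡ (map same R′) zs′)))))
            (trans classTotal pairTotal))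

      direction : ∃[ e ] fractional e ≡ true → Circulation fractional rows
      direction ne = pick (circulation fractional rows ne rows-two (λ f _ → rows-inc f))
        where
        pick : Circulation fractional rows ⊎ TwoRegular fractional rows → Circulation fractional rows
        pick (inj₁ c) = c
        pick (inj₂ r) = balance ne r

      rounded : Fin M → ℕ
      rounded e = if does (y e ℚP.≟ 1ℚ) then 1 else 0

      rounded-value : (∀ e → fractional e ≡ false) → ∀ e → toℚ (rounded e) ≡ y e
      rounded-value h e with y e ℚP.≟ 1ℚ | integral (h e)
      ... | yes p | _ = sym p
      ... | no p | inj₁ z = sym z
      ... | no p | inj₂ o = ⊥-elim (p o)

      rounded-rainbow : (∀ e → fractional e ≡ false) → Rainbow rounded
      rounded-rainbow h = (λ S → subst (g S ≤_) (∑-cong (λ e → cong (⟦ S e ⟧ *_) (sym (rounded-value h e))))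
        (above S)) ,
        All.map (λ {p} k → toℚ-injective
          (trans (toℚ-+ (rounded (proj₁ p)) (rounded (proj₂ p)))
            (trans (cong₂ _+_ (rounded-value h _) (rounded-value h _)) k))) pairSums

    negated : Vec M → Vec M
    negated a e = - a e

    dot-negated : ∀ a x → dot (negated a) x ≡ - dot a x
    dot-negated a x = trans (∑-cong (λ e → lem (a e) (x e)))
      (trans (∑-* (- 1ℚ) (λ e → a e * x e)) (lem₂ (dot a x)))
      where
      lem : ∀ a x → (- a) * x ≡ (- 1ℚ) * (a * x)
      lem = solve-∀ ℚ-ring
      lem₂ : ∀ a → (- 1ℚ) * a ≡ - a
      lem₂ = solve-∀ ℚ-ring

    lower upper : Fin M → Constraint M
    lower e = unit e , 0ℚ
    upper e = negated (unit e) , - 1ℚ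

    onSet : Row M → Constraint M
    onSet S = indicator S , g S

    -- The pair equation enters as two opposite inequalities, both tight at every feasible point.
    pairLower pairUpper : Fin M × Fin M → Constraint M
    pairLower p = indicator (pairRow p) , 1ℚ
    pairUpper p = negated (indicator (pairRow p)) , - 1ℚ

    constraints : List (Constraint M)
    constraints = map lower (allFin M) ++ map upper (allFin M) ++ map onSet (subsets M) ++ map pairLower
      pairs ++ map pairUpper pairs

    blocks : {P : Constraint M → Set} → (∀ e → P (lower e)) → (∀ e → P (upper e)) → (∀ S → P (onSet S)) →
      All (P ∘ pairLower) pairs → All (P ∘ pairUpper) pairs → All P constraints
    blocks {P} l u o p q = AllP.++⁺ (every lower (allFin M) l) (AllP.++⁺ (every upper (allFin M) u)
      (AllP.++⁺ (every onSet (subsets M) o)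
        (AllP.++⁺ (AllP.map⁺ {f = pairLower} p) (AllP.map⁺ {f = pairUpper} q))))
      where
      every : {A : Set} (f : A → Constraint M) (L : List A) → (∀ a → P (f a)) → All P (map f L)
      every f []      h = []
      every f (a ∷ L) h = h a ∷ every f L h

    private
      neg-slack : ∀ {a x} → 0ℚ ≤ dot (negated a) x - (- 1ℚ) → dot a x ≤ 1ℚ
      neg-slack {a} {x} h = ≤-by h (trans (lem (dot a x))
        (cong (λ k → dot a x + (k - (- 1ℚ))) (sym (dot-negated a x))))
        where
        lem : ∀ a → 1ℚ ≡ a + (- a - (- 1ℚ))
        lem = solve-∀ ℚ-ring

      slack-neg : ∀ {a x} → dot a x ≤ 1ℚ → 0ℚ ≤ dot (negated a) x - (- 1ℚ)
      slack-neg {a} {x} h = subst (0ℚ ≤_) (trans (lem (dot a x)) (cong (_- (- 1ℚ)) (sym (dot-negated a x))))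
        (0≤- h)
        where
        lem : ∀ a → 1ℚ - a ≡ - a - (- 1ℚ)
        lem = solve-∀ ℚ-ring

      neg-tight : ∀ {a x} → dot (negated a) x - (- 1ℚ) ≡ 0ℚ → dot a x ≡ 1ℚ
      neg-tight {a} {x} h = ℚP.neg-injective (trans (sym (dot-negated a x)) (-≡0⇒≡ h))

      neg-zero : ∀ {a x} → dot a x ≡ 0ℚ → dot (negated a) x ≡ 0ℚ
      neg-zero {a} {x} h = trans (dot-negated a x) (cong -_ h)

    bounded⇒feasible : ∀ {y} → Bounded y → Feasible constraints y
    bounded⇒feasible {y} (box , sets , ps) = blocks
      (λ e → 0≤- (subst (0ℚ ≤_) (sym (dot-unit e y)) (proj₁ (box e))))
      (λ e → slack-neg {unit e} (subst (_≤ 1ℚ) (sym (dot-unit e y)) (proj₂ (box e))))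
      (λ S → 0≤- (sets S))
      (All.map (λ h → 0≤- (ℚP.≤-reflexive (sym h))) sums)
      (All.map (λ {p} h → slack-neg {indicator (pairRow p)} (ℚP.≤-reflexive h)) sums)
      where
      sums : All (λ p → rowSum (pairRow p) y ≡ 1ℚ) pairs
      sums = All.zipWith (λ (ne , h) → trans (pairRow-sum ne y) h) (distinct , ps)

    feasible⇒bounded : ∀ {y} → Feasible constraints y → Bounded y
    feasible⇒bounded {y} f =
      (λ e → subst (0ℚ ≤_) (dot-unit e y) (0≤-⁻ (All.lookup (AllP.map⁻ f₁) (MP.∈-allFin e))) ,
             subst (_≤ 1ℚ) (dot-unit e y) (neg-slack {unit e} (All.lookup (AllP.map⁻ f₂) (MP.∈-allFin e)))) ,
      sets ,
      All.zipWith (λ { {p} (ne , (h , k)) → trans (sym (pairRow-sum ne y))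
        (ℚP.≤-antisym (neg-slack {indicator (pairRow p)} k) (0≤-⁻ h)) })
        (distinct , All.zip (AllP.map⁻ f₄ , AllP.map⁻ f₅))
      where
      f₁ = AllP.++⁻ˡ (map lower (allFin M)) f
      g₁ = AllP.++⁻ʳ (map lower (allFin M)) f
      f₂ = AllP.++⁻ˡ (map upper (allFin M)) g₁
      g₂ = AllP.++⁻ʳ (map upper (allFin M)) g₁
      f₃ = AllP.++⁻ˡ (map onSet (subsets M)) g₂
      g₃ = AllP.++⁻ʳ (map onSet (subsets M)) g₂
      f₄ = AllP.++⁻ˡ (map pairLower pairs) g₃
      f₅ = AllP.++⁻ʳ (map pairLower pairs) g₃
      sets : ∀ S → g S ≤ mass S y
      sets S with subsets-complete S
      ... | S′ , m , eq = subst₂ _≤_ (g-cong eq) (mass-cong {y = y} eq) (0≤-⁻ (All.lookup (AllP.map⁻ f₃) m))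

    module _ (y : Vec M) (bd : Bounded y) where

      private
        Φ = fractional y bd
        classes = map (same y bd) (R y bd)

      partner : ∀ {a b} → y a + y b ≡ 1ℚ → Φ b ≡ true → Φ a ≡ true
      partner {a} {b} h fb = ⇒fractional y bd
        (λ z → proj₂ (fractional⇒ y bd fb)
          (trans (sym (ℚP.+-identityˡ (y b))) (trans (cong (_+ y b) (sym z)) h)))
        (λ o → proj₁ (fractional⇒ y bd fb) (trans (lem (y a) (y b)) (cong₂ _-_ h o)))
        where
        lem : ∀ p q → q ≡ p + q - p
        lem = solve-∀ ℚ-ring

      -- Pairs without a row in the system have an integral first entry. As the two entries sum to
      -- one, the second is integral as well, and `d` vanishes on both.
      pairs-zero : ∀ {d} → SupportedOn Φ d → All (λ r → rowSum r d ≡ 0ℚ) (rows y bd) → All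
        (λ p → rowSum (pairRow p) d ≡ 0ℚ) pairs
      pairs-zero {d} supp zs = All.tabulate (λ {p} m → one p m (Φ (proj₁ p) B.≟ true))
        where
        activeZero : All (λ p → rowSum (pairRow p) d ≡ 0ℚ) (activePairs y bd)
        activeZero = AllP.map⁻ (AllP.++⁻ʳ classes zs)
        one : ∀ p → p ∈ pairs → Dec (Φ (proj₁ p) ≡ true) → rowSum (pairRow p) d ≡ 0ℚ
        one p m (yes fa) = All.lookup activeZero (MP.∈-filter⁺ (λ p → Φ (proj₁ p) B.≟ true) m fa)
        one (a , b) m (no fa) = trans (pairRow-sum (All.lookup distinct m) d)
          (trans (cong₂ _+_ (supp a (≢true fa))
            (supp b (≢true (λ fb → fa (partner (All.lookup (proj₂ (proj₂ bd)) m) fb))))) (ℚP.+-identityʳ 0ℚ))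

      fractional-direction : Circulation Φ (rows y bd) → ∃[ d ] (∃[ e ] d e ≢ 0ℚ) × Admissible constraints y d
      fractional-direction (d , supp , nz , zs) = d , nz , blocks
        (λ e h → trans (dot-unit e d) (supp e
          (≢true (λ fr → proj₁ (fractional⇒ y bd fr) (trans (sym (dot-unit e y)) (-≡0⇒≡ h))))))
        (λ e h → neg-zero {unit e} (trans (dot-unit e d)
          (supp e (≢true (λ fr → proj₂ (fractional⇒ y bd fr)
            (trans (sym (dot-unit e y)) (neg-tight {unit e} h)))))))
        (λ S h → tight-sum y bd supp (AllP.map⁻ (AllP.++⁻ˡ classes zs)) S (-≡0⇒≡ h))
        (All.map (λ h _ → h) (pairs-zero supp zs))
        (All.map (λ {p} h _ → neg-zero {indicator (pairRow p)} h) (pairs-zero supp zs))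

      improve : Cone Rainbow 1ℚ y ⊎ (∃[ d ] (∃[ e ] d e ≢ 0ℚ) × Admissible constraints y d)
      improve = decide (FP.any? (λ e → Φ e B.≟ true))
        where
        decide : Dec (∃[ e ] Φ e ≡ true) → Cone Rainbow 1ℚ y ⊎
          (∃[ d ] (∃[ e ] d e ≢ 0ℚ) × Admissible constraints y d)
        decide (yes ne)  = inj₂ (fractional-direction (direction y bd ne))
        decide (no none) = inj₁ (cone-point (rounded y bd) (rounded-rainbow y bd all-int)
          (λ e → ℚP.≤-reflexive (rounded-value y bd all-int e)))
          where
          all-int : ∀ e → Φ e ≡ false
          all-int e = ≢true (λ h → none (e , h))

    -- Matroid intersection with a partition matroid whose blocks are pairs.
    rainbow-decomposition : ∀ y → Bounded y → Cone Rainbow 1ℚ y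
    rainbow-decomposition y b = polyhedral-induction constraints
      (λ e → MP.∈-++⁺ˡ (MP.∈-map⁺ lower (MP.∈-allFin e))) Rainbow
      (λ x f → improve x (feasible⇒bounded f)) y (bounded⇒feasible b)

open RainbowForests using (Rainbow; rainbow-decomposition)

-- Components of the graph with a given edge set

module _ {n M : ℕ} (s t : Fin M → Fin n) where

  -- ℓ is an idempotent choice of a representative in every component of the graph with edges P.
  record Labels (P : Fin M → Set) (ℓ : Fin n → Fin n) : Set₁ where
    field
      constant  : ∀ e → P e → ℓ (s e) ≡ ℓ (t e)
      universal : ∀ {A : Set} (h : Fin n → A) → (∀ e → P e → h (s e) ≡ h (t e)) → ∀ v → h (ℓ v) ≡ h v

    idempotent : ∀ v → ℓ (ℓ v) ≡ ℓ v
    idempotent = universal ℓ constant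

  open Labels

  join : Fin M → (Fin n → Fin n) → Fin n → Fin n
  join e ℓ v = if ℓ v == ℓ (s e) then ℓ (t e) else ℓ v

  joinAll : (Fin n → Fin n) → List (Fin M) → Fin n → Fin n
  joinAll ℓ []      = ℓ
  joinAll ℓ (e ∷ L) = joinAll (join e ℓ) L

  labels-id : Labels (λ _ → ⊥) (λ v → v)
  labels-id = record { constant = λ _ () ; universal = λ _ _ _ → refl }

  labels-resp : ∀ {P Q ℓ} → (∀ e → P e → Q e) → (∀ e → Q e → P e) → Labels P ℓ → Labels Q ℓ
  labels-resp to from lab = record
    { constant = λ e q → constant lab e (from e q) ; universal = λ h c → universal lab h
      (λ e p → c e (to e p)) }

  labels-join : ∀ {P ℓ} e → Labels P ℓ → Labels (λ f → f ≡ e ⊎ P f) (join e ℓ)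
  labels-join {P} {ℓ} e lab = record { constant = const ; universal = univ }
    where
    at-t : join e ℓ (t e) ≡ ℓ (t e)
    at-t with ℓ (t e) == ℓ (s e)
    ... | true  = refl
    ... | false = refl
    const : ∀ f → f ≡ e ⊎ P f → join e ℓ (s f) ≡ join e ℓ (t f)
    const f (inj₁ refl) = trans (cong (λ b → if b then ℓ (t f) else ℓ (s f)) (==-refl (ℓ (s f)))) (sym at-t)
    const f (inj₂ p)    = cong (λ w → if w == ℓ (s e) then ℓ (t e) else w) (constant lab f p)
    univ : ∀ {A : Set} (h : Fin n → A) → (∀ f → f ≡ e ⊎ P f → h (s f) ≡ h (t f)) → ∀ v → h (join e ℓ v) ≡ h v
    univ h c v = by (ℓ v == ℓ (s e)) refl
      where
      at : ∀ w → h (ℓ w) ≡ h w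
      at = universal lab h (λ f p → c f (inj₂ p))
      by : ∀ b → (ℓ v == ℓ (s e)) ≡ b → h (if b then ℓ (t e) else ℓ v) ≡ h v
      by false _ = at v
      by true q  = trans (at (t e)) (trans (sym (c e (inj₁ refl)))
        (trans (sym (at (s e))) (trans (cong h (sym (==⇒≡ q))) (at v))))

  labels-joinAll : ∀ {P ℓ} L → Labels P ℓ → Labels (λ f → f ∈ L ⊎ P f) (joinAll ℓ L)
  labels-joinAll []      lab = labels-resp (λ _ → inj₂) (λ { _ (inj₂ p) → p }) lab
  labels-joinAll (e ∷ L) lab = labels-resp
    (λ { _ (inj₁ m) → inj₁ (there m) ; _ (inj₂ (inj₁ refl)) → inj₁ (here refl) ; _ (inj₂ (inj₂ p)) → inj₂ p })
    (λ { _ (inj₁ (here refl)) → inj₂ (inj₁ refl) ; _ (inj₁ (there m)) → inj₁ m ; _ (inj₂ p) → inj₂ (inj₂ p) })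
    (labels-joinAll L (labels-join e lab))

  roots : (Fin n → Fin n) → ℕ
  roots ℓ = size (λ v → ℓ v == v)

  -- `ℓ′` maps the roots of `ℓ` bijectively to its own roots, with inverse `ℓ`. The bijection is
  -- used by counting the pairs (v , w) with w = ℓ′ v and ℓ v = v in both orders.
  roots-unique : ∀ {P ℓ ℓ′} → Labels P ℓ → Labels P ℓ′ → roots ℓ ≡ roots ℓ′
  roots-unique {P} {ℓ} {ℓ′} lab lab′ = trans (spread ℓ ℓ′)
    (trans (∑ℕ-comm (λ v w → ⟦ w == ℓ′ v ⟧ℕ ℕ.* ⟦ ℓ v == v ⟧ℕ))
      (trans (∑ℕ-cong (λ w → ∑ℕ-cong (λ v → swap v w))) (sym (spread ℓ′ ℓ))))
    where
    spread : ∀ (k k′ : Fin n → Fin n) → roots k ≡ ∑ℕ (λ v → ∑ℕ (λ w → ⟦ w == k′ v ⟧ℕ ℕ.* ⟦ k v == v ⟧ℕ))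
    spread k k′ = ∑ℕ-cong (λ v → sym (∑ℕ-single (k′ v) (λ _ → ⟦ k v == v ⟧ℕ)))
    implies : ∀ {k k′} → Labels P k → Labels P k′ → ∀ v w → w ≡ k′ v → k v ≡ v → v ≡ k w × k′ w ≡ w
    implies {k} {k′} L L′ v w refl h = trans (sym h) (sym (universal L′ k (constant L) v)) , idempotent L′ v
    ∧⇒ : ∀ {a b : Bool} {A B : Set} → (A → a ≡ true) → (B → b ≡ true) → A × B → ⟦ a ⟧ℕ ℕ.* ⟦ b ⟧ℕ ≡ 1
    ∧⇒ f g (x , y) = cong₂ (λ a b → ⟦ a ⟧ℕ ℕ.* ⟦ b ⟧ℕ) (f x) (g y)
    ≡⇒== : ∀ {i j : Fin n} → i ≡ j → (i == j) ≡ true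
    ≡⇒== {i} refl = ==-refl i
    swap : ∀ v w → ⟦ w == ℓ′ v ⟧ℕ ℕ.* ⟦ ℓ v == v ⟧ℕ ≡ ⟦ v == ℓ w ⟧ℕ ℕ.* ⟦ ℓ′ w == w ⟧ℕ
    swap v w with (w F.≟ ℓ′ v) ×-dec (ℓ v F.≟ v) | (v F.≟ ℓ w) ×-dec (ℓ′ w F.≟ w)
    ... | yes p | yes q = trans (∧⇒ ≡⇒== ≡⇒== p) (sym (∧⇒ ≡⇒== ≡⇒== q))
    ... | yes p | no q  = ⊥-elim (q (implies lab lab′ v w (proj₁ p) (proj₂ p)))
    ... | no p  | yes q = ⊥-elim (p (implies lab′ lab w v (proj₁ q) (proj₂ q)))
    ... | no p  | no q  = trans (none p) (sym (none q))
      where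
      none : ∀ {i j k l : Fin n} → ¬ (i ≡ j × k ≡ l) → ⟦ i == j ⟧ℕ ℕ.* ⟦ k == l ⟧ℕ ≡ 0
      none {i} {j} {k} {l} h with i F.≟ j | k F.≟ l
      ... | yes a | yes b = ⊥-elim (h (a , b))
      ... | yes _ | no _  = refl
      ... | no _  | _     = refl

  -- When the edge joins two components, exactly one root is lost, the label of its first end.
  roots-join : ∀ {P ℓ} e → Labels P ℓ → roots ℓ ≡ ⟦ not (ℓ (s e) == ℓ (t e)) ⟧ℕ ℕ.+ roots (join e ℓ)
  roots-join {P} {ℓ} e lab with ℓ (s e) F.≟ ℓ (t e)
  ... | yes same = ∑ℕ-cong (λ v → cong (λ w → ⟦ w == v ⟧ℕ) (sym (unchanged v)))
    where
    unchanged : ∀ v → join e ℓ v ≡ ℓ v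
    unchanged v with ℓ v F.≟ ℓ (s e)
    ... | yes q = trans (sym same) (sym q)
    ... | no _  = refl
  ... | no differ = trans (size-∖ {P = λ v → ℓ v == v} {e = ℓ (s e)}
    (trans (cong (_== ℓ (s e)) (idempotent lab (s e))) (==-refl (ℓ (s e)))))
        (cong suc (∑ℕ-cong (λ v → cong ⟦_⟧ℕ (sym (pt v)))))
    where
    pt : ∀ v → (join e ℓ v == v) ≡ (ℓ v == v) ∧ not (v == ℓ (s e))
    pt v with ℓ v F.≟ ℓ (s e)
    ... | yes q = trans (==-≢ (λ r → differ (trans (sym q) (trans (cong ℓ (sym r)) (idempotent lab (t e))))))
                        (sym (rhs (ℓ v F.≟ v)))
      where
      rhs : (d : Dec (ℓ v ≡ v)) → ⌊ d ⌋ ∧ not (v == ℓ (s e)) ≡ false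
      rhs (yes r) = trans (cong (λ w → not (w == ℓ (s e))) (trans (sym r) q)) (cong not (==-refl (ℓ (s e))))
      rhs (no _)  = refl
    ... | no q = sym (trans (cong (λ b → (ℓ v == v) ∧ not b)
      (==-≢ {i = v} (λ r → q (trans (cong ℓ r) (idempotent lab (s e))))))
                        (BP.∧-identityʳ (ℓ v == v)))

  -- Diminishing returns: `ℓ` has fewer edges and hence finer components, so an edge that still
  -- merges two components of `ℓ′` also merges two of `ℓ`. Adding the edges of `L` one by one
  -- therefore lowers the count of `ℓ` at least as much.
  roots-submodular : ∀ L {P P′ ℓ ℓ′} → Labels P ℓ → Labels P′ ℓ′ → (∀ e → P e → P′ e) →
    roots ℓ′ ℕ.+ roots (joinAll ℓ L) ℕ.≤ roots ℓ ℕ.+ roots (joinAll ℓ′ L)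
  roots-submodular [] {ℓ = ℓ} {ℓ′} _ _ _ = ℕP.≤-reflexive (ℕP.+-comm (roots ℓ′) (roots ℓ))
  roots-submodular (e ∷ L) {P} {P′} {ℓ} {ℓ′} lab lab′ sub = subst₂ ℕ._≤_
    (sym (trans (cong (ℕ._+ r) (roots-join e lab′)) (ℕP.+-assoc ⟦ δ′ ⟧ℕ (roots (join e ℓ′)) r)))
    (sym (trans (cong (ℕ._+ r′) (roots-join e lab)) (ℕP.+-assoc ⟦ δ ⟧ℕ (roots (join e ℓ)) r′)))
    (ℕP.+-mono-≤ less (roots-submodular L (labels-join e lab) (labels-join e lab′)
      (λ { f (inj₁ q) → inj₁ q ; f (inj₂ p) → inj₂ (sub f p) })))
    where
    r = roots (joinAll (join e ℓ) L)
    r′ = roots (joinAll (join e ℓ′) L)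
    δ = not (ℓ (s e) == ℓ (t e))
    δ′ = not (ℓ′ (s e) == ℓ′ (t e))
    coarser : ∀ v → ℓ′ (ℓ v) ≡ ℓ′ v
    coarser = universal lab ℓ′ (λ f p → constant lab′ f (sub f p))
    less : ⟦ δ′ ⟧ℕ ℕ.≤ ⟦ δ ⟧ℕ
    less with ℓ (s e) F.≟ ℓ (t e) | ℓ′ (s e) F.≟ ℓ′ (t e)
    ... | yes q | no p  = ⊥-elim (p (trans (sym (coarser (s e))) (trans (cong ℓ′ q) (coarser (t e)))))
    ... | yes _ | yes _ = ℕP.≤-refl
    ... | no _  | yes _ = ℕ.z≤n
    ... | no _  | no _  = ℕP.≤-refl

  edges : Row M → List (Fin M)
  edges X = filter (λ e → X e B.≟ true) (allFin M)

  ∈-edges⁺ : ∀ {X e} → X e ≡ true → e ∈ edges X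
  ∈-edges⁺ {X} {e} h = MP.∈-filter⁺ (λ e → X e B.≟ true) (MP.∈-allFin e) h

  ∈-edges⁻ : ∀ {X e} → e ∈ edges X → X e ≡ true
  ∈-edges⁻ {X} m = proj₂ (MP.∈-filter⁻ (λ e → X e B.≟ true) {xs = allFin M} m)

  component : Row M → Fin n → Fin n
  component X = joinAll (λ v → v) (edges X)

  component-labels : ∀ X → Labels (λ e → X e ≡ true) (component X)
  component-labels X = labels-resp (λ { _ (inj₁ m) → ∈-edges⁻ {X} m ; _ (inj₂ ()) })
    (λ _ h → inj₁ (∈-edges⁺ {X} h)) (labels-joinAll (edges X) labels-id)

  κ : Row M → ℕ
  κ X = roots (component X)

  κ-cong : ∀ {X Y} → (∀ e → X e ≡ Y e) → κ X ≡ κ Y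
  κ-cong {X} {Y} h = roots-unique (component-labels X)
    (labels-resp (λ e p → trans (h e) p) (λ e p → trans (sym (h e)) p) (component-labels Y))

  -- Adding the edges of `X` turns `X ∩ Y` into `X` and `Y` into `X ∪ Y`, and the first saves at
  -- least as many components. This is submodularity of the graphic rank, in terms of component
  -- counts.
  κ-submodular : ∀ X Y → κ X ℕ.+ κ Y ℕ.≤ κ (X ∩ Y) ℕ.+ κ (X ∪ Y)
  κ-submodular X Y = subst₂ ℕ._≤_
    (trans (cong (κ Y ℕ.+_) (roots-unique (labels-resp
        (λ { _ (inj₁ m) → ∈-edges⁻ {X} m ; e (inj₂ p) → proj₁ (∧-true {X e} p) })
          (λ _ h → inj₁ (∈-edges⁺ {X} h)) grown) (component-labels X)))
      (ℕP.+-comm (κ Y) (κ X)))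
    (cong (κ (X ∩ Y) ℕ.+_) (roots-unique (labels-resp to from grown′) (component-labels (X ∪ Y))))
    (roots-submodular (edges X) (component-labels (X ∩ Y)) (component-labels Y)
      (λ e p → proj₂ (∧-true {X e} p)))
    where
    grown = labels-joinAll (edges X) (component-labels (X ∩ Y))
    grown′ = labels-joinAll (edges X) (component-labels Y)
    to : ∀ e → e ∈ edges X ⊎ Y e ≡ true → (X ∪ Y) e ≡ true
    to e (inj₁ m) = cong (_∨ Y e) (∈-edges⁻ {X} m)
    to e (inj₂ p) = trans (cong (X e ∨_) p) (BP.∨-zeroʳ (X e))
    from : ∀ e → (X ∪ Y) e ≡ true → e ∈ edges X ⊎ Y e ≡ true
    from e h with X e in eq
    ... | true  = inj₁ (∈-edges⁺ {X} eq)
    ... | false = inj₂ h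

  -- The least number of edges of S needed to connect the graph once all other edges are present.
  demand : Row M → ℚ
  demand S = toℚ (κ (not ∘ S)) - 1ℚ

  demand-cong : ∀ {S T} → (∀ e → S e ≡ T e) → demand S ≡ demand T
  demand-cong h = cong (λ k → toℚ k - 1ℚ) (κ-cong (λ e → cong not (h e)))

  demand-int : ∀ S → IsInt (demand S)
  demand-int S = int-- (int-ℕ (κ (not ∘ S))) (int-ℕ 1)

  demand-supermodular : ∀ S T → demand S + demand T ≤ demand (S ∪ T) + demand (S ∩ T)
  demand-supermodular S T = ≤-by (0≤- (toℚ-mono (κ-submodular (not ∘ S) (not ∘ T)))) (begin
    (toℚ (κ (not ∘ (S ∪ T))) - 1ℚ) + (toℚ (κ (not ∘ (S ∩ T))) - 1ℚ)
      ≡⟨ cong₂ (λ a b → (toℚ a - 1ℚ) + (toℚ b - 1ℚ)) (κ-cong (λ e → not-∨ (S e) (T e)))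
        (κ-cong (λ e → not-∧ (S e) (T e))) ⟩
    (toℚ k₁ - 1ℚ) + (toℚ k₂ - 1ℚ)
      ≡⟨ lem (toℚ a) (toℚ b) (toℚ k₁) (toℚ k₂) ⟩
    (toℚ a - 1ℚ) + (toℚ b - 1ℚ) + ((toℚ k₁ + toℚ k₂) - (toℚ a + toℚ b))
      ≡⟨ cong₂ (λ p q → demand S + demand T + (p - q)) (sym (toℚ-+ k₁ k₂)) (sym (toℚ-+ a b)) ⟩
    demand S + demand T + (toℚ (k₁ ℕ.+ k₂) - toℚ (a ℕ.+ b)) ∎)
    where
    open ≡-Reasoning
    not-∨ : ∀ a b → not (a ∨ b) ≡ not a ∧ not b
    not-∨ true  b = refl
    not-∨ false b = refl
    not-∧ : ∀ a b → not (a ∧ b) ≡ not a ∨ not b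
    not-∧ true  b = refl
    not-∧ false b = refl
    a = κ (not ∘ S)
    b = κ (not ∘ T)
    k₁ = κ ((not ∘ S) ∩ (not ∘ T))
    k₂ = κ ((not ∘ S) ∪ (not ∘ T))
    lem : ∀ a b c d → (c - 1ℚ) + (d - 1ℚ) ≡ (a - 1ℚ) + (b - 1ℚ) + ((c + d) - (a + b))
    lem = solve-∀ ℚ-ring

  size≤1 : ∀ {k} {P : Row k} → AtMostOne P → size P ℕ.≤ 1
  size≤1 {P = P} (inj₂ none) = ℕP.≤-trans (ℕP.≤-reflexive (∑ℕ-zero (λ v → cong ⟦_⟧ℕ (none v)))) ℕ.z≤n
  size≤1 {P = P} (inj₁ (v , pv , only)) = ℕP.≤-reflexive
    (trans (size-∖ {P = P} pv) (cong suc (∑ℕ-zero (λ w → cong ⟦_⟧ℕ (gone w)))))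
    where
    gone : ∀ w → P w ∧ not (w == v) ≡ false
    gone w with P w in eq
    ... | false = refl
    ... | true rewrite only w eq = cong not (==-refl v)

  -- Delete `S`. If at least two components remain, each has a cut of value at least two, only edges
  -- of `S` cross these cuts, and each crosses at most two of them; so the number of components is
  -- at most the mass of `S`, one more than needed. If at most one remains, the demand is not
  -- positive.
  demand≤ : ∀ {x} → (∀ e → 0ℚ ≤ x e) → (∀ U v w → U v ≡ true → U w ≡ false → 1ℚ + 1ℚ ≤ cutval s t x U) → ∀ S
    → demand S ≤ mass S x
  demand≤ {x} pos cut S = decide (classify root)
    where
    ℓ = component (not ∘ S)
    lab = component-labels (not ∘ S)
    root : Fin n → Bool
    root v = ℓ v == v
    mass≥0 : 0ℚ ≤ mass S x
    mass≥0 = ∑-nonneg (λ e → 0≤* (0≤⟦⟧ (S e)) (pos e))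
    decide : Distinct root ⊎ AtMostOne root → demand S ≤ mass S x
    decide (inj₂ few) = ℚP.≤-trans (≤-by (0≤- (toℚ-mono (size≤1 few))) (lem (toℚ (κ (not ∘ S))))) mass≥0
      where
      lem : ∀ k → 0ℚ ≡ k - 1ℚ + (1ℚ - k)
      lem = solve-∀ ℚ-ring
    decide (inj₁ (u , u′ , ne , hu , hu′)) = ≤-by (0≤+ (0≤* (ℚP.<⇒≤ 0<½) (0≤- twice)) 0≤1)
      (lem (toℚ (κ (not ∘ S))) (mass S x))
      where
      0<½ : 0ℚ < ½
      0<½ = ℚ.*<* (ℤ.+<+ (ℕ.s≤s ℕ.z≤n))
      lem : ∀ k m → m ≡ k - 1ℚ + (½ * ((1ℚ + 1ℚ) * m - (1ℚ + 1ℚ) * k) + 1ℚ)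
      lem k m = trans (lem₁ k m) (cong (λ h → k - 1ℚ + (h + 1ℚ))
        (sym (trans (lem₂ ½ k m) (ℚP.*-identityˡ (m - k)))))
        where
        lem₁ : ∀ k m → m ≡ k - 1ℚ + ((m - k) + 1ℚ)
        lem₁ = solve-∀ ℚ-ring
        lem₂ : ∀ h k m → h * ((1ℚ + 1ℚ) * m - (1ℚ + 1ℚ) * k) ≡ (h + h) * (m - k)
        lem₂ = solve-∀ ℚ-ring
      Uᵥ : Fin n → Fin n → Bool
      Uᵥ v w = ℓ w == v
      other : ∀ v → ∃[ w ] root w ≡ true × w ≢ v
      other v with u F.≟ v
      ... | yes refl = u′ , hu′ , ne ∘ sym
      ... | no p     = u , hu , p
      each : ∀ v → (1ℚ + 1ℚ) * ⟦ root v ⟧ ≤ ⟦ root v ⟧ * cutval s t x (Uᵥ v)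
      each v = by (root v) refl
        where
        by : ∀ b → root v ≡ b → (1ℚ + 1ℚ) * ⟦ b ⟧ ≤ ⟦ b ⟧ * cutval s t x (Uᵥ v)
        by false _ = ℚP.≤-reflexive (sym (ℚP.*-zeroˡ (cutval s t x (Uᵥ v))))
        by true hv with other v
        ... | w , hw , w≢v = subst₂ _≤_ (sym (ℚP.*-identityʳ (1ℚ + 1ℚ)))
          (sym (ℚP.*-identityˡ (cutval s t x (Uᵥ v))))
          (cut (Uᵥ v) v w hv (==-≢ (λ q → w≢v (trans (sym (==⇒≡ hw)) q))))
      crossings : ∀ e → ∑ (λ v → ⟦ root v ⟧ * (⟦ cross s t (Uᵥ v) e ⟧ * x e)) ≤ (1ℚ + 1ℚ) * (⟦ S e ⟧ * x e)
      crossings e = by (S e) refl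
        where
        by : ∀ b → S e ≡ b → ∑ (λ v → ⟦ root v ⟧ * (⟦ cross s t (Uᵥ v) e ⟧ * x e)) ≤ (1ℚ + 1ℚ) * (⟦ b ⟧ * x e)
        by false h = ℚP.≤-reflexive (trans (∑-zero none)
          (sym (trans (cong ((1ℚ + 1ℚ) *_) (ℚP.*-zeroˡ (x e))) (ℚP.*-zeroʳ (1ℚ + 1ℚ)))))
          where
          none : ∀ v → ⟦ root v ⟧ * (⟦ cross s t (Uᵥ v) e ⟧ * x e) ≡ 0ℚ
          none v = trans (cong (λ c → ⟦ root v ⟧ * (⟦ c ⟧ * x e))
            (trans (cong (λ w → (w == v) xor (ℓ (t e) == v)) (Labels.constant lab e (cong not h)))
              (BP.xor-same (ℓ (t e) == v))))
            (trans (cong (⟦ root v ⟧ *_) (ℚP.*-zeroˡ (x e))) (ℚP.*-zeroʳ ⟦ root v ⟧))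
        by true h = ℚP.≤-trans (∑-mono bound)
          (ℚP.≤-reflexive (trans (∑-+ (λ v → ⟦ v == ℓ (s e) ⟧ * x e) (λ v → ⟦ v == ℓ (t e) ⟧ * x e))
            (trans (cong₂ _+_ (∑-single (ℓ (s e)) (λ _ → x e)) (∑-single (ℓ (t e)) (λ _ → x e)))
              (dbl (x e)))))
          where
          dbl : ∀ q → q + q ≡ (1ℚ + 1ℚ) * (1ℚ * q)
          dbl = solve-∀ ℚ-ring
          bound′ : ∀ r a b → ⟦ r ⟧ * (⟦ a xor b ⟧ * x e) ≤ ⟦ a ⟧ * x e + ⟦ b ⟧ * x e
          bound′ r a b = ℚP.≤-trans (drop r) (cases a b)
            where
            drop : ∀ r → ⟦ r ⟧ * (⟦ a xor b ⟧ * x e) ≤ ⟦ a xor b ⟧ * x e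
            drop true  = ℚP.≤-reflexive (ℚP.*-identityˡ _)
            drop false = subst (_≤ ⟦ a xor b ⟧ * x e) (sym (ℚP.*-zeroˡ (⟦ a xor b ⟧ * x e)))
              (0≤* (0≤⟦⟧ (a xor b)) (pos e))
            z₁ : ∀ q → 1ℚ * q ≡ 1ℚ * q + 0ℚ * q
            z₁ = solve-∀ ℚ-ring
            z₂ : ∀ q → 1ℚ * q ≡ 0ℚ * q + 1ℚ * q
            z₂ = solve-∀ ℚ-ring
            z₃ : ∀ q → 0ℚ * q ≡ 0ℚ * q + 0ℚ * q
            z₃ = solve-∀ ℚ-ring
            z₄ : ∀ q → 1ℚ * q + 1ℚ * q ≡ 0ℚ * q + (q + q)
            z₄ = solve-∀ ℚ-ring
            cases : ∀ a b → ⟦ a xor b ⟧ * x e ≤ ⟦ a ⟧ * x e + ⟦ b ⟧ * x e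
            cases true  true  = ≤-by (0≤+ (pos e) (pos e)) (z₄ (x e))
            cases true  false = ℚP.≤-reflexive (z₁ (x e))
            cases false true  = ℚP.≤-reflexive (z₂ (x e))
            cases false false = ℚP.≤-reflexive (z₃ (x e))
          bound : ∀ v → ⟦ root v ⟧ * (⟦ cross s t (Uᵥ v) e ⟧ * x e) ≤ ⟦ v == ℓ (s e) ⟧ * x e + ⟦ v == ℓ
            (t e) ⟧ * x e
          bound v = subst₂ (λ a b → ⟦ root v ⟧ * (⟦ cross s t (Uᵥ v) e ⟧ * x e) ≤ ⟦ a ⟧ * x e + ⟦ b ⟧ * x e)
            (==-sym (ℓ (s e)) v) (==-sym (ℓ (t e)) v)
            (bound′ (root v) (ℓ (s e) == v) (ℓ (t e) == v))
      twice : (1ℚ + 1ℚ) * toℚ (κ (not ∘ S)) ≤ (1ℚ + 1ℚ) * mass S x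
      twice = ℚP.≤-trans (ℚP.≤-reflexive count)
        (ℚP.≤-trans (∑-mono each) (ℚP.≤-trans (ℚP.≤-reflexive exchange)
          (ℚP.≤-trans (∑-mono crossings) (ℚP.≤-reflexive (∑-* (1ℚ + 1ℚ) (λ e → ⟦ S e ⟧ * x e))))))
        where
        count : (1ℚ + 1ℚ) * toℚ (κ (not ∘ S)) ≡ ∑ (λ v → (1ℚ + 1ℚ) * ⟦ root v ⟧)
        count = trans (cong ((1ℚ + 1ℚ) *_)
          (trans (toℚ-∑ (λ v → ⟦ root v ⟧ℕ)) (∑-cong (λ v → ⟦⟧-toℚ (root v)))))
            (sym (∑-* (1ℚ + 1ℚ) (λ v → ⟦ root v ⟧)))
        exchange : ∑ (λ v → ⟦ root v ⟧ * cutval s t x (Uᵥ v)) ≡ ∑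
          (λ e → ∑ (λ v → ⟦ root v ⟧ * (⟦ cross s t (Uᵥ v) e ⟧ * x e)))
        exchange = trans (∑-cong (λ v → sym (∑-* ⟦ root v ⟧ (λ e → ⟦ cross s t (Uᵥ v) e ⟧ * x e))))
          (∑-comm (λ v e → ⟦ root v ⟧ * (⟦ cross s t (Uᵥ v) e ⟧ * x e)))

  CutConnected : Row M → Set
  CutConnected X = ∀ U v w → U v ≡ true → U w ≡ false → ∃[ e ] X e ≡ true × cross s t U e ≡ true

  private
    uncrossed⇒ : ∀ {X : Row M} {U : Fin n → Bool} → ¬ (∃[ e ] X e ≡ true × cross s t U e ≡ true) → ∀ e → X e
      ≡ true → U (s e) ≡ U (t e)
    uncrossed⇒ h e p = xor≡false⇒ (≢true (λ c → h (e , p , c)))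

  one-label⇒connected : ∀ X → (∀ v w → component X v ≡ component X w) → CutConnected X
  one-label⇒connected X same U v w uv uw with FP.any? (λ e → (X e B.≟ true) ×-dec (cross s t U e B.≟ true))
  ... | yes r = r
  ... | no r  = ⊥-elim (true≢false uv (trans (sym (flat v)) (trans (cong U (same v w)) (trans (flat w) uw))))
    where
    flat : ∀ v → U (component X v) ≡ U v
    flat = Labels.universal (component-labels X) U (uncrossed⇒ {X} {U} r)

  one-root : ∀ {P ℓ} → Labels P ℓ → roots ℓ ℕ.≤ 1 → ∀ v w → ℓ v ≡ ℓ w
  one-root {P} {ℓ} lab few v w with ℓ v F.≟ ℓ w
  ... | yes p = p
  ... | no p  = ⊥-elim (ℕP.<-irrefl refl
    (ℕP.≤-trans (two≤size {P = λ v → ℓ v == v} p (rooted v) (rooted w)) few))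
    where
    rooted : ∀ v → (ℓ (ℓ v) == ℓ v) ≡ true
    rooted v = trans (cong (_== ℓ v) (idempotent lab v)) (==-refl (ℓ v))

  -- Take for `S` the complement of the support of `F`. It has mass zero, so its demand is at most
  -- zero, which says that the support has at most one component.
  meets-demand⇒connected : ∀ (F : Fin M → ℕ) → (∀ S → demand S ≤ mass S (λ e → toℚ (F e))) → CutConnected
    (λ e → not (does (F e ℕP.≟ 0)))
  meets-demand⇒connected F meets = one-label⇒connected X (one-root (component-labels X) few)
    where
    X S : Row M
    X e = not (does (F e ℕP.≟ 0))
    S e = does (F e ℕP.≟ 0)
    empty : ∀ (e : Fin M) → ⟦ does (F e ℕP.≟ 0) ⟧ * toℚ (F e) ≡ 0ℚ
    empty e = by (F e)
      where
      by : ∀ k → ⟦ does (k ℕP.≟ 0) ⟧ * toℚ k ≡ 0ℚ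
      by zero    = refl
      by (suc k) = ℚP.*-zeroˡ (toℚ (suc k))
    few : κ X ℕ.≤ 1
    low : demand S ≤ 0ℚ
    low = ℚP.≤-trans (meets S) (ℚP.≤-reflexive (∑-zero empty))
    few = toℚ-cancel (≤-by (0≤- low) (lem (toℚ (κ X))))
      where
      lem : ∀ k → 1ℚ ≡ k + (0ℚ - (k - 1ℚ))
      lem = solve-∀ ℚ-ring
  connected-or-cut : ∀ X → CutConnected X ⊎
    (∃[ U ] ∃[ v ] ∃[ w ] U v ≡ true × U w ≡ false × (∀ e → X e ≡ true → U (s e) ≡ U (t e)))
  connected-or-cut X with FP.any? (λ v → FP.any? (λ w → ¬? (component X v F.≟ component X w)))
  ... | yes (v , w , ne) = inj₂ ((λ u → component X u == component X v) , v , w , ==-refl (component X v) ,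
    ==-≢ (ne ∘ sym) ,
    λ e p → cong (_== component X v) (Labels.constant (component-labels X) e p))
  ... | no all = inj₁ (one-label⇒connected X same)
    where
    same : ∀ v w → component X v ≡ component X w
    same v w with component X v F.≟ component X w
    ... | yes p = p
    ... | no p  = ⊥-elim (all (v , w , p))

  -- Labels arise by joining along edges, so every node is related to its label, and
  -- cut-connectedness leaves only one label. This turns the condition on cuts into walks.
  connected⇒related : ∀ {X} → CutConnected X → (_~_ : Fin n → Fin n → Set) → (∀ {u} → u ~ u) →
    (∀ {u v} → u ~ v → v ~ u) →
    (∀ {u v w} → u ~ v → v ~ w → u ~ w) → (∀ e → X e ≡ true → s e ~ t e) → ∀ u v → u ~ v
  connected⇒related {X} conn _~_ rfl symm tran edge u v = tran
    (to (edges X) (λ m → edge _ (∈-edges⁻ {X} m)) rfl u)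
      (subst (_~ v) (sym same) (symm (to (edges X) (λ m → edge _ (∈-edges⁻ {X} m)) rfl v)))
    where
    to : ∀ L → (∀ {e} → e ∈ L → s e ~ t e) → ∀ {ℓ : Fin n → Fin n} → (∀ {v} → v ~ ℓ v) → ∀ v → v ~ joinAll ℓ
      L v
    to [] _ h v = h
    to (e ∷ L) edge {ℓ} h v = to L (edge ∘ there) (λ {v} → step v) v
      where
      step : ∀ v → v ~ join e ℓ v
      step v with ℓ v F.≟ ℓ (s e)
      ... | yes q = tran h (subst (_~ ℓ (t e)) (sym q) (tran (symm h) (tran (edge (here refl)) h)))
      ... | no _  = h
    same : component X u ≡ component X v
    same with component X u F.≟ component X v
    ... | yes p = p
    ... | no p with conn (λ w → component X w == component X u) u v (==-refl _) (==-≢ (p ∘ sym))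
    ... | e , xe , c = ⊥-elim (true≢false c
      (trans (cong (λ w → (w == component X u) xor (component X (t e) == component X u))
        (Labels.constant (component-labels X) e xe))
      (BP.xor-same (component X (t e) == component X u))))

-- Parities and multiplicities of cuts

odd-+ : ∀ a b → odd (a ℕ.+ b) ≡ odd a xor odd b
odd-+ zero    b = refl
odd-+ (suc a) b = trans (cong not (odd-+ a b)) (BP.not-distribˡ-xor (odd a) (odd b))

opaque
  unfolding ∑ℕ ⨁
  odd-∑ : ∀ {n} (f : Fin n → ℕ) → odd (∑ℕ f) ≡ ⨁ (λ i → odd (f i))
  odd-∑ {zero}  f = refl
  odd-∑ {suc n} f = trans (odd-+ (f zero) (∑ℕ (f ∘ suc))) (cong (odd (f zero) xor_) (odd-∑ (f ∘ suc)))

  xsum-tabulate : ∀ {n} {A : Set} (c : A → Bool) (h : Fin n → A) → xsum c (tabulate h) ≡ ⨁ (c ∘ h)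
  xsum-tabulate {zero}  c h = refl
  xsum-tabulate {suc n} c h = cong (c (h zero) xor_) (xsum-tabulate c (h ∘ suc))

nsum : {A : Set} → (A → ℕ) → List A → ℕ
nsum f []      = 0
nsum f (a ∷ L) = f a ℕ.+ nsum f L

nsum-cong : {A : Set} {f g : A → ℕ} {L : List A} → All (λ a → f a ≡ g a) L → nsum f L ≡ nsum g L
nsum-cong []       = refl
nsum-cong (p ∷ ps) = cong₂ ℕ._+_ p (nsum-cong ps)

odd-nsum : {A : Set} (f : A → ℕ) (L : List A) → odd (nsum f L) ≡ xsum (odd ∘ f) L
odd-nsum f []      = refl
odd-nsum f (a ∷ L) = trans (odd-+ (f a) (nsum f L)) (cong (odd (f a) xor_) (odd-nsum f L))

module _ {n M : ℕ} (s t : Fin M → Fin n) where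

  cutcount : (Fin M → ℕ) → (Fin n → Bool) → ℕ
  cutcount J U = ∑ℕ (λ e → ⟦ cross s t U e ⟧ℕ ℕ.* J e)

  odd-cutcount : ∀ J U → odd (cutcount J U) ≡ parity s t J U
  odd-cutcount J U = trans (odd-∑ (λ e → ⟦ cross s t U e ⟧ℕ ℕ.* J e))
    (⨁-cong (λ e → by (cross s t U e) (J e)))
    where
    by : ∀ b k → odd (⟦ b ⟧ℕ ℕ.* k) ≡ odd k ∧ b
    by true  k = trans (cong odd (ℕP.*-identityˡ k)) (sym (BP.∧-identityʳ (odd k)))
    by false k = sym (BP.∧-zeroʳ (odd k))

  cutcount-+ : ∀ J K U → cutcount (λ e → J e ℕ.+ K e) U ≡ cutcount J U ℕ.+ cutcount K U
  cutcount-+ J K U = trans (∑ℕ-cong (λ e → ℕP.*-distribˡ-+ ⟦ cross s t U e ⟧ℕ (J e) (K e)))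
    (∑ℕ-+ (λ e → ⟦ cross s t U e ⟧ℕ ℕ.* J e) (λ e → ⟦ cross s t U e ⟧ℕ ℕ.* K e))

  parity-+ : ∀ J K U → parity s t (λ e → J e ℕ.+ K e) U ≡ parity s t J U xor parity s t K U
  parity-+ J K U = trans (sym (odd-cutcount (λ e → J e ℕ.+ K e) U)) (trans (cong odd (cutcount-+ J K U))
    (trans (odd-+ (cutcount J U) (cutcount K U)) (cong₂ _xor_ (odd-cutcount J U) (odd-cutcount K U))))

  cutval-toℚ : ∀ J U → cutval s t (λ e → toℚ (J e)) U ≡ toℚ (cutcount J U)
  cutval-toℚ J U = sym (trans (toℚ-∑ (λ e → ⟦ cross s t U e ⟧ℕ ℕ.* J e)) (∑-cong (λ e →
    trans (toℚ-* ⟦ cross s t U e ⟧ℕ (J e)) (cong (_* toℚ (J e)) (⟦⟧-toℚ (cross s t U e))))))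

  single : Fin n → Fin n → Bool
  single v w = w == v

  -- A node set is the sum modulo two of its single nodes, and the parity of a cut is linear in the
  -- set.
  even-nodes⇒even-cuts : ∀ J → (∀ v → parity s t J (single v) ≡ false) → ∀ U → parity s t J U ≡ false
  even-nodes⇒even-cuts J even U = trans (parity-cong s t {J} decompose)
    (trans (parity-xsum s t J U single (allFin n))
      (trans (xsum-tabulate (λ v → U v ∧ parity s t J (single v)) (λ v → v))
      (⨁-zero (λ v → trans (cong (U v ∧_) (even v)) (BP.∧-zeroʳ (U v))))))
    where
    decompose : ∀ w → U w ≡ xsum (λ v → U v ∧ single v w) (allFin n)
    decompose w = sym (trans (xsum-tabulate (λ v → U v ∧ (w == v)) (λ v → v))
      (trans (⨁-cong (λ v → trans (cong (U v ∧_) (==-sym w v)) (BP.∧-comm (U v) (v == w)))) (⨁-single w U)))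

  CutConnectedBy : (Fin M → Set) → Set
  CutConnectedBy P = ∀ U v w → U v ≡ true → U w ≡ false → ∃[ e ] P e × cross s t U e ≡ true

  Flat : (Fin M → Set) → (Fin n → Bool) → Set
  Flat P U = ∀ e → P e → U (s e) ≡ U (t e)

  decide-connected : ∀ {P : Fin M → Set} → (∀ e → Dec (P e)) → CutConnectedBy P ⊎
    (∃[ U ] ∃[ v ] ∃[ w ] U v ≡ true × U w ≡ false × Flat P U)
  decide-connected {P} P? = convert (connected-or-cut s t (λ e → does (P? e)))
    where
    to : ∀ e → does (P? e) ≡ true → P e
    to e h with P? e
    ... | yes p = p
    from : ∀ e → P e → does (P? e) ≡ true
    from e p with P? e
    ... | yes _ = refl
    ... | no q  = ⊥-elim (q p)
    convert : CutConnected s t (λ e → does (P? e)) ⊎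
      (∃[ U ] ∃[ v ] ∃[ w ] U v ≡ true × U w ≡ false × (∀ e → does (P? e) ≡ true → U (s e) ≡ U (t e))) →
      CutConnectedBy P ⊎ (∃[ U ] ∃[ v ] ∃[ w ] U v ≡ true × U w ≡ false × Flat P U)
    convert (inj₁ c) = inj₁ (λ U v w a b → let (e , h , k) = c U v w a b in e , to e h , k)
    convert (inj₂ (U , v , w , a , b , flat)) = inj₂ (U , v , w , a , b , λ e p → flat e (from e p))

-- Squares

-- Turning by one corner exchanges the two pairs of opposite edges, so choosing the pair `A` of a
-- square means choosing between it and its rotation.
rotate : ∀ {n} → Quad n → Quad n
rotate (a , b , c , d) = b , c , d , a

Turned : ∀ {n} → Quad n → Quad n → Set
Turned q q′ = q′ ≡ q ⊎ q′ ≡ rotate q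

rotate-distinct : ∀ {n} {q : Quad n} → Distinct4 q → Distinct4 (rotate q)
rotate-distinct ((ab ∷ ac ∷ ad ∷ []) ∷ (bc ∷ bd ∷ []) ∷ (cd ∷ []) ∷ [] ∷ []) =
  (bc ∷ bd ∷ ab ∘ sym ∷ []) ∷ (cd ∷ ac ∘ sym ∷ []) ∷ (ad ∘ sym ∷ []) ∷ [] ∷ []

module Squares {n M : ℕ} (s t : Fin M → Fin n) (edge : Fin n → Fin n → Fin M)
  (ends : ∀ a b → a ≢ b → (s (edge a b) ≡ a × t (edge a b) ≡ b) ⊎ (s (edge a b) ≡ b × t (edge a b) ≡ a)) where

  e₁ e₂ e₃ e₄ : Quad n → Fin M
  e₁ (a , b , c , d) = edge a b
  e₂ (a , b , c , d) = edge b c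
  e₃ (a , b , c , d) = edge c d
  e₄ (a , b , c , d) = edge d a

  Has HasA : Fin M → Quad n → Set
  Has e q = e ≡ e₁ q ⊎ e ≡ e₂ q ⊎ e ≡ e₃ q ⊎ e ≡ e₄ q
  HasA e q = e ≡ e₁ q ⊎ e ≡ e₃ q

  cross-edge : ∀ {a b} → a ≢ b → ∀ U → cross s t U (edge a b) ≡ U a xor U b
  cross-edge {a} {b} ne U with ends a b ne
  ... | inj₁ (p , q) = cong₂ (λ x y → U x xor U y) p q
  ... | inj₂ (p , q) = trans (cong₂ (λ x y → U x xor U y) p q) (BP.xor-comm (U b) (U a))

  private
    -- Exactly one of the two edges crosses the cut around `x`.
    separated : ∀ {a b u v} x → a ≢ b → u ≢ v → (a == x) xor (b == x) ≡ true → u ≢ x → v ≢ x → edge a b ≢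
      edge u v
    separated {a} {b} {u} {v} x ab uv h ux vx eq = true≢false
      (trans (cross-edge ab (_== x)) h)
      (trans (cong (cross s t (_== x)) eq) (trans (cross-edge uv (_== x)) (cong₂ _xor_ (==-≢ ux) (==-≢ vx))))

  edge-≢ˡ : ∀ {a b u v} → a ≢ b → u ≢ v → a ≢ u → a ≢ v → edge a b ≢ edge u v
  edge-≢ˡ {a} ab uv au av = separated a ab uv (cong₂ _xor_ (==-refl a) (==-≢ (ab ∘ sym))) (au ∘ sym)
    (av ∘ sym)

  edge-≢ʳ : ∀ {a b u v} → a ≢ b → u ≢ v → b ≢ u → b ≢ v → edge a b ≢ edge u v
  edge-≢ʳ {a} {b} ab uv bu bv = separated b ab uv (cong₂ _xor_ (==-≢ ab) (==-refl b)) (bu ∘ sym) (bv ∘ sym)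

  countA countB : Quad n → Fin M → ℕ
  countA q e = ⟦ e == e₁ q ⟧ℕ ℕ.+ ⟦ e == e₃ q ⟧ℕ
  countB q e = ⟦ e == e₂ q ⟧ℕ ℕ.+ ⟦ e == e₄ q ⟧ℕ

  totalA totalB : List (Quad n) → Fin M → ℕ
  totalA L e = nsum (λ q → countA q e) L
  totalB L e = nsum (λ q → countB q e) L

  weigh : ∀ (f : Fin M → ℕ) (p r : Quad n → Fin M) L →
    ∑ℕ (λ e → f e ℕ.* nsum (λ q → ⟦ e == p q ⟧ℕ ℕ.+ ⟦ e == r q ⟧ℕ) L) ≡ nsum (λ q → f (p q) ℕ.+ f (r q)) L
  weigh f p r [] = ∑ℕ-zero (λ e → ℕP.*-zeroʳ (f e))
  weigh f p r (q ∷ L) = trans (∑ℕ-cong pt)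
    (trans (∑ℕ-+ (λ e → ⟦ e == p q ⟧ℕ ℕ.* f e ℕ.+ ⟦ e == r q ⟧ℕ ℕ.* f e) _)
      (cong₂ ℕ._+_ (trans (∑ℕ-+ (λ e → ⟦ e == p q ⟧ℕ ℕ.* f e) (λ e → ⟦ e == r q ⟧ℕ ℕ.* f e))
        (cong₂ ℕ._+_ (∑ℕ-single (p q) f) (∑ℕ-single (r q) f)))
        (weigh f p r L)))
    where
    pt : ∀ e → f e ℕ.* (⟦ e == p q ⟧ℕ ℕ.+ ⟦ e == r q ⟧ℕ ℕ.+ nsum (λ q → ⟦ e == p q ⟧ℕ ℕ.+ ⟦ e == r q ⟧ℕ) L) ≡
      ⟦ e == p q ⟧ℕ ℕ.* f e ℕ.+ ⟦ e == r q ⟧ℕ ℕ.* f e ℕ.+ f e ℕ.* nsum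
        (λ q → ⟦ e == p q ⟧ℕ ℕ.+ ⟦ e == r q ⟧ℕ) L
    pt e = trans (ℕP.*-distribˡ-+ (f e) (⟦ e == p q ⟧ℕ ℕ.+ ⟦ e == r q ⟧ℕ) _)
      (cong (ℕ._+ (f e ℕ.* nsum (λ q → ⟦ e == p q ⟧ℕ ℕ.+ ⟦ e == r q ⟧ℕ) L))
        (trans (ℕP.*-comm (f e) (⟦ e == p q ⟧ℕ ℕ.+ ⟦ e == r q ⟧ℕ))
          (ℕP.*-distribʳ-+ (f e) ⟦ e == p q ⟧ℕ ⟦ e == r q ⟧ℕ)))

  cutA : ∀ L U → cutcount s t (totalA L) U ≡ nsum
    (λ q → ⟦ cross s t U (e₁ q) ⟧ℕ ℕ.+ ⟦ cross s t U (e₃ q) ⟧ℕ) L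
  cutA L U = weigh (λ e → ⟦ cross s t U e ⟧ℕ) e₁ e₃ L

  cutB : ∀ L U → cutcount s t (totalB L) U ≡ nsum
    (λ q → ⟦ cross s t U (e₂ q) ⟧ℕ ℕ.+ ⟦ cross s t U (e₄ q) ⟧ℕ) L
  cutB L U = weigh (λ e → ⟦ cross s t U e ⟧ℕ) e₂ e₄ L

  -- The parity of the number of corners in `U`. Either pair of opposite edges covers every corner
  -- once, so this is also the parity of its intersection with the cut, whichever pair is chosen.
  quadParity : (Fin n → Bool) → Quad n → Bool
  quadParity U (a , b , c , d) = (U a xor U b) xor (U c xor U d)

  private
    odd-two : ∀ a b → odd (⟦ a ⟧ℕ ℕ.+ ⟦ b ⟧ℕ) ≡ a xor b
    odd-two true  true  = refl
    odd-two true  false = refl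
    odd-two false true  = refl
    odd-two false false = refl

  crossA-parity : ∀ {q} → Distinct4 q → ∀ U → cross s t U (e₁ q) xor cross s t U (e₃ q) ≡ quadParity U q
  crossA-parity ((ab ∷ _) ∷ _ ∷ (cd ∷ []) ∷ _) U = cong₂ _xor_ (cross-edge ab U) (cross-edge cd U)

  parityA : ∀ {L} → All Distinct4 L → ∀ U → parity s t (totalA L) U ≡ xsum (quadParity U) L
  parityA {L} dist U = trans (sym (odd-cutcount s t (totalA L) U)) (trans (cong odd (cutA L U))
    (trans (odd-nsum (λ q → ⟦ cross s t U (e₁ q) ⟧ℕ ℕ.+ ⟦ cross s t U (e₃ q) ⟧ℕ) L)
      (xsum-cong (All.map (λ {q} h → trans (odd-two (cross s t U (e₁ q)) (cross s t U (e₃ q)))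
        (crossA-parity h U)) dist))))

  private
    disjoint-xor : ∀ {n} {a b : Fin n} v → a ≢ b → ⟦ (a == v) xor (b == v) ⟧ℕ ≡ ⟦ a == v ⟧ℕ ℕ.+ ⟦ b == v ⟧ℕ
    disjoint-xor {a = a} {b} v ne with a F.≟ v | b F.≟ v
    ... | yes refl | yes refl = ⊥-elim (ne refl)
    ... | yes _ | no _ = refl
    ... | no _ | yes _ = refl
    ... | no _ | no _ = refl

  -- Each corner of a square lies on one edge of `A` and on one edge of `B`.
  balanced : ∀ {L} → All Distinct4 L → ∀ v → cutcount s t (totalA L) (single s t v) ≡ cutcount s t
    (totalB L) (single s t v)
  balanced {L} dist v = trans (cutA L (single s t v))
    (trans (nsum-cong (All.map (λ {q} → pt q) dist)) (sym (cutB L (single s t v))))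
    where
    at : ∀ {a b} → a ≢ b → ⟦ cross s t (single s t v) (edge a b) ⟧ℕ ≡ ⟦ a == v ⟧ℕ ℕ.+ ⟦ b == v ⟧ℕ
    at ne = trans (cong ⟦_⟧ℕ (cross-edge ne (single s t v))) (disjoint-xor v ne)
    shuffle : ∀ a b c d → (a ℕ.+ b) ℕ.+ (c ℕ.+ d) ≡ (b ℕ.+ c) ℕ.+ (d ℕ.+ a)
    shuffle = NS.solve-∀
    pt : ∀ q → Distinct4 q → ⟦ cross s t (single s t v) (e₁ q) ⟧ℕ ℕ.+ ⟦ cross s t (single s t v) (e₃ q) ⟧ℕ ≡
      ⟦ cross s t (single s t v) (e₂ q) ⟧ℕ ℕ.+ ⟦ cross s t (single s t v) (e₄ q) ⟧ℕ
    pt (a , b , c , d) ((ab ∷ ac ∷ ad ∷ []) ∷ (bc ∷ bd ∷ []) ∷ (cd ∷ []) ∷ _) =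
      trans (cong₂ ℕ._+_ (at ab) (at cd)) (trans (shuffle ⟦ a == v ⟧ℕ ⟦ b == v ⟧ℕ ⟦ c == v ⟧ℕ ⟦ d == v ⟧ℕ)
        (sym (cong₂ ℕ._+_ (at bc) (at (ad ∘ sym)))))

  -- Orienting the squares one at a time so that the graph stays connected

  module _ (one : Row M) where

    -- The graph midway through the orientation: finished squares keep only their pair `A`, the
    -- others still have all four edges.
    Present : List (Quad n) → List (Quad n) → Fin M → Set
    Present done todo e = one e ≡ true ⊎ Any (HasA e) done ⊎ Any (Has e) todo

    hasA? : ∀ e q → Dec (HasA e q)
    hasA? e q = (e F.≟ e₁ q) ⊎-dec (e F.≟ e₃ q)

    has? : ∀ e q → Dec (Has e q)
    has? e q = (e F.≟ e₁ q) ⊎-dec ((e F.≟ e₂ q) ⊎-dec ((e F.≟ e₃ q) ⊎-dec (e F.≟ e₄ q)))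

    present? : ∀ done todo e → Dec (Present done todo e)
    present? done todo e = (one e B.≟ true) ⊎-dec (Any.any? (hasA? e) done ⊎-dec Any.any? (has? e) todo)

    private
      flat-quad : ∀ {q U} → Distinct4 q → U (s (e₁ q)) ≡ U (t (e₁ q)) → U (s (e₃ q)) ≡ U (t (e₃ q)) →
        quadParity U q ≡ false
      flat-quad {q} {U} h p r = trans (sym (crossA-parity {q} h U))
        (cong₂ _xor_ (flat (U (s (e₁ q))) p) (flat (U (s (e₃ q))) r))
        where
        flat : ∀ a {b} → a ≡ b → a xor b ≡ false
        flat a refl = BP.xor-same a

      xsum-zero : ∀ {A : Set} {c : A → Bool} L → (∀ {q} → q ∈ L → c q ≡ false) → xsum c L ≡ false
      xsum-zero []      h = refl
      xsum-zero (q ∷ L) h = cong₂ _xor_ (h (here refl)) (xsum-zero L (h ∘ there))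

    -- Evenness of `one` together with one pair of every square. Counting corners states it
    -- independently of the choice of pairs, so it survives every turn.
    Even : List (Quad n) → List (Quad n) → Set
    Even done todo = ∀ U → parity s t (λ e → ⟦ one e ⟧ℕ) U ≡ xsum (quadParity U) done xor xsum
      (quadParity U) todo

    rotate-parity : ∀ q U → quadParity U (rotate q) ≡ quadParity U q
    rotate-parity (a , b , c , d) U = by (U a) (U b) (U c) (U d)
      where
      by : ∀ a b c d → (b xor c) xor (d xor a) ≡ (a xor b) xor (c xor d)
      by true  true  true  true  = refl
      by true  true  true  false = refl
      by true  true  false true  = refl
      by true  true  false false = refl
      by true  false true  true  = refl
      by true  false true  false = refl
      by true  false false true  = refl
      by true  false false false = refl
      by false true  true  true  = refl
      by false true  true  false = refl
      by false true  false true  = refl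
      by false true  false false = refl
      by false false true  true  = refl
      by false false true  false = refl
      by false false false true  = refl
      by false false false false = refl

    -- If both orientations disconnect, by cuts U and U′, then U ∩ U′ is an odd cut meeting one corner of q.
    private
      both-fail : ∀ {done q todo} → Even done (q ∷ todo) → Distinct4 q → All Distinct4 done → All Distinct4
        todo →
        CutConnectedBy s t (Present done (q ∷ todo)) →
        ∀ {U v w U′ v′ w′} → U v ≡ true → U w ≡ false → Flat s t (Present (q ∷ done) todo) U →
        U′ v′ ≡ true → U′ w′ ≡ false → Flat s t (Present (rotate q ∷ done) todo) U′ → ⊥
      both-fail {done} {q@(a , b , c , d)} {todo} even
        dq@((ab ∷ ac ∷ ad ∷ []) ∷ (bc ∷ bd ∷ []) ∷ (cd ∷ []) ∷ _) dd dt conn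
        {U} {v} {w} {U′} {v′} {w′} uv uw flat uv′ uw′ flat′ =
        true≢false corner (trans (sym rest-zero) (trans (sym (even X)) ones-zero))
        where
        X : Fin n → Bool
        X u = U u ∧ U′ u
        same-edge : ∀ {a b} → a ≢ b → ∀ U → U (s (edge a b)) ≡ U (t (edge a b)) → U a ≡ U b
        same-edge {a} {b} ne U h = xor≡false⇒
          (trans (sym (cross-edge ne U))
            (trans (cong (_xor U (t (edge a b))) h) (BP.xor-same (U (t (edge a b))))))
        Uab = same-edge ab U (flat _ (inj₂ (inj₁ (here (inj₁ refl)))))
        Ucd = same-edge cd U (flat _ (inj₂ (inj₁ (here (inj₂ refl)))))
        Ubc′ = same-edge bc U′ (flat′ _ (inj₂ (inj₁ (here (inj₁ refl)))))
        Uda′ = same-edge (ad ∘ sym) U′ (flat′ _ (inj₂ (inj₁ (here (inj₂ refl)))))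
        uncrossed : ∀ (U : Fin n → Bool) e → U (s e) ≡ U (t e) → cross s t U e ≡ true → ⊥
        uncrossed U e h k = true≢false k (trans (cong (_xor U (t e)) h) (BP.xor-same (U (t e))))
        crossed : ∀ {a b} → a ≢ b → ∀ U → cross s t U (edge a b) ≡ true → U a ≢ U b
        crossed {a} {b} ne U h eq = true≢false (trans (sym (cross-edge ne U)) h)
          (trans (cong (_xor U b) eq) (BP.xor-same (U b)))
        -- Otherwise `U` would be constant on all four corners as well and would disconnect the
        -- graph before this square is oriented.
        Uac : U a ≢ U c
        Uac eq with conn U v w uv uw
        ... | e , inj₁ o , k = uncrossed U e (flat e (inj₁ o)) k
        ... | e , inj₂ (inj₁ m) , k = uncrossed U e (flat e (inj₂ (inj₁ (there m)))) k
        ... | e , inj₂ (inj₂ (there m)) , k = uncrossed U e (flat e (inj₂ (inj₂ m))) k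
        ... | e , inj₂ (inj₂ (here (inj₁ p))) , k = uncrossed U e (flat e (inj₂ (inj₁ (here (inj₁ p))))) k
        ... | e , inj₂ (inj₂ (here (inj₂ (inj₁ refl)))) , k = crossed bc U k (trans (sym Uab) eq)
        ... | e , inj₂ (inj₂ (here (inj₂ (inj₂ (inj₁ p))))) , k = uncrossed U e
          (flat e (inj₂ (inj₁ (here (inj₂ p))))) k
        ... | e , inj₂ (inj₂ (here (inj₂ (inj₂ (inj₂ refl))))) , k = crossed (ad ∘ sym) U k
          (trans (sym Ucd) (sym eq))
        Uab′ : U′ a ≢ U′ b
        Uab′ eq with conn U′ v′ w′ uv′ uw′
        ... | e , inj₁ o , k = uncrossed U′ e (flat′ e (inj₁ o)) k
        ... | e , inj₂ (inj₁ m) , k = uncrossed U′ e (flat′ e (inj₂ (inj₁ (there m)))) k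
        ... | e , inj₂ (inj₂ (there m)) , k = uncrossed U′ e (flat′ e (inj₂ (inj₂ m))) k
        ... | e , inj₂ (inj₂ (here (inj₁ refl))) , k = crossed ab U′ k eq
        ... | e , inj₂ (inj₂ (here (inj₂ (inj₁ p)))) , k = uncrossed U′ e
          (flat′ e (inj₂ (inj₁ (here (inj₁ p))))) k
        ... | e , inj₂ (inj₂ (here (inj₂ (inj₂ (inj₁ refl))))) , k = crossed cd U′ k
          (trans (sym Ubc′) (trans (sym eq) (sym Uda′)))
        ... | e , inj₂ (inj₂ (here (inj₂ (inj₂ (inj₂ p))))) , k = uncrossed U′ e
          (flat′ e (inj₂ (inj₁ (here (inj₂ p))))) k
        flatX : ∀ e → Present done todo e → X (s e) ≡ X (t e)
        flatX e (inj₁ o)        = cong₂ _∧_ (flat e (inj₁ o)) (flat′ e (inj₁ o))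
        flatX e (inj₂ (inj₁ m)) = cong₂ _∧_ (flat e (inj₂ (inj₁ (there m)))) (flat′ e (inj₂ (inj₁ (there m))))
        flatX e (inj₂ (inj₂ m)) = cong₂ _∧_ (flat e (inj₂ (inj₂ m))) (flat′ e (inj₂ (inj₂ m)))
        table : ∀ p p′ r r′ → p ≢ p′ → r ≢ r′ → ((p ∧ r) xor (p ∧ r′)) xor ((p′ ∧ r′) xor (p′ ∧ r)) ≡ true
        table true  true  _ _ h _ = ⊥-elim (h refl)
        table false false _ _ h _ = ⊥-elim (h refl)
        table _ _ true  true  _ h = ⊥-elim (h refl)
        table _ _ false false _ h = ⊥-elim (h refl)
        table true  false true  false _ _ = refl
        table true  false false true  _ _ = refl
        table false true  true  false _ _ = refl
        table false true  false true  _ _ = refl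
        -- `U` pairs the corners as ab and cd, `U′` as bc and da, and each separates its two pairs,
        -- so the intersection contains exactly one corner.
        corner : quadParity X q ≡ true
        corner = trans (cong₂ (λ x y → ((U a ∧ U′ a) xor (x ∧ U′ b)) xor ((U c ∧ y) xor (U d ∧ U′ d)))
          (sym Uab) (sym Ubc′))
          (trans (cong₂ (λ x y → ((U a ∧ U′ a) xor (U a ∧ U′ b)) xor ((U c ∧ U′ b) xor (x ∧ y))) (sym Ucd)
            Uda′) (table (U a) (U c) (U′ a) (U′ b) Uac Uab′))
        done-zero : xsum (quadParity X) done ≡ false
        done-zero = xsum-zero done (λ {r} m → flat-quad {r} {X} (All.lookup dd m)
          (flatX _ (inj₂ (inj₁ (Any.map (λ { refl → inj₁ refl }) m))))
            (flatX _ (inj₂ (inj₁ (Any.map (λ { refl → inj₂ refl }) m)))))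
        todo-zero : xsum (quadParity X) todo ≡ false
        todo-zero = xsum-zero todo (λ {r} m → flat-quad {r} {X} (All.lookup dt m)
          (flatX _ (inj₂ (inj₂ (Any.map (λ { refl → inj₁ refl }) m))))
            (flatX _ (inj₂ (inj₂ (Any.map (λ { refl → inj₂ (inj₂ (inj₁ refl)) }) m)))))
        rest-zero : xsum (quadParity X) done xor xsum (quadParity X) (q ∷ todo) ≡ quadParity X q
        rest-zero = trans (cong₂ (λ x y → x xor (quadParity X q xor y)) done-zero todo-zero)
          (BP.xor-identityʳ (quadParity X q))
        ones-zero : parity s t (λ e → ⟦ one e ⟧ℕ) X ≡ false
        ones-zero = ⨁-zero pt
          where
          pt : ∀ e → odd ⟦ one e ⟧ℕ ∧ cross s t X e ≡ false
          pt e with one e in eq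
          ... | false = refl
          ... | true  = trans (cong (_xor X (t e)) (flatX e (inj₁ eq))) (BP.xor-same (X (t e)))

    orient : ∀ done todo → Even done todo → All Distinct4 done → All Distinct4 todo → CutConnectedBy s t
      (Present done todo) →
      ∃[ todo′ ] Pointwise Turned todo todo′ × CutConnectedBy s t
        (λ e → one e ≡ true ⊎ Any (HasA e) done ⊎ Any (HasA e) todo′)
    orient done [] even dd dt conn = [] , [] , λ U v w a b → let (e , p , k) = conn U v w a b in e , weaken p , k
      where
      weaken : ∀ {e} → Present done [] e → one e ≡ true ⊎ Any (HasA e) done ⊎ Any (HasA e) []
      weaken (inj₁ o) = inj₁ o
      weaken (inj₂ (inj₁ m)) = inj₂ (inj₁ m)
    orient done (q ∷ todo) even dd (dq ∷ dt) conn =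
      try (decide-connected s t (present? (q ∷ done) todo))
        (decide-connected s t (present? (rotate q ∷ done) todo))
      where
      Result : Set
      Result = ∃[ todo′ ] Pointwise Turned (q ∷ todo) todo′ × CutConnectedBy s t
        (λ e → one e ≡ true ⊎ Any (HasA e) done ⊎ Any (HasA e) todo′)
      Outcome : Quad n → Set
      Outcome r = CutConnectedBy s t (Present (r ∷ done) todo) ⊎
        (∃[ U ] ∃[ v ] ∃[ w ] U v ≡ true × U w ≡ false × Flat s t (Present (r ∷ done) todo) U)
      move : ∀ {a b c} → a xor (b xor c) ≡ (b xor a) xor c
      move {a} {b} {c} = trans (sym (BP.xor-assoc a b c)) (cong (_xor c) (BP.xor-comm a b))
      shift : ∀ r → Turned q r → Even (r ∷ done) todo
      shift r turned U = trans (even U)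
        (trans (move {xsum (quadParity U) done} {quadParity U q})
          (cong (λ b → (b xor xsum (quadParity U) done) xor xsum (quadParity U) todo) (sym (same turned))))
        where
        same : Turned q r → quadParity U r ≡ quadParity U q
        same (inj₁ refl) = refl
        same (inj₂ refl) = rotate-parity q U
      continue : ∀ r → Turned q r → Distinct4 r → CutConnectedBy s t (Present (r ∷ done) todo) → Result
      continue r turned dr c with orient (r ∷ done) todo (shift r turned) (dr ∷ dd) dt c
      ... | todo′ , rel , conn′ = r ∷ todo′ , turned ∷ rel , λ U v w a b → let (e , p , k) = conn′ U v w a b in e , regroup p , k
        where
        regroup : ∀ {e} → one e ≡ true ⊎ Any (HasA e) (r ∷ done) ⊎ Any (HasA e) todo′ → one e ≡ true ⊎ Any
          (HasA e) done ⊎ Any (HasA e) (r ∷ todo′)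
        regroup (inj₁ o) = inj₁ o
        regroup (inj₂ (inj₁ (here h))) = inj₂ (inj₂ (here h))
        regroup (inj₂ (inj₁ (there m))) = inj₂ (inj₁ m)
        regroup (inj₂ (inj₂ m)) = inj₂ (inj₂ (there m))
      try : Outcome q → Outcome (rotate q) → Result
      try (inj₁ c) _ = continue q (inj₁ refl) dq c
      try (inj₂ _) (inj₁ c) = continue (rotate q) (inj₂ refl) (rotate-distinct {q = q} dq) c
      try (inj₂ (U , v , w , a , b , f)) (inj₂ (U′ , v′ , w′ , a′ , b′ , f′)) = ⊥-elim
        (both-fail {done} {q} {todo} even dq dd dt conn {U} {v} {w} {U′} {v′} {w′} a b f a′ b′ f′)

-- Each F of the outer combination is replaced by the combination of all F + J, with J from its own
-- inner combination. Every F pays for `z` in proportion to its weight, which adds `w * z` in total.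
cone-bind : ∀ {M} {G K : (Fin M → ℕ) → Set} {H : (Fin M → ℕ) → (Fin M → ℕ) → Set} {z : Vec M} →
  (∀ e → 0ℚ ≤ z e) →
  (∀ {F} → G F → Cone (H F) 1ℚ z) → (∀ {F J} → G F → H F J → K (λ e → F e ℕ.+ J e)) →
  ∀ {w v} → Cone G w v → Cone K w (λ e → v e + w * z e)
cone-bind {M} {G} {K} {H} {z} z≥0 inner combine = go
  where
  translate : ∀ {F} → G F → ∀ {u β} → Cone (H F) u β → Cone K u (λ e → u * toℚ (F e) + β e)
  translate {F} g (nil {v} h) = nil (λ e → subst (0ℚ ≤_) (lem (toℚ (F e)) (v e)) (h e))
    where
    lem : ∀ f v → v ≡ 0ℚ * f + v
    lem = solve-∀ ℚ-ring
  translate {F} g (cons {u} {v} {u′} {v′} c J p h C q below) = cons c (λ e → F e ℕ.+ J e) p (combine g h)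
    (translate g C) q bound
    where
    lem : ∀ c f j u v → c * (f + j) + (u * f + v) ≡ (c + u) * f + (c * j + v)
    lem = solve-∀ ℚ-ring
    bound : ∀ e → c * toℚ (F e ℕ.+ J e) + (u′ * toℚ (F e) + v′ e) ≤ u * toℚ (F e) + v e
    bound e = subst (_≤ u * toℚ (F e) + v e)
      (sym (trans (cong (λ k → c * k + (u′ * toℚ (F e) + v′ e)) (toℚ-+ (F e) (J e)))
        (trans (lem c (toℚ (F e)) (toℚ (J e)) u′ (v′ e))
          (cong (λ k → k * toℚ (F e) + (c * toℚ (J e) + v′ e)) (sym q)))))
      (ℚP.+-monoʳ-≤ (u * toℚ (F e)) (below e))
  go : ∀ {w v} → Cone G w v → Cone K w (λ e → v e + w * z e)
  go (nil {v} h) = nil (λ e → subst (0ℚ ≤_) (lem (v e) (z e)) (h e))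
    where
    lem : ∀ v z → v ≡ v + 0ℚ * z
    lem = solve-∀ ℚ-ring
  go (cons {w} {v} {w′} {v′} c F p g C q below) = subst (λ u → Cone K u (λ e → v e + w * z e))
    (trans (cong (_+ w′) (ℚP.*-identityʳ c)) (sym q))
    (cone-up (cone-++ (cone-scale c p (translate g (inner g))) (go C)) bound)
    where
    lem : ∀ c f z v w → c * (1ℚ * f + z) + (v + w * z) ≡ c * f + v + (c + w) * z
    lem = solve-∀ ℚ-ring
    bound : ∀ e → c * (1ℚ * toℚ (F e) + z e) + (v′ e + w′ * z e) ≤ v e + w * z e
    bound e = subst (_≤ v e + w * z e)
      (sym (trans (lem c (toℚ (F e)) (z e) (v′ e) w′) (cong (λ u → c * toℚ (F e) + v′ e + u * z e) (sym q))))
      (ℚP.+-monoˡ-≤ (w * z e) (below e))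

-- Arithmetic of even cuts

even≥1⇒≥2 : ∀ {h} → odd h ≡ false → 1 ℕ.≤ h → 2 ℕ.≤ h
even≥1⇒≥2 {suc (suc h)} _ _ = ℕ.s≤s (ℕ.s≤s ℕ.z≤n)
even≥1⇒≥2 {suc zero} () _

even≥3⇒≥4 : ∀ {h} → odd h ≡ false → 3 ℕ.≤ h → 4 ℕ.≤ h
even≥3⇒≥4 {suc (suc h)} e (ℕ.s≤s (ℕ.s≤s p)) =
  ℕ.s≤s (ℕ.s≤s (even≥1⇒≥2 (trans (sym (BP.not-involutive (odd h))) e) p))

even≥5⇒≥6 : ∀ {h} → odd h ≡ false → 5 ℕ.≤ h → 6 ℕ.≤ h
even≥5⇒≥6 {suc (suc h)} e (ℕ.s≤s (ℕ.s≤s p)) =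
  ℕ.s≤s (ℕ.s≤s (even≥3⇒≥4 (trans (sym (BP.not-involutive (odd h))) e) p))

-- Six times the join weight of a cut is h + 2j, where h = k + a is its intersection with the
-- Hamiltonian cycle and j = k + b; twice its x-weight is h + j.
cut-arithmetic : ∀ k a b → 4 ℕ.≤ k ℕ.+ a ℕ.+ (k ℕ.+ b) → odd (k ℕ.+ a) ≡ false → 1 ℕ.≤ k ℕ.+ a →
  6 ℕ.≤ (k ℕ.+ a) ℕ.+ 2 ℕ.* (k ℕ.+ b) ⊎ (k ≡ 0 × b ≡ 0 × a ≡ 4)
cut-arithmetic k a b four even pos = by (k ℕ.+ b) refl
  where
  by : ∀ j → k ℕ.+ b ≡ j → 6 ℕ.≤ (k ℕ.+ a) ℕ.+ 2 ℕ.* (k ℕ.+ b) ⊎ (k ≡ 0 × b ≡ 0 × a ≡ 4)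
  by (suc (suc j)) eq = inj₁ (ℕP.+-mono-≤ (even≥1⇒≥2 even pos)
    (ℕP.*-monoʳ-≤ 2 (subst (2 ℕ.≤_) (sym eq) (ℕ.s≤s (ℕ.s≤s ℕ.z≤n)))))
  by (suc zero) eq = inj₁ (ℕP.+-mono-≤
    (even≥3⇒≥4 even (ℕP.+-cancelʳ-≤ 1 3 (k ℕ.+ a) (subst (λ j → 4 ℕ.≤ k ℕ.+ a ℕ.+ j) eq four)))
    (ℕP.*-monoʳ-≤ 2 (subst (1 ℕ.≤_) (sym eq) ℕP.≤-refl)))
  by zero eq with ℕP.m+n≡0⇒m≡0 k eq | ℕP.m+n≡0⇒n≡0 k eq
  ... | refl | refl with ℕP.m≤n⇒m<n∨m≡n (subst (4 ℕ.≤_) (ℕP.+-identityʳ a) four)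
  ... | inj₁ lt = inj₁ (ℕP.≤-trans (even≥5⇒≥6 even lt) (ℕP.m≤m+n a 0))
  ... | inj₂ r  = inj₂ (refl , refl , sym r)

incidence-nsum : ∀ {M} {A : Set} (g : A → Row M) (L : List A) e → incidence (map g L) e ≡ nsum
  (λ a → ⟦ g a e ⟧ℕ) L
incidence-nsum g []      e = refl
incidence-nsum g (a ∷ L) e = cong (⟦ g a e ⟧ℕ ℕ.+_) (incidence-nsum g L e)

nsum-mono : {A : Set} {f g : A → ℕ} (L : List A) → (∀ a → f a ℕ.≤ g a) → nsum f L ℕ.≤ nsum g L
nsum-mono []      h = ℕ.z≤n
nsum-mono (a ∷ L) h = ℕP.+-mono-≤ (h a) (nsum-mono L h)

nsum-+ : {A : Set} (f g : A → ℕ) (L : List A) → nsum (λ a → f a ℕ.+ g a) L ≡ nsum f L ℕ.+ nsum g L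
nsum-+ f g []      = refl
nsum-+ f g (a ∷ L) = trans (cong (f a ℕ.+ g a ℕ.+_) (nsum-+ f g L))
  (shuffle (f a) (g a) (nsum f L) (nsum g L))
  where
  shuffle : ∀ a b c d → a ℕ.+ b ℕ.+ (c ℕ.+ d) ≡ a ℕ.+ c ℕ.+ (b ℕ.+ d)
  shuffle = NS.solve-∀

-- Decomposition of a square point with oriented squares

module SquarePoints {n M : ℕ} (s t : Fin M → Fin n) (edge : Fin n → Fin n → Fin M)
  (ends : ∀ a b → a ≢ b → (s (edge a b) ≡ a × t (edge a b) ≡ b) ⊎ (s (edge a b) ≡ b × t (edge a b) ≡ a)) where

  open Squares s t edge ends

  private
    node-edge : ∀ {e q} → Distinct4 q → Has e q → ∃[ u ] ∃[ v ] (u ∈ quadNodes q × v ∈ quadNodes q) × u ≢ v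
      × e ≡ edge u v
    node-edge ((ab ∷ ac ∷ ad ∷ []) ∷ (bc ∷ bd ∷ []) ∷ (cd ∷ []) ∷ _) (inj₁ p) = _ , _ ,
      (here refl , there (here refl)) , ab , p
    node-edge ((ab ∷ ac ∷ ad ∷ []) ∷ (bc ∷ bd ∷ []) ∷ (cd ∷ []) ∷ _) (inj₂ (inj₁ p)) = _ , _ ,
      (there (here refl) , there (there (here refl))) , bc , p
    node-edge ((ab ∷ ac ∷ ad ∷ []) ∷ (bc ∷ bd ∷ []) ∷ (cd ∷ []) ∷ _) (inj₂ (inj₂ (inj₁ p))) = _ , _ ,
      (there (there (here refl)) , there (there (there (here refl)))) , cd , p
    node-edge ((ab ∷ ac ∷ ad ∷ []) ∷ (bc ∷ bd ∷ []) ∷ (cd ∷ []) ∷ _) (inj₂ (inj₂ (inj₂ p))) = _ , _ ,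
      (there (there (there (here refl))) , here refl) , ad ∘ sym , p

  disjoint-edges : ∀ {e q r} → Distinct4 q → Distinct4 r → NodeDisjoint q r → Has e q → ¬ Has e r
  disjoint-edges {e} {q} {r} dq dr nd h h′ with node-edge {q = q} dq h | node-edge {q = r} dr h′
  ... | u , v , (uq , _) , uv , p | u′ , v′ , (ur , vr) , uv′ , p′ =
    edge-≢ˡ uv uv′ (All.lookup (All.lookup nd uq) ur) (All.lookup (All.lookup nd uq) vr) (trans (sym p) p′)

  private
    opposite-≢ : ∀ {q} → Distinct4 q → e₁ q ≢ e₃ q
    opposite-≢ ((ab ∷ ac ∷ ad ∷ []) ∷ (bc ∷ bd ∷ []) ∷ (cd ∷ []) ∷ _) = edge-≢ˡ ab cd ac ad

    count : Quad n → Fin M → ℕ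
    count q e = countA q e ℕ.+ countB q e

    indicator≡ : ∀ {i j : Fin M} → i ≢ j → ⟦ i == j ⟧ℕ ≡ 0
    indicator≡ h = cong ⟦_⟧ℕ (==-≢ h)

    indicator-refl : ∀ (i : Fin M) → ⟦ i == i ⟧ℕ ≡ 1
    indicator-refl i = cong ⟦_⟧ℕ (==-refl i)

    sum4 : ∀ {a a′ b b′ c c′ d d′ : ℕ} → a ≡ a′ → b ≡ b′ → c ≡ c′ → d ≡ d′ → (a ℕ.+ b) ℕ.+ (c ℕ.+ d) ≡
      (a′ ℕ.+ b′) ℕ.+ (c′ ℕ.+ d′)
    sum4 refl refl refl refl = refl

    count-has : ∀ {e q} → Distinct4 q → Has e q → count q e ≡ 1
    count-has {q = a , b , c , d} ((ab ∷ ac ∷ ad ∷ []) ∷ (bc ∷ bd ∷ []) ∷ (cd ∷ []) ∷ _) (inj₁ refl) = sum4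
      (indicator-refl (edge a b))
      (indicator≡ (edge-≢ˡ ab cd ac ad)) (indicator≡ (edge-≢ˡ ab bc ab ac))
        (indicator≡ (edge-≢ʳ ab (ad ∘ sym) bd (ab ∘ sym)))
    count-has {q = a , b , c , d} ((ab ∷ ac ∷ ad ∷ []) ∷ (bc ∷ bd ∷ []) ∷ (cd ∷ []) ∷ _) (inj₂ (inj₁ refl))
      = sum4 (indicator≡ (edge-≢ʳ bc ab (ac ∘ sym) (bc ∘ sym)))
      (indicator≡ (edge-≢ˡ bc cd bc bd)) (indicator-refl (edge b c))
        (indicator≡ (edge-≢ˡ bc (ad ∘ sym) bd (ab ∘ sym)))
    count-has {q = a , b , c , d} ((ab ∷ ac ∷ ad ∷ []) ∷ (bc ∷ bd ∷ []) ∷ (cd ∷ []) ∷ _)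
      (inj₂ (inj₂ (inj₁ refl))) = sum4 (indicator≡ (edge-≢ˡ cd ab (ac ∘ sym) (bc ∘ sym)))
      (indicator-refl (edge c d)) (indicator≡ (edge-≢ʳ cd bc (bd ∘ sym) (cd ∘ sym)))
        (indicator≡ (edge-≢ˡ cd (ad ∘ sym) cd (ac ∘ sym)))
    count-has {q = a , b , c , d} ((ab ∷ ac ∷ ad ∷ []) ∷ (bc ∷ bd ∷ []) ∷ (cd ∷ []) ∷ _)
      (inj₂ (inj₂ (inj₂ refl))) = sum4 (indicator≡ (edge-≢ˡ (ad ∘ sym) ab (ad ∘ sym) (bd ∘ sym)))
      (indicator≡ (edge-≢ʳ (ad ∘ sym) cd ac ad)) (indicator≡ (edge-≢ˡ (ad ∘ sym) bc (bd ∘ sym) (cd ∘ sym)))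
        (indicator-refl (edge d a))

    count-none : ∀ {e q} → ¬ Has e q → count q e ≡ 0
    count-none h = sum4 (indicator≡ (λ p → h (inj₁ p))) (indicator≡ (λ p → h (inj₂ (inj₂ (inj₁ p)))))
      (indicator≡ (λ p → h (inj₂ (inj₁ p)))) (indicator≡ (λ p → h (inj₂ (inj₂ (inj₂ p)))))

    total-none : ∀ {e} L → (∀ {q} → q ∈ L → ¬ Has e q) → nsum (λ q → count q e) L ≡ 0
    total-none []      h = refl
    total-none (q ∷ L) h = cong₂ ℕ._+_ (count-none {q = q} (h (here refl))) (total-none L (h ∘ there))

    total-has : ∀ {e} L → All Distinct4 L → AllPairs NodeDisjoint L → Any (Has e) L → nsum (λ q → count q e)
      L ≡ 1
    total-has {e} (q ∷ L) (dq ∷ dL) (nd ∷ _) (here h) = cong₂ ℕ._+_ (count-has {q = q} dq h)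
      (total-none L (λ {r} m → disjoint-edges {e} {q} {r} dq (All.lookup dL m) (All.lookup nd m) h))
    total-has {e} (q ∷ L) (dq ∷ dL) (nd ∷ ps) (there m) = cong₂ ℕ._+_
      (count-none {q = q} (λ h → let (r , mr , hr) = find m in disjoint-edges {e} {q} {r} dq (All.lookup dL mr) (All.lookup nd mr) h hr))
      (total-has L dL ps m)

  total-split : ∀ L e → totalA L e ℕ.+ totalB L e ≡ nsum (λ q → count q e) L
  total-split L e = sym (nsum-+ (λ q → countA q e) (λ q → countB q e) L)

  record Structure (x : Vec M) (L : List (Quad n)) : Set where
    field
      distinct : All Distinct4 L
      disjoint : AllPairs NodeDisjoint L
      values   : ∀ e → x e ≡ 0ℚ ⊎ x e ≡ ½ ⊎ x e ≡ 1ℚ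
      half⇒    : ∀ e → x e ≡ ½ → Any (Has e) L
      ⇒half    : ∀ e → Any (Has e) L → x e ≡ ½
      degrees  : ∀ v → cutval s t x (single s t v) ≡ toℚ 2
      cuts     : ∀ U v w → U v ≡ true → U w ≡ false → toℚ 2 ≤ cutval s t x U

  one : Vec M → Row M
  one x e = does (x e ℚP.≟ 1ℚ)

  ones : Vec M → Fin M → ℕ
  ones x e = ⟦ one x e ⟧ℕ

  module Counting {x : Vec M} {L : List (Quad n)} (S : Structure x L) where

    open Structure S

    k A B : Fin M → ℕ
    k = ones x
    A = totalA L
    B = totalB L

    AB≡0 : ∀ {e} → x e ≢ ½ → A e ℕ.+ B e ≡ 0
    AB≡0 {e} h = trans (total-split L e) (total-none L (λ m hq → h (⇒half e (lose m hq))))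

    AB≡1 : ∀ {e} → x e ≡ ½ → A e ℕ.+ B e ≡ 1
    AB≡1 {e} h = trans (total-split L e) (total-has L distinct disjoint (half⇒ e h))

    AB≤1 : ∀ e → A e ℕ.+ B e ℕ.≤ 1
    AB≤1 e with x e ℚP.≟ ½
    ... | yes p = ℕP.≤-reflexive (AB≡1 p)
    ... | no p  = ℕP.≤-trans (ℕP.≤-reflexive (AB≡0 p)) ℕ.z≤n

    private
      ½≢1 : ½ ≢ 1ℚ
      ½≢1 ()
      ½≢0 : ½ ≢ 0ℚ
      ½≢0 ()
      0≢1 : 0ℚ ≢ 1ℚ
      0≢1 ()
      ones≡1 : ∀ {e} → x e ≡ 1ℚ → k e ≡ 1
      ones≡1 {e} h with x e ℚP.≟ 1ℚ
      ... | yes _ = refl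
      ... | no p  = ⊥-elim (p h)
      ones≡0 : ∀ {e} → x e ≢ 1ℚ → k e ≡ 0
      ones≡0 {e} h with x e ℚP.≟ 1ℚ
      ... | yes p = ⊥-elim (h p)
      ... | no _  = refl

    x≡ : ∀ e → x e ≡ ½ * toℚ ((k e ℕ.+ A e) ℕ.+ (k e ℕ.+ B e))
    x≡ e = trans (by (values e)) (cong (λ m → ½ * toℚ m) (shuffle (k e) (A e) (B e)))
      where
      shuffle : ∀ k a b → k ℕ.+ k ℕ.+ (a ℕ.+ b) ≡ k ℕ.+ a ℕ.+ (k ℕ.+ b)
      shuffle = NS.solve-∀
      by : x e ≡ 0ℚ ⊎ x e ≡ ½ ⊎ x e ≡ 1ℚ → x e ≡ ½ * toℚ (k e ℕ.+ k e ℕ.+ (A e ℕ.+ B e))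
      by (inj₁ h) = trans h (cong₂ (λ k m → ½ * toℚ (k ℕ.+ k ℕ.+ m))
        (sym (ones≡0 (λ q → 0≢1 (trans (sym h) q)))) (sym (AB≡0 (λ q → ½≢0 (trans (sym q) h)))))
      by (inj₂ (inj₁ h)) = trans h (cong₂ (λ k m → ½ * toℚ (k ℕ.+ k ℕ.+ m))
        (sym (ones≡0 (λ q → ½≢1 (trans (sym h) q)))) (sym (AB≡1 h)))
      by (inj₂ (inj₂ h)) = trans h (cong₂ (λ k m → ½ * toℚ (k ℕ.+ k ℕ.+ m)) (sym (ones≡1 h))
        (sym (AB≡0 (λ q → ½≢1 (trans (sym q) h)))))

    K : (Fin M → ℕ) → (Fin n → Bool) → ℕ
    K = cutcount s t

    cutval-x : ∀ U → cutval s t x U ≡ ½ * toℚ ((K k U ℕ.+ K A U) ℕ.+ (K k U ℕ.+ K B U))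
    cutval-x U = trans (∑-cong (λ e → trans (cong (⟦ cross s t U e ⟧ *_) (x≡ e))
      (swap ⟦ cross s t U e ⟧ ½ (toℚ (W e)))))
      (trans (∑-* ½ (λ e → ⟦ cross s t U e ⟧ * toℚ (W e))) (cong (½ *_) (trans (cutval-toℚ s t W U) (cong toℚ
        (trans (cutcount-+ s t (λ e → k e ℕ.+ A e) (λ e → k e ℕ.+ B e) U)
          (cong₂ ℕ._+_ (cutcount-+ s t k A U) (cutcount-+ s t k B U)))))))
      where
      W : Fin M → ℕ
      W e = (k e ℕ.+ A e) ℕ.+ (k e ℕ.+ B e)
      swap : ∀ a b c → a * (b * c) ≡ b * (a * c)
      swap = solve-∀ ℚ-ring

    private
      double : ∀ {p q} → p ≡ ½ * q → p + p ≡ q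
      double {p} {q} refl = trans (sym (ℚP.*-distribʳ-+ q ½ ½)) (ℚP.*-identityˡ q)

    cut-4 : ∀ U v w → U v ≡ true → U w ≡ false → 4 ℕ.≤ (K k U ℕ.+ K A U) ℕ.+ (K k U ℕ.+ K B U)
    cut-4 U v w a b = toℚ-cancel (subst (toℚ 4 ≤_) (double (cutval-x U))
      (ℚP.+-mono-≤ (cuts U v w a b) (cuts U v w a b)))

    H : Fin M → ℕ
    H e = k e ℕ.+ A e

    -- By `balanced` a node has the same degree in `1 + A` as in `1 + B`. The two add up to twice
    -- its degree in x, which is four, so every node has degree two in `H`.
    H-even : ∀ U → parity s t H U ≡ false
    H-even = even-nodes⇒even-cuts s t H
      (λ v → trans (sym (odd-cutcount s t H (single s t v))) (cong odd (at v)))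
      where
      at : ∀ v → K H (single s t v) ≡ 2
      at v = halve (toℚ-injective (sym (trans (sym (cong₂ _+_ (degrees v) (degrees v)))
          (trans (double (cutval-x (single s t v)))
            (cong (λ b → toℚ ((K k (single s t v) ℕ.+ K A (single s t v)) ℕ.+ (K k (single s t v) ℕ.+ b)))
              (sym (balanced distinct v)))))))
        where
        halve : (K k (single s t v) ℕ.+ K A (single s t v)) ℕ.+ (K k (single s t v) ℕ.+ K A (single s t v))
          ≡ 4 → K H (single s t v) ≡ 2
        halve h = trans (cutcount-+ s t k A (single s t v))
          (ℕP.*-cancelˡ-≡ _ 2 2 (trans (cong (K k (single s t v) ℕ.+ K A (single s t v) ℕ.+_)
            (ℕP.+-identityʳ _)) h))

    even : ∀ U → parity s t k U ≡ xsum (quadParity U) L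
    even U = xor≡false⇒ (trans (cong (parity s t k U xor_) (sym (parityA distinct U)))
      (trans (sym (parity-+ s t k A U)) (H-even U)))

    initially-connected : CutConnectedBy s t (Present (one x) [] L)
    initially-connected U v w a b with FP.any? (λ e → (cross s t U e B.≟ true) ×-dec ¬? (x e ℚP.≟ 0ℚ))
    ... | yes (e , c , nz) = e , present (values e) , c
      where
      present : x e ≡ 0ℚ ⊎ x e ≡ ½ ⊎ x e ≡ 1ℚ → Present (one x) [] L e
      present (inj₁ z) = ⊥-elim (nz z)
      present (inj₂ (inj₁ h)) = inj₂ (inj₂ (half⇒ e h))
      present (inj₂ (inj₂ o)) = inj₁ (true? o)
        where
        true? : x e ≡ 1ℚ → one x e ≡ true
        true? h with x e ℚP.≟ 1ℚ
        ... | yes _ = refl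
        ... | no p  = ⊥-elim (p h)
    ... | no none = ⊥-elim (<⇒≱ (toℚ-suc 1)
      (ℚP.≤-trans (cuts U v w a b) (ℚP.≤-trans (ℚP.≤-reflexive (∑-zero flat)) (0≤toℚ 1))))
      where
      flat : ∀ e → ⟦ cross s t U e ⟧ * x e ≡ 0ℚ
      flat e with cross s t U e in eq | x e ℚP.≟ 0ℚ
      ... | false | _ = ℚP.*-zeroˡ (x e)
      ... | true | yes z = trans (cong (1ℚ *_) z) (ℚP.*-zeroʳ 1ℚ)
      ... | true | no nz = ⊥-elim (none (e , eq , nz))

  EvenConnected : (Fin M → ℕ) → Set
  EvenConnected J = CutConnectedBy s t (λ e → 1 ℕ.≤ J e) × (∀ U → parity s t J U ≡ false)

  module Decomposition {x : Vec M} {L : List (Quad n)} (S : Structure x L)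
    (conn : CutConnectedBy s t (λ e → one x e ≡ true ⊎ Any (HasA e) L)) where

    open Structure S
    open Counting S

    private
      A-pos : ∀ {e} L → Any (HasA e) L → 1 ℕ.≤ totalA L e
      A-pos {e} (q ∷ L) (here (inj₁ refl)) = ℕP.≤-trans (ℕP.≤-reflexive (sym (indicator-refl e)))
        (ℕP.≤-trans (ℕP.m≤m+n _ ⟦ e == e₃ q ⟧ℕ) (ℕP.m≤m+n (countA q e) _))
      A-pos {e} (q ∷ L) (here (inj₂ refl)) = ℕP.≤-trans (ℕP.≤-reflexive (sym (indicator-refl e)))
        (ℕP.≤-trans (ℕP.m≤n+m _ ⟦ e == e₁ q ⟧ℕ) (ℕP.m≤m+n (countA q e) _))
      A-pos {e} (q ∷ L) (there m) = ℕP.≤-trans (A-pos L m) (ℕP.m≤n+m _ (countA q e))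

    H-tour : EvenConnected H
    H-tour = (λ U v w a b → let (e , p , c) = conn U v w a b in e , positive p , c) , H-even
      where
      positive : ∀ {e} → one x e ≡ true ⊎ Any (HasA e) L → 1 ℕ.≤ H e
      positive {e} (inj₁ o) = ℕP.≤-trans (ℕP.≤-reflexive (cong ⟦_⟧ℕ (sym o))) (ℕP.m≤m+n (k e) (A e))
      positive {e} (inj₂ m) = ℕP.≤-trans (A-pos L m) (ℕP.m≤n+m (A e) (k e))

    cutcount-pos : ∀ {J U e} → 1 ℕ.≤ J e → cross s t U e ≡ true → 1 ℕ.≤ K J U
    cutcount-pos {J} {U} {e} p c with K J U in eq
    ... | suc _ = ℕ.s≤s ℕ.z≤n
    ... | zero  = ⊥-elim (ℕP.<-irrefl refl (ℕP.≤-trans p (ℕP.≤-reflexive (cutcount-zero eq e c))))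
      where
      cutcount-zero : K J U ≡ 0 → ∀ e → cross s t U e ≡ true → J e ≡ 0
      cutcount-zero h e c = trans (sym (trans (cong (λ b → ⟦ b ⟧ℕ ℕ.* J e) c) (ℕP.*-identityˡ (J e))))
        (sym (∑ℕ-tight {f = λ _ → 0} {g = λ e → ⟦ cross s t U e ⟧ℕ ℕ.* J e} (λ _ → ℕ.z≤n)
          (ℕP.≤-trans (ℕP.≤-reflexive h) ℕ.z≤n) e))

    cut-zero : ∀ {J U} → K J U ≡ 0 → ∀ e → cross s t U e ≡ true → J e ≡ 0
    cut-zero {J} {U} h e c = ℕP.n≤0⇒n≡0
      (ℕP.≮⇒≥ (λ p → ℕP.<-irrefl refl (ℕP.≤-trans (cutcount-pos {J} {U} p c) (ℕP.≤-reflexive h))))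

    sixth : ℚ
    sixth = ℤ.+ 1 / 6

    z : Vec M
    z e = sixth * toℚ ((k e ℕ.+ A e) ℕ.+ 2 ℕ.* (k e ℕ.+ B e))

    0≤sixth : 0ℚ ≤ sixth
    0≤sixth = ℚ.*≤* (ℤ.+≤+ ℕ.z≤n)

    z≥0 : ∀ e → 0ℚ ≤ z e
    z≥0 e = 0≤* 0≤sixth (0≤toℚ ((k e ℕ.+ A e) ℕ.+ 2 ℕ.* (k e ℕ.+ B e)))

    cutval-z : ∀ U → cutval s t z U ≡ sixth * toℚ ((K k U ℕ.+ K A U) ℕ.+ 2 ℕ.* (K k U ℕ.+ K B U))
    cutval-z U = trans (∑-cong (λ e → swap ⟦ cross s t U e ⟧ sixth (toℚ (W e))))
      (trans (∑-* sixth (λ e → ⟦ cross s t U e ⟧ * toℚ (W e)))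
        (cong (sixth *_) (trans (cutval-toℚ s t W U) (cong toℚ
        (trans (cutcount-+ s t (λ e → k e ℕ.+ A e) (λ e → 2 ℕ.* (k e ℕ.+ B e)) U)
          (cong₂ ℕ._+_ (cutcount-+ s t k A U) twice))))))
      where
      W : Fin M → ℕ
      W e = (k e ℕ.+ A e) ℕ.+ 2 ℕ.* (k e ℕ.+ B e)
      swap : ∀ a b c → a * (b * c) ≡ b * (a * c)
      swap = solve-∀ ℚ-ring
      swapℕ : ∀ a b → a ℕ.* (2 ℕ.* b) ≡ 2 ℕ.* (a ℕ.* b)
      swapℕ = NS.solve-∀
      twice : K (λ e → 2 ℕ.* (k e ℕ.+ B e)) U ≡ 2 ℕ.* (K k U ℕ.+ K B U)
      twice = trans (∑ℕ-cong (λ e → swapℕ ⟦ cross s t U e ⟧ℕ (k e ℕ.+ B e)))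
        (trans (∑ℕ-* 2 (λ e → ⟦ cross s t U e ⟧ℕ ℕ.* (k e ℕ.+ B e)))
        (cong (2 ℕ.*_) (cutcount-+ s t k B U)))

    pairOf : Quad n → Fin M × Fin M
    pairOf q = e₁ q , e₃ q

    -- In a cut consisting of two opposite pairs, F uses exactly one edge of each pair.
    tight-even : ∀ F → All (λ q → F (e₁ q) ℕ.+ F (e₃ q) ≡ 1) L → (∀ e → x e ≡ 0ℚ → F e ≡ 0) →
      ∀ U → K k U ≡ 0 → K B U ≡ 0 → K A U ≡ 4 → parity s t F U ≡ false
    tight-even F rainbow supp U k0 B0 A4 = trans (sym (odd-cutcount s t F U)) (cong odd (trans spread two))
      where
      c : Fin M → ℕ
      c e = ⟦ cross s t U e ⟧ℕ
      -- No edge of value one and no edge of `B` crosses, so a crossing edge used by `F` lies in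
      -- `A`, where the factor `A e` is one. With this factor the sum can be rearranged by squares.
      pt : ∀ e → c e ℕ.* F e ≡ (c e ℕ.* F e) ℕ.* A e
      pt e = by (cross s t U e) refl
        where
        by : ∀ b → cross s t U e ≡ b → ⟦ b ⟧ℕ ℕ.* F e ≡ (⟦ b ⟧ℕ ℕ.* F e) ℕ.* A e
        by false _ = refl
        by true h = trans (cases (values e)) (cong (ℕ._* A e) (sym (ℕP.*-identityˡ (F e))))
          where
          cases : x e ≡ 0ℚ ⊎ x e ≡ ½ ⊎ x e ≡ 1ℚ → 1 ℕ.* F e ≡ F e ℕ.* A e
          cases (inj₁ z₀) = trans (cong (1 ℕ.*_) (supp e z₀)) (cong (ℕ._* A e) (sym (supp e z₀)))
          cases (inj₂ (inj₁ hf)) = trans (ℕP.*-comm 1 (F e))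
            (cong (F e ℕ.*_) (sym (trans (sym (ℕP.+-identityʳ (A e)))
            (trans (cong (A e ℕ.+_) (sym (cut-zero {B} {U} B0 e h))) (AB≡1 hf)))))
          cases (inj₂ (inj₂ o)) = ⊥-elim (1≢0′ (trans (sym (isOne o)) (cut-zero {k} {U} k0 e h)))
            where
            1≢0′ : 1 ≢ 0
            1≢0′ ()
            isOne : x e ≡ 1ℚ → k e ≡ 1
            isOne q with x e ℚP.≟ 1ℚ
            ... | yes _ = refl
            ... | no p  = ⊥-elim (p q)
      spread : K F U ≡ nsum (λ q → c (e₁ q) ℕ.* F (e₁ q) ℕ.+ c (e₃ q) ℕ.* F (e₃ q)) L
      spread = trans (∑ℕ-cong pt) (weigh (λ e → c e ℕ.* F e) e₁ e₃ L)
      B-terms : ∀ {q} L → nsum (λ q → c (e₂ q) ℕ.+ c (e₄ q)) L ≡ 0 → q ∈ L → c (e₂ q) ≡ 0 × c (e₄ q) ≡ 0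
      B-terms (q ∷ L) h (here refl) = ℕP.m+n≡0⇒m≡0 (c (e₂ q)) (ℕP.m+n≡0⇒m≡0 _ h) , ℕP.m+n≡0⇒n≡0 (c (e₂ q))
        (ℕP.m+n≡0⇒m≡0 _ h)
      B-terms (q ∷ L) h (there m) = B-terms L (ℕP.m+n≡0⇒n≡0 (c (e₂ q) ℕ.+ c (e₄ q)) h) m
      -- No edge of `B` crosses, so `U` is constant on bc and on da; hence the edges of the pair `A`
      -- cross both or not at all.
      equal : ∀ {q} → q ∈ L → Distinct4 q → c (e₁ q) ≡ c (e₃ q)
      equal {q@(a , b , c′ , d)} m ((ab ∷ ac ∷ ad ∷ []) ∷ (bc ∷ bd ∷ []) ∷ (cd ∷ []) ∷ _) = cong ⟦_⟧ℕ
          (trans (cross-edge ab U) (trans (cong₂ _xor_ (sym Uda) Ubc)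
            (trans (BP.xor-comm (U d) (U c′)) (sym (cross-edge cd U)))))
        where
        zeros = B-terms L (trans (sym (cutB L U)) B0) m
        uncrossed : ∀ {b} → ⟦ b ⟧ℕ ≡ 0 → b ≡ false
        uncrossed {false} _ = refl
        Ubc : U b ≡ U c′
        Ubc = xor≡false⇒ (trans (sym (cross-edge bc U)) (uncrossed (proj₁ zeros)))
        Uda : U d ≡ U a
        Uda = xor≡false⇒ (trans (sym (cross-edge (ad ∘ sym) U)) (uncrossed (proj₂ zeros)))
      half : nsum (λ q → c (e₁ q)) L ℕ.+ nsum (λ q → c (e₁ q)) L ≡ 4
      half = trans (sym (nsum-+ (λ q → c (e₁ q)) (λ q → c (e₁ q)) L))
        (trans (nsum-cong (All.tabulate
          (λ {q} m → cong (c (e₁ q) ℕ.+_) (equal {q} m (All.lookup distinct m)))))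
            (trans (sym (cutA L U)) A4))
      two : nsum (λ q → c (e₁ q) ℕ.* F (e₁ q) ℕ.+ c (e₃ q) ℕ.* F (e₃ q)) L ≡ 2
      two = trans (nsum-cong (All.tabulate (λ {q} m → trans
          (trans (cong (λ r → c (e₁ q) ℕ.* F (e₁ q) ℕ.+ r ℕ.* F (e₃ q))
            (sym (equal {q} m (All.lookup distinct m))))
              (sym (ℕP.*-distribˡ-+ (c (e₁ q)) (F (e₁ q)) (F (e₃ q)))))
          (trans (cong (c (e₁ q) ℕ.*_) (All.lookup rainbow m)) (ℕP.*-identityʳ (c (e₁ q)))))))
        (ℕP.*-cancelˡ-≡ _ 2 2 (trans (cong (nsum (λ q → c (e₁ q)) L ℕ.+_) (ℕP.+-identityʳ _)) half))

    -- An odd cut is proper, so x and `H` both bound it and `cut-arithmetic` applies. Its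
    -- exceptional case, four edges of `A` and nothing else, is even for rainbow F and does not
    -- arise.
    joinable : ∀ F → All (λ q → F (e₁ q) ℕ.+ F (e₃ q) ≡ 1) L → (∀ e → x e ≡ 0ℚ → F e ≡ 0) → ∀ U → parity s t
      F U ≡ true → 1ℚ ≤ cutval s t z U
    joinable F rainbow supp U o = nontrivial (FP.any? (λ v → U v B.≟ true)) (FP.any? (λ w → U w B.≟ false))
      where
      constant : ∀ b → (∀ v → U v ≡ b) → ⊥
      constant b h = true≢false o (trans (parity-cong s t {F} h) (parity-const s t F b))
      ≢false : ∀ {b} → b ≢ false → b ≡ true
      ≢false {true}  _ = refl
      ≢false {false} h = ⊥-elim (h refl)
      nontrivial : Dec (∃[ v ] U v ≡ true) → Dec (∃[ w ] U w ≡ false) → 1ℚ ≤ cutval s t z U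
      nontrivial (no h) _ = ⊥-elim (constant false (λ v → ≢true (λ p → h (v , p))))
      nontrivial (yes _) (no h) = ⊥-elim (constant true (λ v → ≢false (λ p → h (v , p))))
      nontrivial (yes (v , hv)) (yes (w , hw)) = use
        (cut-arithmetic (K k U) (K A U) (K B U) (cut-4 U v w hv hw)
          (trans (cong odd (sym (cutcount-+ s t k A U))) (trans (odd-cutcount s t H U) (H-even U)))
          (subst (1 ℕ.≤_) (cutcount-+ s t k A U)
            (let (e , p , c) = proj₁ H-tour U v w hv hw in cutcount-pos {H} {U} p c)))
        where
        use : 6 ℕ.≤ (K k U ℕ.+ K A U) ℕ.+ 2 ℕ.* (K k U ℕ.+ K B U) ⊎ (K k U ≡ 0 × K B U ≡ 0 × K A U ≡ 4) → 1ℚ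
          ≤ cutval s t z U
        use (inj₁ six) = subst (1ℚ ≤_) (sym (cutval-z U)) (*-mono-≤ʳ {sixth} {toℚ 6} 0≤sixth (toℚ-mono six))
        use (inj₂ (k0 , B0 , A4)) = ⊥-elim (true≢false o (tight-even F rainbow supp U k0 B0 A4))

    private
      half-edge : ∀ {q} → q ∈ L → x (e₁ q) ≡ ½ × x (e₃ q) ≡ ½
      half-edge m = ⇒half _ (lose m (inj₁ refl)) , ⇒half _ (lose m (inj₂ (inj₂ (inj₁ refl))))

      pair≤A : ∀ q e → ⟦ pairRow (pairOf q) e ⟧ℕ ℕ.≤ countA q e
      pair≤A q e with e == e₁ q
      ... | true  = ℕ.s≤s ℕ.z≤n
      ... | false = ℕP.≤-refl

      pairs-once : ∀ e → incidence (map pairRow (map pairOf L)) e ℕ.≤ 1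
      pairs-once e = subst (ℕ._≤ 1) (sym
        (trans (cong (λ R → incidence R e) (sym (LP.map-∘ L))) (incidence-nsum (pairRow ∘ pairOf) L e)))
        (ℕP.≤-trans (nsum-mono L (λ q → pair≤A q e)) (ℕP.≤-trans (ℕP.m≤m+n (A e) (B e)) (AB≤1 e)))

      0≤x : ∀ e → 0ℚ ≤ x e
      0≤x e with values e
      ... | inj₁ h = ℚP.≤-reflexive (sym h)
      ... | inj₂ (inj₁ h) = subst (0ℚ ≤_) (sym h) (ℚ.*≤* (ℤ.+≤+ ℕ.z≤n))
      ... | inj₂ (inj₂ h) = subst (0ℚ ≤_) (sym h) 0≤1

      x≤1 : ∀ e → x e ≤ 1ℚ
      x≤1 e with values e
      ... | inj₁ h = subst (_≤ 1ℚ) (sym h) 0≤1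
      ... | inj₂ (inj₁ h) = subst (_≤ 1ℚ) (sym h) (ℚ.*≤* (ℤ.+≤+ (ℕ.s≤s ℕ.z≤n)))
      ... | inj₂ (inj₂ h) = ℚP.≤-reflexive h

      Forest : (Fin M → ℕ) → Set
      Forest F = (CutConnectedBy s t (λ e → 1 ℕ.≤ F e) × All (λ q → F (e₁ q) ℕ.+ F (e₃ q) ≡ 1) L) ×
        (∀ e → x e ≡ 0ℚ → F e ≡ 0)

    -- The cut constraints of x imply the demand inequalities, and each pair `A` consists of two
    -- edges of value one half and so has total one. Staying in the support of x is kept because
    -- `tight-even` relies on it.
    forests : Cone Forest 1ℚ x
    forests = cone-map (λ { ((meets , rainbow) , supp) → (connected meets , AllP.map⁻ rainbow) , supp })
      (cone-support (rainbow-decomposition (demand s t) (demand-cong s t) (demand-int s t)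
        (demand-supermodular s t) (map pairOf L)
        (AllP.map⁺ (All.map (λ {q} → opposite-≢ {q}) distinct)) pairs-once x
        ((λ e → 0≤x e , x≤1 e) , demand≤ s t 0≤x cuts , AllP.map⁺
          (All.tabulate (λ {q} m → cong₂ _+_ (proj₁ (half-edge {q} m)) (proj₂ (half-edge {q} m)))))))
      where
      connected : ∀ {F : Fin M → ℕ} → (∀ S → demand s t S ≤ mass S (λ e → toℚ (F e))) → CutConnectedBy s t
        (λ e → 1 ℕ.≤ F e)
      connected {F} meets U v w a b = let (e , p , c) = meets-demand⇒connected s t F meets U v w a b in e , pos (F e) p , c
        where
        pos : ∀ k → not (does (k ℕP.≟ 0)) ≡ true → 1 ℕ.≤ k
        pos (suc _) _ = ℕ.s≤s ℕ.z≤n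

    joined : Cone EvenConnected 1ℚ (λ e → x e + 1ℚ * z e)
    joined = cone-bind {G = Forest} {K = EvenConnected} {H = λ F J → ∀ U → parity s t J U ≡ parity s t F U}
      z≥0
      (λ {F} ((_ , rainbow) , supp) → joins-dominated s t F z≥0 (joinable F rainbow supp))
      (λ {F} {J} ((c , _) , _) join → (λ U v w a b → let (e , p , h) = c U v w a b in e , ℕP.≤-trans p (ℕP.m≤m+n (F e) (J e)) , h) ,
        λ U → trans (parity-+ s t F J U)
          (trans (cong (parity s t F U xor_) (join U)) (BP.xor-same (parity s t F U))))
      forests

    tours : Cone EvenConnected 1ℚ (λ e → (ℤ.+ 10 / 7) * x e)
    tours = cone-up (cone-++ (cone-scale (ℤ.+ 1 / 7) (ℚ.*<* (ℤ.+<+ (ℕ.s≤s ℕ.z≤n)))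
      (cone-point {v = λ e → toℚ (H e)} H H-tour (λ _ → ℚP.≤-refl)))
        (cone-scale (ℤ.+ 6 / 7) (ℚ.*<* (ℤ.+<+ (ℕ.s≤s ℕ.z≤n))) joined)) (λ e → ℚP.≤-reflexive (balance e))
      where
      -- Here h and j are the multiplicities of one edge in `1 + A` and `1 + B`, in terms of which x
      -- and `z` are both linear.
      lem : ∀ h j → (ℤ.+ 1 / 7) * h + (ℤ.+ 6 / 7) * (½ * (h + j) + 1ℚ * (sixth * (h + (j + j)))) ≡
        (ℤ.+ 10 / 7) * (½ * (h + j))
      lem = solve-∀ ℚ-ring
      balance : ∀ e → (ℤ.+ 1 / 7) * toℚ (H e) + (ℤ.+ 6 / 7) * (x e + 1ℚ * z e) ≡ (ℤ.+ 10 / 7) * x e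
      balance e = trans (cong₂ (λ p q → (ℤ.+ 1 / 7) * toℚ (H e) + (ℤ.+ 6 / 7) * (p + 1ℚ * (sixth * q))) x≡′
          (trans (toℚ-+ (H e) (2 ℕ.* j))
            (cong (λ p → toℚ (H e) + p) (trans (cong (λ m → toℚ (j ℕ.+ m)) (ℕP.+-identityʳ j)) (toℚ-+ j j)))))
        (trans (lem (toℚ (H e)) (toℚ j)) (cong ((ℤ.+ 10 / 7) *_) (sym x≡′)))
        where
        j = k e ℕ.+ B e
        x≡′ : x e ≡ ½ * (toℚ (H e) + toℚ j)
        x≡′ = trans (x≡ e) (cong (½ *_) (toℚ-+ (H e) j))

-- Invariance of the square structure under turning squares

turned-nodes : ∀ {n} {q q′ : Quad n} → Turned q q′ → ∀ {u} → u ∈ quadNodes q′ → u ∈ quadNodes q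
turned-nodes (inj₁ refl) m = m
turned-nodes (inj₂ refl) (here h) = there (here h)
turned-nodes (inj₂ refl) (there (here h)) = there (there (here h))
turned-nodes (inj₂ refl) (there (there (here h))) = there (there (there (here h)))
turned-nodes (inj₂ refl) (there (there (there (here h)))) = here h

turned-distinct : ∀ {n} {L L′ : List (Quad n)} → Pointwise Turned L L′ → All Distinct4 L → All Distinct4 L′
turned-distinct [] [] = []
turned-distinct (inj₁ refl ∷ ts) (d ∷ ds) = d ∷ turned-distinct ts ds
turned-distinct {L = q ∷ _} (inj₂ refl ∷ ts) (d ∷ ds) = rotate-distinct {q = q} d ∷ turned-distinct ts ds

turned-disjoint : ∀ {n} {L L′ : List (Quad n)} → Pointwise Turned L L′ → AllPairs NodeDisjoint L → AllPairs
  NodeDisjoint L′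
turned-disjoint [] [] = []
turned-disjoint (t ∷ ts) (d ∷ ds) = apart t ts d ∷ turned-disjoint ts ds
  where
  apart : ∀ {q q′ L L′} → Turned q q′ → Pointwise Turned L L′ → All (NodeDisjoint q) L → All
    (NodeDisjoint q′) L′
  apart t [] [] = []
  apart {q} t (_∷_ {x = r} {y = r′} u us) (d ∷ ds) =
    All.tabulate (λ m → All.tabulate
      (λ m′ → All.lookup (All.lookup d (turned-nodes t m)) (turned-nodes {q = r} {r′} u m′))) ∷ apart t us ds

module TurnedSquares {n M : ℕ} (s t : Fin M → Fin n) (edge : Fin n → Fin n → Fin M)
  (ends : ∀ a b → a ≢ b → (s (edge a b) ≡ a × t (edge a b) ≡ b) ⊎ (s (edge a b) ≡ b × t (edge a b) ≡ a)) where

  open Squares s t edge ends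
  open SquarePoints s t edge ends

  private
    has-turned : ∀ {e q q′} → Turned q q′ → Has e q → Has e q′
    has-turned (inj₁ refl) h = h
    has-turned (inj₂ refl) (inj₁ h) = inj₂ (inj₂ (inj₂ h))
    has-turned (inj₂ refl) (inj₂ (inj₁ h)) = inj₁ h
    has-turned (inj₂ refl) (inj₂ (inj₂ (inj₁ h))) = inj₂ (inj₁ h)
    has-turned (inj₂ refl) (inj₂ (inj₂ (inj₂ h))) = inj₂ (inj₂ (inj₁ h))

    has-unturned : ∀ {e q q′} → Turned q q′ → Has e q′ → Has e q
    has-unturned (inj₁ refl) h = h
    has-unturned (inj₂ refl) (inj₁ h) = inj₂ (inj₁ h)
    has-unturned (inj₂ refl) (inj₂ (inj₁ h)) = inj₂ (inj₂ (inj₁ h))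
    has-unturned (inj₂ refl) (inj₂ (inj₂ (inj₁ h))) = inj₂ (inj₂ (inj₂ h))
    has-unturned (inj₂ refl) (inj₂ (inj₂ (inj₂ h))) = inj₁ h

    any-turned : ∀ {e L L′} → Pointwise Turned L L′ → Any (Has e) L → Any (Has e) L′
    any-turned {e} (_∷_ {x = q} {y = q′} u us) (here h) = here (has-turned {e} {q} {q′} u h)
    any-turned (u ∷ us) (there m) = there (any-turned us m)

    any-unturned : ∀ {e L L′} → Pointwise Turned L L′ → Any (Has e) L′ → Any (Has e) L
    any-unturned {e} (_∷_ {x = q} {y = q′} u us) (here h) = here (has-unturned {e} {q} {q′} u h)
    any-unturned (u ∷ us) (there m) = there (any-unturned us m)

  turn : ∀ {x L L′} → Pointwise Turned L L′ → Structure x L → Structure x L′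
  turn ts S = record
    { distinct = turned-distinct ts distinct ; disjoint = turned-disjoint ts disjoint ; values = values
    ; half⇒ = λ e h → any-turned ts (half⇒ e h) ; ⇒half = λ e m → ⇒half e (any-unturned ts m)
    ; degrees = degrees ; cuts = cuts }
    where open Structure S

  structure-tours : ∀ {x L} → Structure x L → Cone EvenConnected 1ℚ (λ e → (ℤ.+ 10 / 7) * x e)
  structure-tours {x} {L} S = use
    (orient (one x) [] L (Counting.even S) [] (Structure.distinct S) (Counting.initially-connected S))
    where
    use : ∃[ L′ ] Pointwise Turned L L′ × CutConnectedBy s t
      (λ e → one x e ≡ true ⊎ Any (HasA e) [] ⊎ Any (HasA e) L′) → Cone EvenConnected 1ℚ
        (λ e → (ℤ.+ 10 / 7) * x e)
    use (L′ , ts , conn) = Decomposition.tours (turn ts S) (λ U v w a b → let (e , p , c) = conn U v w a b in e , drop p , c)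
      where
      drop : ∀ {e} → one x e ≡ true ⊎ Any (HasA e) [] ⊎ Any (HasA e) L′ → one x e ≡ true ⊎ Any (HasA e) L′
      drop (inj₁ o) = inj₁ o
      drop (inj₂ (inj₂ m)) = inj₂ m

-- From domination to equality: doubling an edge arbitrarily often keeps a tour a tour.

-- The denominator is at least one, so the absolute value of the numerator is a bound.
archimedean : ∀ q → ∃[ k ] q ≤ toℚ k
archimedean q = ℤ.∣ ℚ.↥ q ∣ , ℚP.toℚᵘ-cancel-≤
  (ℚᵘP.≤-trans (bound q) (ℚᵘP.≤-reflexive (ℚᵘP.≃-sym (ℚP.toℚᵘ-fromℚᵘ (ℚᵘ.mkℚᵘ (ℤ.+ ℤ.∣ ℚ.↥ q ∣) 0)))))
  where
  below : ∀ a d → a ℤ.* ℤ.+ 1 ℤ.≤ ℤ.+ ℤ.∣ a ∣ ℤ.* ℤ.+ suc d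
  below (ℤ.+ a) d = subst₂ ℤ._≤_ (ℤP.pos-* a 1) (ℤP.pos-* a (suc d))
    (ℤ.+≤+ (ℕP.*-monoʳ-≤ a (ℕ.s≤s (ℕ.z≤n {d}))))
  below ℤ.-[1+ a ] d = subst (ℤ.-[1+ a ] ℤ.* ℤ.+ 1 ℤ.≤_) (ℤP.pos-* (suc a) (suc d))
    (ℤP.≤-trans (ℤP.≤-reflexive (ℤP.*-identityʳ ℤ.-[1+ a ])) ℤ.-≤+)
  bound : ∀ q → ℚ.toℚᵘ q ℚᵘ.≤ ℚᵘ.mkℚᵘ (ℤ.+ ℤ.∣ ℚ.↥ q ∣) 0
  bound (ℚ.mkℚ a d _) = ℚᵘ.*≤* (below a d)

module _ {M : ℕ} where

  Weighted : Set
  Weighted = List (ℚ × (Fin M → ℕ))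

  weight : ℚ × (Fin M → ℕ) → ℚ
  weight = proj₁

  load : Fin M → ℚ × (Fin M → ℕ) → ℚ
  load e (c , J) = c * toℚ (J e)

  -- More copies of edges with unchanged parities preserve both connectedness and evenness, so the
  -- base point `J` is kept as the witness.
  Augments : ((Fin M → ℕ) → Set) → (Fin M → ℕ) → Set
  Augments G J′ = ∃[ J ] G J × (∀ e → J e ℕ.≤ J′ e) × (∀ e → odd (J′ e) ≡ odd (J e))

  cone⇒list : ∀ {G : (Fin M → ℕ) → Set} {w v} → Cone G w v →
    Σ[ L ∈ Weighted ] All (λ p → 0ℚ ≤ proj₁ p × Augments G (proj₂ p)) L × lsum weight L ≡ w ×
      (∀ e → lsum (load e) L ≤ v e)
  cone⇒list (nil h) = [] , [] , refl , h
  cone⇒list (cons c J p g C q below) with cone⇒list C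
  ... | L , good , total , small = (c , J) ∷ L , (ℚP.<⇒≤ p , J , g , (λ _ → ℕP.≤-refl) , (λ _ → refl)) ∷
    good ,
    trans (cong (c +_) total) (sym q) , λ e → ℚP.≤-trans (ℚP.+-monoʳ-≤ (c * toℚ (J e)) (small e)) (below e)

  double-edge : ℕ → (Fin M → ℕ) → Fin M → Fin M → ℕ
  double-edge k J e i = J i ℕ.+ ⟦ i == e ⟧ℕ ℕ.* (k ℕ.+ k)

  double-augments : ∀ {G : (Fin M → ℕ) → Set} k {J} e → G J → Augments G (double-edge k J e)
  double-augments k {J} e g = J , g , (λ i → ℕP.m≤m+n (J i) _) , λ i → trans (odd-+ (J i) _)
    (trans (cong (odd (J i) xor_) (by (i == e))) (BP.xor-identityʳ (odd (J i))))
    where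
    by : ∀ b → odd (⟦ b ⟧ℕ ℕ.* (k ℕ.+ k)) ≡ false
    by true  = trans (cong odd (ℕP.*-identityˡ (k ℕ.+ k))) (trans (odd-+ k k) (BP.xor-same (odd k)))
    by false = refl

  -- The missing amount `σ` is supplied by splitting a little weight `ρ * σ e` off the first point
  -- for each edge `e` and raising `e` there by 2k copies, where 2kρ = 1. For large k the weight
  -- split off does not exceed what the first point has. Total weight one ensures that there is a
  -- first point.
  exact : ∀ {G : (Fin M → ℕ) → Set} {y} → Cone G 1ℚ y →
    Σ[ L ∈ Weighted ] All (λ p → 0ℚ ≤ proj₁ p × Augments G (proj₂ p)) L × lsum weight L ≡ 1ℚ ×
      (∀ e → lsum (load e) L ≡ y e)
  exact {G} {y} (cons {w′ = w′} {v′} c J p g C q below) = fill (cone⇒list C)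
    (inverse⁺ (c + c) (ℚP.+-mono-< p p))
    where
    fill : Σ[ L ∈ Weighted ] All (λ p → 0ℚ ≤ proj₁ p × Augments G (proj₂ p)) L × lsum weight L ≡ w′ ×
      (∀ e → lsum (load e) L ≤ v′ e) →
      ∃[ r ] 0ℚ < r × r * (c + c) ≡ 1ℚ →
      Σ[ L ∈ Weighted ] All (λ p → 0ℚ ≤ proj₁ p × Augments G (proj₂ p)) L × lsum weight L ≡ 1ℚ ×
        (∀ e → lsum (load e) L ≡ y e)
    -- `r` is 1/(2c), so k is at least ∑σ/(2c), and with ρ = 1/(2k) the weight ρ∑σ split off is at
    -- most c. The successor makes k positive.
    fill (L , good , total , small) (r , pr , inv) = choose (archimedean (r * ∑ σ))
      where
      σ : Vec M
      σ e = y e - (c * toℚ (J e) + lsum (load e) L)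
      σ≥0 : ∀ e → 0ℚ ≤ σ e
      σ≥0 e = 0≤- (ℚP.≤-trans (ℚP.+-monoʳ-≤ (c * toℚ (J e)) (small e)) (below e))
      choose : ∃[ k ] r * ∑ σ ≤ toℚ k →
        Σ[ L ∈ Weighted ] All (λ p → 0ℚ ≤ proj₁ p × Augments G (proj₂ p)) L × lsum weight L ≡ 1ℚ ×
          (∀ e → lsum (load e) L ≡ y e)
      choose (k₀ , big) = spread (inverse⁺ (toℚ k + toℚ k) (ℚP.+-mono-< k>0 k>0))
        where
        k = suc k₀
        k>0 : 0ℚ < toℚ k
        k>0 = ℚP.≤-<-trans (0≤toℚ k₀) (toℚ-suc k₀)
        spread : ∃[ ρ ] 0ℚ < ρ × ρ * (toℚ k + toℚ k) ≡ 1ℚ →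
          Σ[ L ∈ Weighted ] All (λ p → 0ℚ ≤ proj₁ p × Augments G (proj₂ p)) L × lsum weight L ≡ 1ℚ ×
            (∀ e → lsum (load e) L ≡ y e)
        spread (ρ , pρ , inv′) = (c - ρ * ∑ σ , J) ∷ extra ++ L ,
            (0≤- enough , J , g , (λ _ → ℕP.≤-refl) , (λ _ → refl)) ∷ AllP.++⁺ extra-good good , weights ,
              loads
          where
          extra : Weighted
          extra = tabulate (λ e → ρ * σ e , double-edge k J e)
          extra-good : All (λ p → 0ℚ ≤ proj₁ p × Augments G (proj₂ p)) extra
          extra-good = AllP.tabulate⁺ (λ e → 0≤* (ℚP.<⇒≤ pρ) (σ≥0 e) , double-augments {G} k {J} e g)
          enough : ρ * ∑ σ ≤ c
          enough = ≤-by (0≤* (0≤* (ℚP.<⇒≤ (ℚP.+-mono-< p p)) (ℚP.<⇒≤ pρ))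
            (0≤- (ℚP.≤-trans big (ℚP.<⇒≤ (toℚ-suc k₀)))))
            (trans (half c inv′ ρ (toℚ k)) (lem ρ (∑ σ) c (toℚ k) r inv))
            where
            half : ∀ c {ρ k} → ρ * (k + k) ≡ 1ℚ → ∀ ρ′ k′ → c ≡ (c + c) * ρ * k
            half c {ρ} {k} h _ _ = trans (sym (ℚP.*-identityʳ c)) (trans (cong (c *_) (sym h)) (ring c ρ k))
              where
              ring : ∀ c ρ k → c * (ρ * (k + k)) ≡ (c + c) * ρ * k
              ring = solve-∀ ℚ-ring
            lem : ∀ ρ S c k r → r * (c + c) ≡ 1ℚ → (c + c) * ρ * k ≡ ρ * S + (c + c) * ρ * (k - r * S)
            lem ρ S c k r h = trans (ring₁ ρ S c k r)
              (trans (cong (λ u → (u * ρ) * S + (c + c) * ρ * (k - r * S)) h)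
              (cong (λ u → u * S + (c + c) * ρ * (k - r * S)) (ℚP.*-identityˡ ρ)))
              where
              ring₁ : ∀ ρ S c k r → (c + c) * ρ * k ≡ (r * (c + c) * ρ) * S + (c + c) * ρ * (k - r * S)
              ring₁ = solve-∀ ℚ-ring
          weights : (c - ρ * ∑ σ) + lsum weight (extra ++ L) ≡ 1ℚ
          weights = trans (cong (λ u → c - ρ * ∑ σ + u) (trans (lsum-++ weight extra L)
              (cong₂ _+_ (trans (lsum-tabulate weight (λ e → ρ * σ e , double-edge k J e)) (∑-* ρ σ)) total)))
            (trans (ring c (ρ * ∑ σ) w′) (sym q))
            where
            ring : ∀ c S w → c - S + (S + w) ≡ c + w
            ring = solve-∀ ℚ-ring
          extra-load : ∀ i → lsum (load i) extra ≡ (ρ * ∑ σ) * toℚ (J i) + σ i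
          extra-load i = trans (lsum-tabulate (load i) (λ e → ρ * σ e , double-edge k J e)) (trans (∑-cong pt)
            (trans (∑-+ (λ e → toℚ (J i) * (ρ * σ e)) (λ e → ⟦ e == i ⟧ * (ρ * (toℚ k + toℚ k) * σ e)))
              (cong₂ _+_ (trans (∑-* (toℚ (J i)) (λ e → ρ * σ e))
                (trans (cong (toℚ (J i) *_) (∑-* ρ σ)) (ℚP.*-comm (toℚ (J i)) (ρ * ∑ σ))))
                (trans (∑-single i (λ e → ρ * (toℚ k + toℚ k) * σ e))
                  (trans (cong (_* σ i) inv′) (ℚP.*-identityˡ (σ i)))))))
            where
            ring : ∀ ρ s j b k → ρ * s * (j + b * (k + k)) ≡ j * (ρ * s) + b * (ρ * (k + k) * s)
            ring = solve-∀ ℚ-ring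
            value : ∀ e → toℚ (double-edge k J e i) ≡ toℚ (J i) + ⟦ e == i ⟧ * (toℚ k + toℚ k)
            value e = trans (toℚ-+ (J i) (⟦ i == e ⟧ℕ ℕ.* (k ℕ.+ k))) (cong (λ u → toℚ (J i) + u)
              (trans (toℚ-* ⟦ i == e ⟧ℕ (k ℕ.+ k))
                (cong₂ _*_ (trans (⟦⟧-toℚ (i == e)) (cong ⟦_⟧ (==-sym i e))) (toℚ-+ k k))))
            pt : ∀ e → ρ * σ e * toℚ (double-edge k J e i) ≡ toℚ (J i) * (ρ * σ e) + ⟦ e == i ⟧ *
              (ρ * (toℚ k + toℚ k) * σ e)
            pt e = trans (cong (ρ * σ e *_) (value e)) (ring ρ (σ e) (toℚ (J i)) ⟦ e == i ⟧ (toℚ k))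
          loads : ∀ i → (c - ρ * ∑ σ) * toℚ (J i) + lsum (load i) (extra ++ L) ≡ y i
          loads i = trans (cong (λ u → (c - ρ * ∑ σ) * toℚ (J i) + u)
            (trans (lsum-++ (load i) extra L) (cong (_+ lsum (load i) L) (extra-load i))))
            (ring c (ρ * ∑ σ) (toℚ (J i)) (y i) (lsum (load i) L))
            where
            ring : ∀ c S j y l → (c - S) * j + (S * j + (y - (c * j + l)) + l) ≡ y
            ring = solve-∀ ℚ-ring

open import Defs using (δ)

-- Edges of K_n among the n * n ordered pairs of nodes

even⇒2∣ : ∀ k → odd k ≡ false → 2 ∣ k
even⇒2∣ zero          _ = divides 0 refl
even⇒2∣ (suc (suc k)) h with even⇒2∣ k (trans (sym (BP.not-involutive (odd k))) h)
... | divides q eq = divides (suc q) (cong (λ m → suc (suc m)) eq)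

sum≡lsum : ∀ {A : Set} (f : A → ℚ) (L : List A) → sumℚ (map f L) ≡ lsum f L
sum≡lsum f []      = refl
sum≡lsum f (a ∷ L) = cong (f a +_) (sum≡lsum f L)

lsum-concatMap : ∀ {A B : Set} (f : B → ℚ) {P : B → Set} (P? : ∀ b → Dec (P b)) (g : A → List B)
  (L : List A) →
  lsum f (filter P? (concatMap g L)) ≡ lsum (λ a → lsum f (filter P? (g a))) L
lsum-concatMap f P? g [] = refl
lsum-concatMap f P? g (a ∷ L) = trans (cong (lsum f) (LP.filter-++ P? (g a) (concatMap g L)))
  (trans (lsum-++ f (filter P? (g a)) (filter P? (concatMap g L)))
    (cong (λ u → lsum f (filter P? (g a)) + u) (lsum-concatMap f P? g L)))

opaque
  unfolding ∑
  ∑-append : ∀ a {b} (f : Fin (a ℕ.+ b) → ℚ) → ∑ f ≡ ∑ (λ i → f (i F.↑ˡ b)) + ∑ (λ j → f (a F.↑ʳ j))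
  ∑-append zero    f = sym (ℚP.+-identityˡ (∑ f))
  ∑-append (suc a) f = trans (cong (f zero +_) (∑-append a (f ∘ suc))) (sym (ℚP.+-assoc (f zero) _ _))

  ∑-remQuot : ∀ m n (G : Fin m × Fin n → ℚ) → ∑ (λ k → G (F.remQuot {m} n k)) ≡ ∑ (λ i → ∑ (λ j → G (i , j)))
  ∑-remQuot zero    n G = refl
  ∑-remQuot (suc m) n G = trans (∑-append n (λ k → G (F.remQuot {suc m} n k)))
    (cong₂ _+_ (∑-cong first) (trans (∑-cong rest) (∑-remQuot m n (λ (i , j) → G (suc i , j)))))
    where
    first : ∀ j → G (F.remQuot {suc m} n (j F.↑ˡ (m ℕ.* n))) ≡ G (zero , j)
    first j rewrite FP.splitAt-↑ˡ n j (m ℕ.* n) = refl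
    rest : ∀ k → G (F.remQuot {suc m} n (n F.↑ʳ k)) ≡ G
      (suc (proj₁ (F.remQuot {m} n k)) , proj₂ (F.remQuot {m} n k))
    rest k rewrite FP.splitAt-↑ʳ n (m ℕ.* n) k = refl

orderedPair : ∀ {n} (i j : Fin n) → Dec (i F.< j) → List (Edge n)
orderedPair i j (yes p) = ((i , j) , p) ∷ []
orderedPair i j (no _)  = []

-- The enumeration of pairs in allEdges is a local definition that cannot be named, so the type of
-- pick≡ is left to be inferred from its use.
mutual
  allEdges≡ : ∀ n → allEdges n ≡ concatMap (λ i → concatMap (λ j → orderedPair i j (i F.<? j)) (allFin n))
    (allFin n)
  allEdges≡ n = LP.concatMap-cong (λ i → LP.concatMap-cong (λ j → pick≡ i j) (allFin n)) (allFin n)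

  pick≡ : ∀ {n} (i j : Fin n) → _
  pick≡ i j with i F.<? j
  ... | yes p = refl
  ... | no _  = refl

module Pairs (n : ℕ) where

  s t : Fin (n ℕ.* n) → Fin n
  s k = proj₁ (F.remQuot {n} n k)
  t k = proj₂ (F.remQuot {n} n k)

  code : Fin n → Fin n → Fin (n ℕ.* n)
  code i j = F.combine i j

  edge : Fin n → Fin n → Fin (n ℕ.* n)
  edge a b = if does (a F.<? b) then code a b else code b a

  s-code : ∀ i j → s (code i j) ≡ i
  s-code i j = cong proj₁ (FP.remQuot-combine i j)

  t-code : ∀ i j → t (code i j) ≡ j
  t-code i j = cong proj₂ (FP.remQuot-combine i j)

  ends : ∀ a b → a ≢ b → (s (edge a b) ≡ a × t (edge a b) ≡ b) ⊎ (s (edge a b) ≡ b × t (edge a b) ≡ a)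
  ends a b _ with does (a F.<? b)
  ... | true  = inj₁ (s-code a b , t-code a b)
  ... | false = inj₂ (s-code b a , t-code b a)

  index : Edge n → Fin (n ℕ.* n)
  index e = code (end₁ e) (end₂ e)

  -- A pair that is not increasing codes no edge. The default value zero keeps it out of every cut
  -- value and, through `cone-support`, out of the points of the combination.
  at : (Edge n → ℚ) → (p : Fin n × Fin n) → Dec (proj₁ p F.< proj₂ p) → ℚ
  at f p (yes h) = f (p , h)
  at f p (no _)  = 0ℚ

  onPair : (Edge n → ℚ) → Fin n × Fin n → ℚ
  onPair f p = at f p (proj₁ p F.<? proj₂ p)

  lift : (Edge n → ℚ) → Vec (n ℕ.* n)
  lift f k = onPair f (F.remQuot {n} n k)

  Real : Fin (n ℕ.* n) → Set
  Real k = s k F.< t k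

  real-edge : ∀ k → Real k → Edge n
  real-edge k h = F.remQuot {n} n k , h

  onPair-edge : ∀ f e → onPair f (proj₁ e) ≡ f e
  onPair-edge f (p , h) = by (proj₁ p F.<? proj₂ p)
    where
    by : ∀ d → at f p d ≡ f (p , h)
    by (yes h′) = cong (λ q → f (p , q)) (FP.<-irrelevant h′ h)
    by (no q)   = ⊥-elim (q h)

  lift-index : ∀ f e → lift f (index e) ≡ f e
  lift-index f e = trans (cong (onPair f) (FP.remQuot-combine (end₁ e) (end₂ e))) (onPair-edge f e)

  lift-real : ∀ f k (h : Real k) → lift f k ≡ f (real-edge k h)
  lift-real f k h = onPair-edge f (real-edge k h)

  lift-unreal : ∀ f k → ¬ Real k → lift f k ≡ 0ℚ
  lift-unreal f k h = by (s k F.<? t k)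
    where
    by : ∀ d → at f (F.remQuot {n} n k) d ≡ 0ℚ
    by (yes q) = ⊥-elim (h q)
    by (no _)  = refl

  real⇒index : ∀ k (h : Real k) → index (real-edge k h) ≡ k
  real⇒index k h = FP.combine-remQuot {n} n k

  δ-sum : ∀ f U → sumℚ (map f (δ U)) ≡ cutval s t (lift f) U
  δ-sum f U = trans (sum≡lsum f (δ U)) (trans (cong (λ L → lsum f (filter P? L)) (allEdges≡ n))
    (trans (lsum-concatMap f P? (λ i → concatMap (λ j → orderedPair i j (i F.<? j)) (allFin n)) (allFin n))
    (trans (lsum-cong (allFin n) (λ i → trans
      (lsum-concatMap f P? (λ j → orderedPair i j (i F.<? j)) (allFin n)) (lsum-tabulate _ (λ j → j))))
    (trans (lsum-tabulate _ (λ i → i))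
      (trans (∑-cong (λ i → ∑-cong (λ j → term i j (i F.<? j))))
        (sym (∑-remQuot n n (λ p → ⟦ U (proj₁ p) xor U (proj₂ p) ⟧ * onPair f p))))))))
    where
    P? : ∀ e → Dec ((U (end₁ e) xor U (end₂ e)) ≡ true)
    P? e = (U (end₁ e) xor U (end₂ e)) B.≟ true
    term : ∀ i j d → lsum f (filter P? (orderedPair i j d)) ≡ ⟦ U i xor U j ⟧ * at f (i , j) d
    term i j (no _) = sym (ℚP.*-zeroʳ ⟦ U i xor U j ⟧)
    term i j (yes p) with U i xor U j
    ... | true  = trans (ℚP.+-identityʳ (f ((i , j) , p))) (sym (ℚP.*-identityˡ (f ((i , j) , p))))
    ... | false = sym (ℚP.*-zeroˡ (f ((i , j) , p)))

  singleton≡ : ∀ v w → singleton v w ≡ single s t v w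
  singleton≡ v w with v F.≟ w
  ... | yes refl = sym (==-refl v)
  ... | no h     = sym (==-≢ (h ∘ sym))

  δ-node : ∀ f v → sumℚ (map f (δ (singleton v))) ≡ cutval s t (lift f) (single s t v)
  δ-node f v = trans (δ-sum f (singleton v)) (cutval-cong s t {lift f} (singleton≡ v))

  open Squares s t edge ends using (Has)
  open SquarePoints s t edge ends using (Structure; EvenConnected)
  open TurnedSquares s t edge ends using (structure-tours)

  joins⇒edge : ∀ {k u v} (h : Real k) → Joins (real-edge k h) u v → k ≡ edge u v
  joins⇒edge {k} h (inj₁ (refl , refl)) = by (s k F.<? t k)
    where
    by : (d : Dec (s k F.< t k)) → k ≡ (if does d then code (s k) (t k) else code (t k) (s k))
    by (yes _) = sym (FP.combine-remQuot {n} n k)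
    by (no q)  = ⊥-elim (q h)
  joins⇒edge {k} h (inj₂ (refl , refl)) = by (t k F.<? s k)
    where
    by : (d : Dec (t k F.< s k)) → k ≡ (if does d then code (t k) (s k) else code (s k) (t k))
    by (yes q) = ⊥-elim (FP.<-asym q h)
    by (no _)  = sym (FP.combine-remQuot {n} n k)

  edge⇒joins : ∀ {u v} → u ≢ v → Σ[ h ∈ Real (edge u v) ] Joins (real-edge (edge u v) h) u v
  edge⇒joins {u} {v} ne = by (u F.<? v)
    where
    by : (d : Dec (u F.< v)) → let k = if does d then code u v else code v u in Σ[ h ∈ Real k ] Joins (real-edge k h) u v
    by (yes p) = subst₂ F._<_ (sym (s-code u v)) (sym (t-code u v)) p , inj₁ (s-code u v , t-code u v)
    by (no q)  = subst₂ F._<_ (sym (s-code v u)) (sym (t-code v u)) (FP.≤∧≢⇒< (ℕP.≮⇒≥ q) (ne ∘ sym)) , inj₂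
      (s-code v u , t-code v u)

  quad⇒has : ∀ {k q} (h : Real k) → EdgeOfQuad (real-edge k h) q → Has k q
  quad⇒has h (inj₁ j) = inj₁ (joins⇒edge h j)
  quad⇒has h (inj₂ (inj₁ j)) = inj₂ (inj₁ (joins⇒edge h j))
  quad⇒has h (inj₂ (inj₂ (inj₁ j))) = inj₂ (inj₂ (inj₁ (joins⇒edge h j)))
  quad⇒has h (inj₂ (inj₂ (inj₂ j))) = inj₂ (inj₂ (inj₂ (joins⇒edge h j)))

  has⇒quad : ∀ {k q} → Distinct4 q → Has k q → Σ[ h ∈ Real k ] EdgeOfQuad (real-edge k h) q
  has⇒quad ((ab ∷ ac ∷ ad ∷ []) ∷ (bc ∷ bd ∷ []) ∷ (cd ∷ []) ∷ _) (inj₁ refl) = let (h , j) = edge⇒joins ab in h , inj₁ j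
  has⇒quad ((ab ∷ ac ∷ ad ∷ []) ∷ (bc ∷ bd ∷ []) ∷ (cd ∷ []) ∷ _) (inj₂ (inj₁ refl)) = let (h , j) = edge⇒joins bc in h , inj₂ (inj₁ j)
  has⇒quad ((ab ∷ ac ∷ ad ∷ []) ∷ (bc ∷ bd ∷ []) ∷ (cd ∷ []) ∷ _) (inj₂ (inj₂ (inj₁ refl))) = let (h , j) = edge⇒joins cd in h , inj₂ (inj₂ (inj₁ j))
  has⇒quad ((ab ∷ ac ∷ ad ∷ []) ∷ (bc ∷ bd ∷ []) ∷ (cd ∷ []) ∷ _) (inj₂ (inj₂ (inj₂ refl))) = let (h , j) = edge⇒joins (ad ∘ sym) in h , inj₂ (inj₂ (inj₂ j))

  square⇒structure : ∀ x (sq : SquarePoint n x) → Structure (lift x) (proj₁ (proj₂ (proj₂ sq)))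
  square⇒structure x ((degree , cut , _) , halfInt , Q , dist , disj , half) = record
    { distinct = dist
    ; disjoint = disj
    ; values   = λ k → by k (s k F.<? t k)
    ; half⇒    = λ k e → to k e (s k F.<? t k)
    ; ⇒half    = from
    ; degrees  = λ v → trans (sym (δ-node x v)) (degree v)
    ; cuts     = λ U v w a b → subst (toℚ 2 ≤_) (δ-sum x U) (cut U (v , a) (w , b))
    }
    where
    by : ∀ k → Dec (Real k) → lift x k ≡ 0ℚ ⊎ lift x k ≡ ½ ⊎ lift x k ≡ 1ℚ
    by k (yes h) = subst (λ q → q ≡ 0ℚ ⊎ q ≡ ½ ⊎ q ≡ 1ℚ) (sym (lift-real x k h)) (halfInt (real-edge k h))
    by k (no h)  = inj₁ (lift-unreal x k h)
    to : ∀ k → lift x k ≡ ½ → Dec (Real k) → Any (Has k) Q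
    to k e (yes h) = Any.map (λ {q} → quad⇒has {q = q} h)
      (Equivalence.to (half (real-edge k h)) (trans (sym (lift-real x k h)) e))
    to k e (no h)  = ⊥-elim (½≢0 (trans (sym e) (lift-unreal x k h)))
      where
      ½≢0 : ½ ≢ 0ℚ
      ½≢0 ()
    from : ∀ k → Any (Has k) Q → lift x k ≡ ½
    from k m = let (q , mq , hq) = find m
                   (h , eq) = has⇒quad {q = q} (All.lookup dist mq) hq
               in trans (lift-real x k h) (Equivalence.from (half (real-edge k h)) (lose mq eq))

  edges-of : (Fin (n ℕ.* n) → ℕ) → Multiset n
  edges-of J e = J (index e)

  Supported : (Fin (n ℕ.* n) → ℕ) → Set
  Supported J = EvenConnected J × (∀ k → ¬ Real k → J k ≡ 0)

  reach-trans : ∀ {m : Multiset n} {u v w} → Reach m u v → Reach m v w → Reach m u w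
  reach-trans Reach.here           q = q
  reach-trans (Reach.step e j p r) q = Reach.step e j p (reach-trans r q)

  reach-sym : ∀ {m : Multiset n} {u v} → Reach m u v → Reach m v u
  reach-sym Reach.here = Reach.here
  reach-sym (Reach.step e j p r) = reach-trans (reach-sym r) (Reach.step e (flip j) p Reach.here)
    where
    flip : ∀ {u w} → Joins e u w → Joins e w u
    flip (inj₁ (a , b)) = inj₂ (a , b)
    flip (inj₂ (a , b)) = inj₁ (a , b)

  -- Walks come from `J`, whose edges all occur in `J′`, and degrees have the parities of `J`.
  augmented-tour : ∀ {J′} → Augments Supported J′ → IsTour n (edges-of J′)
  augmented-tour {J′} (J , ((conn , even) , supp) , below , same) = connected , even-degree
    where
    X : Row (n ℕ.* n)
    X k = does (1 ℕP.≤? J k)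
    does-true : ∀ {P : Set} (d : Dec P) → P → does d ≡ true
    does-true (yes _) _ = refl
    does-true (no q)  p = ⊥-elim (q p)
    true-does : ∀ {P : Set} (d : Dec P) → does d ≡ true → P
    true-does (yes p) _ = p
    toX : ∀ {k} → 1 ℕ.≤ J k → X k ≡ true
    toX {k} = does-true (1 ℕP.≤? J k)
    fromX : ∀ k → X k ≡ true → 1 ℕ.≤ J k
    fromX k = true-does (1 ℕP.≤? J k)
    along : ∀ k → Dec (Real k) → 1 ℕ.≤ J k → Reach (edges-of J′) (s k) (t k)
    along k (yes h) p = Reach.step (real-edge k h) (inj₁ (refl , refl))
      (subst (λ i → ℕ.NonZero (J′ i)) (sym (real⇒index k h)) (ℕ.>-nonZero (ℕP.≤-trans p (below k))))
        Reach.here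
    along k (no h) p = ⊥-elim (ℕP.<-irrefl refl (ℕP.≤-trans p (ℕP.≤-reflexive (supp k h))))
    connected : Connected (edges-of J′)
    connected = connected⇒related s t {X} (λ U v w a b → let (e , p , c) = conn U v w a b in e , toX p , c)
      (Reach (edges-of J′)) Reach.here reach-sym reach-trans (λ k h → along k (s k F.<? t k) (fromX k h))
    -- Augmentation may put copies on pairs that code no edge; they are masked here. This changes no
    -- parity, because `J` vanishes on such pairs and `J′` is even there.
    real : Fin (n ℕ.* n) → ℕ
    real k = if does (s k F.<? t k) then J′ k else 0
    real-lift : ∀ k → lift (λ e → toℚ (edges-of J′ e)) k ≡ toℚ (real k)
    real-lift k = go (s k F.<? t k)
      where
      go : ∀ d → at (λ e → toℚ (edges-of J′ e)) (F.remQuot {n} n k) d ≡ toℚ (if does d then J′ k else 0)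
      go (yes h) = cong (λ i → toℚ (J′ i)) (real⇒index k h)
      go (no _)  = refl
    real-odd : ∀ k → odd (real k) ≡ odd (J k)
    real-odd k = go (s k F.<? t k)
      where
      go : (d : Dec (Real k)) → odd (if does d then J′ k else 0) ≡ odd (J k)
      go (yes _) = same k
      go (no h)  = cong odd (sym (supp k h))
    toℚ-sum : ∀ {A : Set} (f : A → ℕ) L → toℚ (sumℕ (map f L)) ≡ sumℚ (map (λ a → toℚ (f a)) L)
    toℚ-sum f []      = refl
    toℚ-sum f (a ∷ L) = trans (toℚ-+ (f a) (sumℕ (map f L))) (cong (λ u → toℚ (f a) + u) (toℚ-sum f L))
    degree : ∀ v → deg (edges-of J′) v ≡ cutcount s t real (single s t v)
    degree v = toℚ-injective (trans (toℚ-sum (edges-of J′) (δ (singleton v)))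
      (trans (δ-node (λ e → toℚ (edges-of J′ e)) v)
      (trans (∑-cong (λ k → cong (⟦ cross s t (single s t v) k ⟧ *_) (real-lift k)))
        (cutval-toℚ s t real (single s t v)))))
    even-degree : ∀ v → 2 ∣ deg (edges-of J′) v
    even-degree v = even⇒2∣ _ (trans (cong odd (degree v)) (trans (odd-cutcount s t real (single s t v))
      (trans (⨁-cong (λ k → cong (_∧ cross s t (single s t v) k) (real-odd k))) (even (single s t v)))))

  dominated⇒polytope : ∀ y → Cone EvenConnected 1ℚ (lift y) → InTourPolytope n y
  dominated⇒polytope y C = convert
    (exact (cone-map (λ (tour , zero-off) → tour , λ k h → zero-off k (lift-unreal y k h)) (cone-support C)))
    where
    convert : Σ[ L ∈ Weighted ] All (λ p → 0ℚ ≤ proj₁ p × Augments Supported (proj₂ p)) L × lsum weight L ≡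
      1ℚ × (∀ k → lsum (load k) L ≡ lift y k) →
      InTourPolytope n y
    convert (L , good , total , loads) = map decode L , AllP.map⁺
      (All.map (λ { {c , J} (p , a) → p , augmented-tour {J} a }) good) ,
        trans (cong sumℚ (sym (LP.map-∘ L))) (trans (sum≡lsum weight L) total) ,
        λ e → trans (cong sumℚ (sym (LP.map-∘ L)))
          (trans (sum≡lsum (load (index e)) L) (trans (loads (index e)) (lift-index y e)))
      where
      decode : ℚ × (Fin (n ℕ.* n) → ℕ) → ℚ × Multiset n
      decode (c , J) = c , edges-of J

  lift-scale : ∀ r x k → r * lift x k ≡ lift (λ e → r * x e) k
  lift-scale r x k = by (s k F.<? t k)
    where
    by : ∀ d → r * at x (F.remQuot {n} n k) d ≡ at (λ e → r * x e) (F.remQuot {n} n k) d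
    by (yes _) = refl
    by (no _)  = ℚP.*-zeroʳ r

  square-tours : ∀ x → SquarePoint n x → InTourPolytope n (λ e → (ℤ.+ 10 / 7) * x e)
  square-tours x sq = dominated⇒polytope (λ e → (ℤ.+ 10 / 7) * x e)
    (cone-up (structure-tours (square⇒structure x sq)) (λ k → ℚP.≤-reflexive (lift-scale (ℤ.+ 10 / 7) x k)))

open import Defs
open import Data.Nat using (ℕ; _≥_)
open import Data.Integer using (+_)
open import Data.Rational using (ℚ; _/_; _*_)

theorem8 : (n : ℕ) → n ≥ 3 → (x : Edge n → ℚ) → SquarePoint n x →
    InTourPolytope n (λ e → (+ 10 / 7) * x e)
theorem8 n _ x sq = Pairs.square-tours n x sq
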